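{- Let $n$ be a positive integer and $X=\{x_1,\ldots,x_n\}$. For a nonempty subset $S\subseteq[n]$ put $X_S=\sum_{i\in S}x_i$. For integers $1\le k\le n$ define \[ B_{n,k}(X)=\prod_{S\subseteq[n],\,|S|=k} X_S,\qquad B_n(X)=\prod_{k=1}^n B_{n,k}(X). \] Then for any positive integers $k\le n$, $B_{n,k}(X)$ is Schur-positive, i.e. there exist nonnegative integers $\kappa^{(n,k)}_\lambda$ such that \[ B_{n,k}(X)=\sum_{\lambda}\kappa^{(n,k)}_\lambda s_\lambda(x_1,\ldots,x_n). \] Furthermore, $B_n(X)$ is Schur-positive, i.e. it is a linear combination of the Schur polynomials $s_\lambda(x_1,\ldots,x_n)$ with nonnegative integer coefficients.
   Context: $s_\lambda(x_1,\ldots,x_n)$ denotes the Schur polynomial in $n$ variables indexed by the partition $\lambda$, i.e. the sum of $x^{T}$ over semistandard Young tableaux $T$ of shape $\lambda$ with entries in $[n]$. -}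

module Defs where

open import Data.Nat using (ℕ; zero; suc; _+_; _≤_; _≤ᵇ_; _<ᵇ_)
import Data.Nat as N
open import Data.Bool using (Bool; true; false; _∧_; if_then_else_)
open import Data.List using (List; []; _∷_; [_]; map; concat; concatMap; replicate; foldr; filter; filterᵇ; length; zipWith; upTo; _++_)
open import Data.List.Relation.Unary.All using (All)
open import Data.Bool.ListAction using (and)
open import Data.List.Relation.Unary.Linked using (Linked)
open import Data.Vec using (Vec; lookup; tabulate)
import Data.Vec as V
open import Data.Vec.Properties using (≡-dec)
open import Data.Fin using (Fin; toℕ)
open import Data.Fin.Properties using () renaming (_≟_ to _≟F_)
open import Data.Fin.Subset using (Subset; ∣_∣)
open import Data.List using (allFin)
open import Data.Product using (_×_; _,_; ∃-syntax)
open import Relation.Nullary using (does)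
open import Relation.Binary.PropositionalEquality using (_≡_)

-- Polynomials in x_1..x_n with nonnegative integer coefficients.
-- A monomial x^α is its exponent vector α : Vec ℕ n (variable x_{i+1} ↔ i : Fin n).
-- A polynomial is a formal sum of monomials (a finite list; the
-- coefficient of x^α is the number of occurrences of α).

Mono : ℕ → Set
Mono n = Vec ℕ n

Poly : ℕ → Set
Poly n = List (Mono n)

oneM : ∀ {n} → Mono n
oneM = V.replicate _ 0

_*M_ : ∀ {n} → Mono n → Mono n → Mono n
_*M_ = V.zipWith _+_

var : ∀ {n} → Fin n → Mono n
var i = tabulate (λ j → if does (i ≟F j) then 1 else 0)

oneP : ∀ {n} → Poly n
oneP = [ oneM ]

_+P_ : ∀ {n} → Poly n → Poly n → Poly n
_+P_ = _++_

_*P_ : ∀ {n} → Poly n → Poly n → Poly n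
p *P q = concatMap (λ a → map (a *M_) q) p

prodP : ∀ {n} → List (Poly n) → Poly n
prodP = foldr _*P_ oneP

scaleP : ∀ {n} → ℕ → Poly n → Poly n
scaleP κ p = concat (replicate κ p)

coeff : ∀ {n} → Mono n → Poly n → ℕ
coeff α p = length (filter (λ β → ≡-dec N._≟_ β α) p)

_≈P_ : ∀ {n} → Poly n → Poly n → Set
p ≈P q = ∀ α → coeff α p ≡ coeff α q

allSubsets : ∀ n → List (Subset n)
allSubsets zero = [ V.[] ]
allSubsets (suc n) = concatMap (λ s → (true V.∷ s) ∷ (false V.∷ s) ∷ []) (allSubsets n)

XS : ∀ {n} → Subset n → Poly n
XS {n} S = concatMap (λ i → if lookup S i then [ var i ] else []) (allFin n)

B : ∀ n → ℕ → Poly n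
B n k = prodP (map XS (filter (λ S → ∣ S ∣ N.≟ k) (allSubsets n)))

Bn : ∀ n → Poly n
Bn n = prodP (map (λ k → B n (suc k)) (upTo n))

IsPartition : List ℕ → Set
IsPartition λ′ = All (λ x → 1 ≤ x) λ′ × Linked (λ a b → b ≤ a) λ′

words : ∀ {n} → ℕ → List (List (Fin n))
words {n} zero = [ [] ]
words {n} (suc r) = concatMap (λ i → map (i ∷_) (words r)) (allFin n)

fillings : ∀ {n} → List ℕ → List (List (List (Fin n)))
fillings [] = [ [] ]
fillings (r ∷ rs) = concatMap (λ row → map (row ∷_) (fillings rs)) (words r)

rowWeak : ∀ {n} → List (Fin n) → Bool
rowWeak [] = true
rowWeak (a ∷ []) = true
rowWeak (a ∷ b ∷ r) = (toℕ a ≤ᵇ toℕ b) ∧ rowWeak (b ∷ r)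

colStrict : ∀ {n} → List (Fin n) → List (Fin n) → Bool
colStrict upper lower = and (zipWith (λ a b → toℕ a <ᵇ toℕ b) upper lower)

isSSYT : ∀ {n} → List (List (Fin n)) → Bool
isSSYT [] = true
isSSYT (r ∷ []) = rowWeak r
isSSYT (r ∷ s ∷ t) = rowWeak r ∧ colStrict r s ∧ isSSYT (s ∷ t)

weight : ∀ {n} → List (List (Fin n)) → Mono n
weight T = foldr (λ a m → var a *M m) oneM (concat T)

schur : ∀ n → List ℕ → Poly n
schur n λ′ = map weight (filterᵇ isSSYT (fillings {n} λ′))

SchurPositive : ∀ n → Poly n → Set
SchurPositive n p =
  ∃[ c ] (All (λ (lk : List ℕ × ℕ) → IsPartition (Data.Product.proj₁ lk)) c
         × p ≈P foldr (λ { (λ′ , κ) acc → scaleP κ (schur n λ′) +P acc }) [] c)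

{-# OPTIONS --safe #-}
module Submission where

-- Write P for the product of the X_S over a family of subsets S stable under permuting the letters,
-- and V for the span of the corresponding wedges of basis vectors. The coefficient of s_λ in P is that
-- of x^(λ+δ) in a_δ P, where a_δ is the Vandermonde product. Lift P to the polynomial
-- F(X) = det(ρ(X)) on n × n matrices, ρ being the action of gl_n on V, so that P is the restriction of
-- F to diagonal matrices. F is invariant under conjugation, and its derivatives at 0 form Gram matrices:
-- ∂(i₁j₁) ⋯ ∂(iᵣjᵣ) F = Σ_T Ω(i₁T₁, …, iᵣTᵣ) Ω(j₁T₁, …, jᵣTᵣ), where Ω is the volume form of V.
--
-- By Harish-Chandra's argument, multiplication by a_δ turns Σ ∂ᵢⱼ ∂ⱼᵢ into the Laplacian of the
-- diagonal variables; commuting it n times with det X shows that it turns Cayley's operator det(∂) into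
-- ∂₁ ⋯ ∂ₙ. Applying these operators strips the columns of λ one by one and preserves both the
-- invariance and the Gram property, and what is left at the end is a positive multiple of the
-- coefficient in question and a sum of squares.
--
-- To expand P in Schur polynomials with these coefficients one removes one variable x₀ at a time:
-- dividing an alternating series by ∏ (x₀ − xⱼ) and cancelling pairs leaves the terms which interlace,
-- and the same interlacing shapes appear when the largest letter is removed from a semistandard tableau.

open import Defs
open import Data.Nat as ℕ using (ℕ; zero; suc; z≤n; s≤s; _≤ᵇ_; _<ᵇ_; _≤_)
open import Data.Integer as ℤ using (ℤ; 0ℤ; 1ℤ; _+_; _*_; -_; _-_; +≤+; +<+)
import Data.Integer.Properties as ℤP
open import Data.Integer.Tactic.RingSolver using (solve-∀)
open import Data.List using (List; []; _∷_; _++_; map; concatMap; length; foldr; upTo; [_]; replicate; concat; allFin; tabulate; filterᵇ; filter)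
open import Data.List.Relation.Binary.Permutation.Propositional using (_↭_; ↭-sym; ↭-trans; ↭-refl; prep; swap; refl; trans; ↭-reflexive; ↭⇒↭ₛ)
open import Data.List.Relation.Binary.Permutation.Propositional.Properties using (map⁺)
open import Data.Product using (_×_; _,_; proj₁; proj₂; ∃-syntax; Σ)
open import Data.Maybe using (Maybe; just; nothing)
open import Level using (0ℓ)
open import Function using (_∘_; id; mk⇔)
open import Relation.Nullary using (yes; no; ¬_; does; Dec)
open import Relation.Binary.PropositionalEquality using (_≡_; refl; sym; cong; cong₂; subst; module ≡-Reasoning; _≢_)
import Relation.Binary.PropositionalEquality as ≡
open import Algebra.Bundles using (CommutativeRing)
import Algebra.Solver.Ring
import Algebra.Solver.Ring.AlmostCommutativeRing as ACR
import Data.Nat.Properties as ℕP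
open import Data.List.Relation.Unary.All as All using (All; []; _∷_)
open import Data.List.Relation.Unary.AllPairs as AllPairs using (AllPairs; []; _∷_)
open import Data.List.Relation.Unary.Unique.Propositional using (Unique)
import Data.List.Relation.Unary.Unique.Propositional.Properties as UniqueP
import Data.List.Relation.Unary.All.Properties as AllP
open import Data.Fin using (Fin; zero; suc; toℕ; inject₁; fromℕ; opposite)
import Data.Fin.Properties as FinP
import Data.Product as Prod
open import Data.Empty using (⊥-elim; ⊥)
import Relation.Binary.Reasoning.Setoid
import Data.List.Properties as ListP
open import Data.List.Relation.Unary.Any as Any using (Any; here; there)
import Data.List.Relation.Binary.Permutation.Propositional.Properties as ↭P
open import Data.Sum using (_⊎_; inj₁; inj₂)
open import Data.List.Membership.Propositional using (_∈_; _∉_)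
open import Data.List.Membership.Propositional.Properties using (∈-∃++; ∈-++⁻; ∈-++⁺ˡ; ∈-++⁺ʳ; ∈-map⁺; ∈-map⁻; ∈-insert; ∈-filter⁺; ∈-filter⁻; ∈-concat⁺′; ∈-concat⁻′)
import Data.List.Membership.DecPropositional as DecMem
import Data.List.Relation.Unary.Any.Properties as AnyP
import Data.List.Relation.Unary.AllPairs.Properties as AllPairsP
import Data.List.Relation.Binary.Permutation.Setoid.Properties as ↭ₛP
open import Data.Bool using (if_then_else_; Bool; true; false; _∧_)
open import Data.Vec as V using (Vec; []; _∷_; _∷ʳ_; lookup)
import Data.Vec.Properties as VP
open import Data.Unit using (⊤; tt)
import Data.Nat.Tactic.RingSolver as ℕSolver
open import Data.Bool.ListAction using (and)
import Data.Bool.Properties as BoolP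
open import Data.List.Relation.Unary.Linked using (Linked; []; [-]; _∷_)
open import Data.List.Membership.Propositional.Properties.WithK using (unique∧set⇒bag)
open import Data.List.Relation.Binary.BagAndSetEquality using (∼bag⇒↭)
open import Data.Fin.Subset using (Subset; ∣_∣)

-- The coefficient of x^(λ+δ) in a_δ P is an alternating sum of coefficients of P, so its sign
-- cannot be read off on the diagonal. On matrices the signs disappear: the Taylor coefficients of F
-- form Gram matrices, and a contraction of two Gram matrices is again one. The product with a_δ
-- serves only to translate the operators on matrices into shifts of exponents on the diagonal.
-- Stability of the family is used twice: it makes P symmetric, and it makes V a gl_n-submodule, so
-- that the off-diagonal matrix units, having trace zero on V, kill the volume form. Everything
-- stays over ℤ: series are stored by their derivatives at 0, and the constants that arise, powers
-- of 2 and products of factorials, are positive and are cancelled rather than divided by. Since the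
-- sets S may differ in size, the vectors of V are encoded as forms on words of varying length.
-- Symmetric series and alternating forms are both functions on lists of letters, so one type serves
-- for F and for Ω.

private variable
  A C I J : Set
  n : ℕ

-- Finite sums of integers

∑ : List A → (A → ℤ) → ℤ
∑ []       f = 0ℤ
∑ (x ∷ xs) f = f x + ∑ xs f

∑-cong : ∀ (xs : List A) {f g : A → ℤ} → (∀ x → f x ≡ g x) → ∑ xs f ≡ ∑ xs g
∑-cong []       e = refl
∑-cong (x ∷ xs) e = cong₂ _+_ (e x) (∑-cong xs e)

∑-0 : ∀ (xs : List A) → ∑ xs (λ _ → 0ℤ) ≡ 0ℤ
∑-0 []       = refl
∑-0 (x ∷ xs) = ≡.trans (ℤP.+-identityˡ _) (∑-0 xs)

+-interchange : ∀ a b c d → (a + b) + (c + d) ≡ (a + c) + (b + d)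
+-interchange = solve-∀

∑-+ : ∀ (xs : List A) (f g : A → ℤ) → ∑ xs (λ x → f x + g x) ≡ ∑ xs f + ∑ xs g
∑-+ []       f g = refl
∑-+ (x ∷ xs) f g = ≡.trans (cong ((f x + g x) +_) (∑-+ xs f g)) (+-interchange (f x) (g x) _ _)

∑-*ˡ : ∀ (xs : List A) (c : ℤ) (f : A → ℤ) → ∑ xs (λ x → c * f x) ≡ c * ∑ xs f
∑-*ˡ []       c f = sym (ℤP.*-zeroʳ c)
∑-*ˡ (x ∷ xs) c f = ≡.trans (cong (c * f x +_) (∑-*ˡ xs c f)) (sym (ℤP.*-distribˡ-+ c (f x) _))

∑-*ʳ : ∀ (xs : List A) (c : ℤ) (f : A → ℤ) → ∑ xs (λ x → f x * c) ≡ ∑ xs f * c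
∑-*ʳ xs c f = ≡.trans (∑-cong xs (λ x → ℤP.*-comm (f x) c)) (≡.trans (∑-*ˡ xs c f) (ℤP.*-comm c _))

∑-neg : ∀ (xs : List A) (f : A → ℤ) → ∑ xs (λ x → - f x) ≡ - ∑ xs f
∑-neg []       f = refl
∑-neg (x ∷ xs) f = ≡.trans (cong (- f x +_) (∑-neg xs f)) (sym (ℤP.neg-distrib-+ (f x) _))

∑-++ : ∀ (xs ys : List A) (f : A → ℤ) → ∑ (xs ++ ys) f ≡ ∑ xs f + ∑ ys f
∑-++ []       ys f = sym (ℤP.+-identityˡ _)
∑-++ (x ∷ xs) ys f = ≡.trans (cong (f x +_) (∑-++ xs ys f)) (sym (ℤP.+-assoc (f x) _ _))

∑-map : ∀ (h : A → C) (xs : List A) (f : C → ℤ) → ∑ (map h xs) f ≡ ∑ xs (f ∘ h)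
∑-map h []       f = refl
∑-map h (x ∷ xs) f = cong (f (h x) +_) (∑-map h xs f)

∑-concatMap : ∀ (h : A → List C) (xs : List A) (f : C → ℤ) → ∑ (concatMap h xs) f ≡ ∑ xs (λ x → ∑ (h x) f)
∑-concatMap h []       f = refl
∑-concatMap h (x ∷ xs) f = ≡.trans (∑-++ (h x) (concatMap h xs) f) (cong (∑ (h x) f +_) (∑-concatMap h xs f))

∑-comm : ∀ (xs : List A) (ys : List C) (f : A → C → ℤ) →
         ∑ xs (λ x → ∑ ys (f x)) ≡ ∑ ys (λ y → ∑ xs (λ x → f x y))
∑-comm []       ys f = sym (∑-0 ys)
∑-comm (x ∷ xs) ys f = ≡.trans (cong (∑ ys (f x) +_) (∑-comm xs ys f)) (sym (∑-+ ys (f x) _))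

∑-zero : ∀ (xs : List A) {f : A → ℤ} → (∀ x → f x ≡ 0ℤ) → ∑ xs f ≡ 0ℤ
∑-zero xs e = ≡.trans (∑-cong xs e) (∑-0 xs)

-- The ring of exponential power series

-- Exponential power series in commuting variables indexed by I: F (p₁ ∷ … ∷ pₖ ∷ []) is the
-- value at 0 of ∂p₁⋯∂pₖ F, so that ∂p is prefixing and the Leibniz rule defines the product.

Ser : Set → Set
Ser I = List I → ℤ

D : I → Ser I → Ser I
D p F L = F (p ∷ L)

infixl 7 _⊛_
infixl 6 _⊕_ _⊖_
infix 4 _≋_

_≋_ : Ser I → Ser I → Set
F ≋ G = ∀ L → F L ≡ G L

_⊕_ : Ser I → Ser I → Ser I
(F ⊕ G) L = F L + G L

⊝_ : Ser I → Ser I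
(⊝ F) L = - F L

_⊖_ : Ser I → Ser I → Ser I
F ⊖ G = F ⊕ (⊝ G)

_⊛_ : Ser I → Ser I → Ser I
(F ⊛ G) []      = F [] * G []
(F ⊛ G) (p ∷ L) = (D p F ⊛ G) L + (F ⊛ D p G) L

con : ℤ → Ser I
con z []      = z
con z (_ ∷ _) = 0ℤ

lin : (I → ℤ) → Ser I
lin u []      = 0ℤ
lin u (p ∷ L) = con (u p) L

∑S : List A → (A → Ser I) → Ser I
∑S xs f L = ∑ xs (λ x → f x L)

≋-refl : {F : Ser I} → F ≋ F
≋-refl L = refl

≋-sym : {F G : Ser I} → F ≋ G → G ≋ F
≋-sym e L = sym (e L)

≋-trans : {F G H : Ser I} → F ≋ G → G ≋ H → F ≋ H
≋-trans e e′ L = ≡.trans (e L) (e′ L)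

⊕-cong : {F F′ G G′ : Ser I} → F ≋ F′ → G ≋ G′ → F ⊕ G ≋ F′ ⊕ G′
⊕-cong e e′ L = cong₂ _+_ (e L) (e′ L)

⊝-cong : {F F′ : Ser I} → F ≋ F′ → ⊝ F ≋ ⊝ F′
⊝-cong e L = cong -_ (e L)

⊖-cong : {F F′ G G′ : Ser I} → F ≋ F′ → G ≋ G′ → F ⊖ G ≋ F′ ⊖ G′
⊖-cong e e′ = ⊕-cong e (⊝-cong e′)

⊛-cong : {F F′ G G′ : Ser I} → F ≋ F′ → G ≋ G′ → F ⊛ G ≋ F′ ⊛ G′
⊛-cong e e′ []      = cong₂ _*_ (e []) (e′ [])
⊛-cong e e′ (p ∷ L) = cong₂ _+_ (⊛-cong (λ K → e (p ∷ K)) e′ L) (⊛-cong e (λ K → e′ (p ∷ K)) L)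

⊛-congˡ : {F G G′ : Ser I} → G ≋ G′ → F ⊛ G ≋ F ⊛ G′
⊛-congˡ e = ⊛-cong ≋-refl e

⊛-congʳ : {F F′ G : Ser I} → F ≋ F′ → F ⊛ G ≋ F′ ⊛ G
⊛-congʳ e = ⊛-cong e ≋-refl

⊛-comm : (F G : Ser I) → F ⊛ G ≋ G ⊛ F
⊛-comm F G []      = ℤP.*-comm (F []) (G [])
⊛-comm F G (p ∷ L) = ≡.trans (cong₂ _+_ (⊛-comm (D p F) G L) (⊛-comm F (D p G) L)) (ℤP.+-comm ((G ⊛ D p F) L) _)

⊛-distribʳ : (H F G : Ser I) → (F ⊕ G) ⊛ H ≋ (F ⊛ H) ⊕ (G ⊛ H)
⊛-distribʳ H F G []      = ℤP.*-distribʳ-+ (H []) (F []) (G [])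
⊛-distribʳ H F G (p ∷ L) =
  ≡.trans (cong₂ _+_ (⊛-distribʳ H (D p F) (D p G) L) (⊛-distribʳ (D p H) F G L))
        (+-interchange ((D p F ⊛ H) L) _ _ _)

⊛-distribˡ : (H F G : Ser I) → H ⊛ (F ⊕ G) ≋ (H ⊛ F) ⊕ (H ⊛ G)
⊛-distribˡ H F G = ≋-trans (⊛-comm H (F ⊕ G)) (≋-trans (⊛-distribʳ H F G) (⊕-cong (⊛-comm F H) (⊛-comm G H)))

⊛-zeroˡ : (F : Ser I) → (λ _ → 0ℤ) ⊛ F ≋ (λ _ → 0ℤ)
⊛-zeroˡ F []      = ℤP.*-zeroˡ (F [])
⊛-zeroˡ F (p ∷ L) = cong₂ _+_ (⊛-zeroˡ F L) (⊛-zeroˡ (D p F) L)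

⊛-con : (z : ℤ) (F : Ser I) → con z ⊛ F ≋ (λ L → z * F L)
⊛-con z F []      = refl
⊛-con z F (p ∷ L) = ≡.trans (cong₂ _+_ (⊛-zeroˡ F L) (⊛-con z (D p F) L)) (ℤP.+-identityˡ _)

con-1-identityˡ : (F : Ser I) → con 1ℤ ⊛ F ≋ F
con-1-identityˡ F = ≋-trans (⊛-con 1ℤ F) (λ L → ℤP.*-identityˡ (F L))

⊛-assoc : (F G H : Ser I) → (F ⊛ G) ⊛ H ≋ F ⊛ (G ⊛ H)
⊛-assoc F G H []      = ℤP.*-assoc (F []) (G []) (H [])
⊛-assoc F G H (p ∷ L) = begin
  ((D p F ⊛ G ⊕ F ⊛ D p G) ⊛ H) L + (F ⊛ G ⊛ D p H) L
    ≡⟨ cong₂ _+_ (⊛-distribʳ H (D p F ⊛ G) (F ⊛ D p G) L) (⊛-assoc F G (D p H) L) ⟩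
  ((D p F ⊛ G ⊛ H) L + (F ⊛ D p G ⊛ H) L) + (F ⊛ (G ⊛ D p H)) L
    ≡⟨ cong (_+ (F ⊛ (G ⊛ D p H)) L) (cong₂ _+_ (⊛-assoc (D p F) G H L) (⊛-assoc F (D p G) H L)) ⟩
  ((D p F ⊛ (G ⊛ H)) L + (F ⊛ (D p G ⊛ H)) L) + (F ⊛ (G ⊛ D p H)) L
    ≡⟨ ℤP.+-assoc ((D p F ⊛ (G ⊛ H)) L) _ _ ⟩
  (D p F ⊛ (G ⊛ H)) L + ((F ⊛ (D p G ⊛ H)) L + (F ⊛ (G ⊛ D p H)) L)
    ≡⟨ cong ((D p F ⊛ (G ⊛ H)) L +_) (sym (⊛-distribˡ F (D p G ⊛ H) (G ⊛ D p H) L)) ⟩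
  (D p F ⊛ (G ⊛ H)) L + (F ⊛ (D p G ⊛ H ⊕ G ⊛ D p H)) L ∎
  where open ≡-Reasoning

serRing : Set → CommutativeRing 0ℓ 0ℓ
serRing I = record
  { Carrier = Ser I ; _≈_ = _≋_ ; _+_ = _⊕_ ; _*_ = _⊛_ ; -_ = ⊝_
  ; 0# = λ _ → 0ℤ ; 1# = con 1ℤ
  ; isCommutativeRing = record
    { isRing = record
      { +-isAbelianGroup = record
        { isGroup = record
          { isMonoid = record
            { isSemigroup = record
              { isMagma = record
                { isEquivalence = record { refl = ≋-refl ; sym = ≋-sym ; trans = ≋-trans }
                ; ∙-cong = ⊕-cong }
              ; assoc = λ F G H L → ℤP.+-assoc (F L) (G L) (H L) }
            ; identity = (λ F L → ℤP.+-identityˡ (F L)) , (λ F L → ℤP.+-identityʳ (F L)) }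
          ; inverse = (λ F L → ℤP.+-inverseˡ (F L)) , (λ F L → ℤP.+-inverseʳ (F L))
          ; ⁻¹-cong = ⊝-cong }
        ; comm = λ F G L → ℤP.+-comm (F L) (G L) }
      ; *-cong = ⊛-cong
      ; *-assoc = ⊛-assoc
      ; *-identity = con-1-identityˡ , λ F → ≋-trans (⊛-comm F (con 1ℤ)) (con-1-identityˡ F)
      ; distrib = ⊛-distribˡ , ⊛-distribʳ }
    ; *-comm = ⊛-comm } }

con-+ : ∀ x y → con {I} (x + y) ≋ con x ⊕ con y
con-+ x y []      = refl
con-+ x y (_ ∷ _) = refl

con-* : ∀ x y → con {I} (x * y) ≋ con x ⊛ con y
con-* x y []      = refl
con-* x y (p ∷ L) = sym (≡.trans (cong₂ _+_ (⊛-zeroˡ (con y) L) (≡.trans (⊛-con x _ L) (ℤP.*-zeroʳ x))) refl)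

con-neg : ∀ x → con {I} (- x) ≋ ⊝ con x
con-neg x []      = refl
con-neg x (_ ∷ _) = refl

module SerSolver (I : Set) where
  private
    ring : ACR.AlmostCommutativeRing 0ℓ 0ℓ
    ring = ACR.fromCommutativeRing (serRing I)

    constants : CommutativeRing.rawRing ℤP.+-*-commutativeRing ACR.-Raw-AlmostCommutative⟶ ring
    constants = record
      { ⟦_⟧ = con ; +-homo = con-+ ; *-homo = con-* ; -‿homo = con-neg
      ; 0-homo = λ { [] → refl ; (_ ∷ _) → refl } ; 1-homo = ≋-refl }

    con≟ : ∀ x y → Maybe (con {I} x ≋ con y)
    con≟ x y with x ℤP.≟ y
    ... | yes e = just (λ L → cong (λ z → con z L) e)
    ... | no _  = nothing

  open Algebra.Solver.Ring (CommutativeRing.rawRing ℤP.+-*-commutativeRing) ring constants con≟ public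

D-lin : ∀ (u : I → ℤ) (F : Ser I) p → D p (lin u ⊛ F) ≋ (λ L → u p * F L + (lin u ⊛ D p F) L)
D-lin u F p L = cong (_+ (lin u ⊛ D p F) L) (⊛-con (u p) F L)

∑S-cong : ∀ (xs : List A) {f g : A → Ser I} → (∀ x → f x ≋ g x) → ∑S xs f ≋ ∑S xs g
∑S-cong xs e L = ∑-cong xs (λ x → e x L)

⊛-∑ˡ : ∀ (xs : List A) (f : A → Ser I) (G : Ser I) → ∑S xs f ⊛ G ≋ ∑S xs (λ x → f x ⊛ G)
⊛-∑ˡ []       f G = ⊛-zeroˡ G
⊛-∑ˡ (x ∷ xs) f G = ≋-trans (⊛-distribʳ G (f x) (∑S xs f)) (⊕-cong {F = f x ⊛ G} ≋-refl (⊛-∑ˡ xs f G))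

⊛-∑ʳ : ∀ (xs : List A) (F : Ser I) (g : A → Ser I) → F ⊛ ∑S xs g ≋ ∑S xs (λ x → F ⊛ g x)
⊛-∑ʳ xs F g = ≋-trans (⊛-comm F (∑S xs g)) (≋-trans (⊛-∑ˡ xs g F) (∑S-cong xs (λ x → ⊛-comm (g x) F)))

-- Substitutions, and series with commuting derivatives

_^*_ : (I → J) → Ser J → Ser I
(φ ^* F) L = F (map φ L)

^*-⊛ : ∀ (φ : I → J) (F G : Ser J) → φ ^* (F ⊛ G) ≋ (φ ^* F) ⊛ (φ ^* G)
^*-⊛ φ F G []      = refl
^*-⊛ φ F G (p ∷ L) = cong₂ _+_ (^*-⊛ φ (D (φ p) F) G L) (^*-⊛ φ F (D (φ p) G) L)

^*-con : ∀ (φ : I → J) z → φ ^* con z ≋ con z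
^*-con φ z []      = refl
^*-con φ z (_ ∷ _) = refl

^*-lin : ∀ (φ : I → J) u → φ ^* lin u ≋ lin (u ∘ φ)
^*-lin φ u []      = refl
^*-lin φ u (p ∷ L) = ^*-con φ (u (φ p)) L

-- The derivations D p and D q need not commute in general; on series with this property they do.
record Comm (F : Ser I) : Set where
  constructor comm
  field perm : ∀ {L L′} → L ↭ L′ → F L ≡ F L′
open Comm public

Comm-D : ∀ {F : Ser I} p → Comm F → Comm (D p F)
Comm-D p c .perm r = perm c (prep p r)

DD-comm : ∀ {F : Ser I} p q → Comm F → D p (D q F) ≋ D q (D p F)
DD-comm p q c L = perm c (swap q p ↭-refl)

Comm-⊛ : {F G : Ser I} → Comm F → Comm G → Comm (F ⊛ G)
Comm-⊛ c d .perm = go c d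
  where
  go : ∀ {F G : Ser _} → Comm F → Comm G → ∀ {L L′} → L ↭ L′ → (F ⊛ G) L ≡ (F ⊛ G) L′
  go c d refl         = refl
  go c d (prep p r)   = cong₂ _+_ (go (Comm-D p c) d r) (go c (Comm-D p d) r)
  go {F} {G} c d (swap {ys = ys} p q r) = ≡.trans
    (cong₂ _+_
      (cong₂ _+_ (go (Comm-D q (Comm-D p c)) d r) (go (Comm-D p c) (Comm-D q d) r))
      (cong₂ _+_ (go (Comm-D q c) (Comm-D p d) r) (go c (Comm-D q (Comm-D p d)) r)))
    (≡.trans
      (cong₂ _+_
        (cong (_+ (D p F ⊛ D q G) ys) (⊛-congʳ {G = G} (DD-comm q p c) ys))
        (cong ((D q F ⊛ D p G) ys +_) (⊛-congˡ {F = F} (DD-comm q p d) ys)))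
      (+-interchange ((D p (D q F) ⊛ G) ys) _ _ _))
  go c d (trans r s)  = ≡.trans (go c d r) (go c d s)

Comm-⊕ : {F G : Ser I} → Comm F → Comm G → Comm (F ⊕ G)
Comm-⊕ c d .perm r = cong₂ _+_ (perm c r) (perm d r)

Comm-⊝ : {F : Ser I} → Comm F → Comm (⊝ F)
Comm-⊝ c .perm r = cong -_ (perm c r)

Comm-∑ : ∀ (xs : List A) {f : A → Ser I} → (∀ x → Comm (f x)) → Comm (∑S xs f)
Comm-∑ xs c .perm r = ∑-cong xs (λ x → perm (c x) r)

Comm-con : ∀ z → Comm {I} (con z)
Comm-con z .perm refl         = refl
Comm-con z .perm (prep p r)   = refl
Comm-con z .perm (swap p q r) = refl
Comm-con z .perm (trans r s)  = ≡.trans (perm (Comm-con z) r) (perm (Comm-con z) s)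

Comm-lin : ∀ (u : I → ℤ) → Comm (lin u)
Comm-lin u .perm refl         = refl
Comm-lin u .perm (prep p r)   = perm (Comm-con (u p)) r
Comm-lin u .perm (swap p q r) = refl
Comm-lin u .perm (trans r s)  = ≡.trans (perm (Comm-lin u) r) (perm (Comm-lin u) s)

Comm-^* : ∀ (φ : I → J) {F : Ser J} → Comm F → Comm (φ ^* F)
Comm-^* φ c .perm r = perm c (map⁺ φ r)

infixl 7 _·_
_·_ : ℤ → Ser I → Ser I
(z · F) L = z * F L

·-cong : ∀ z {F G : Ser I} → F ≋ G → z · F ≋ z · G
·-cong z e L = cong (z *_) (e L)

·-⊛ : ∀ z (F G : Ser I) → (z · F) ⊛ G ≋ z · (F ⊛ G)
·-⊛ z F G = ≋-trans (⊛-congʳ {G = G} (≋-sym (⊛-con z F)))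
  (≋-trans (⊛-assoc (con z) F G) (⊛-con z (F ⊛ G)))

Comm-· : ∀ z {F : Ser I} → Comm F → Comm (z · F)
Comm-· z c .perm r = cong (z *_) (perm c r)

-- Laplacians, iterated commutators and contraction

pow2 : ℕ → ℤ
pow2 zero    = 1ℤ
pow2 (suc m) = (ℤ.+ 2) * pow2 m

pow2-cancel : ∀ m {x y} → pow2 m * x ≡ pow2 m * y → x ≡ y
pow2-cancel zero    {x} {y} e = ≡.trans (sym (ℤP.*-identityˡ x)) (≡.trans e (ℤP.*-identityˡ y))
pow2-cancel (suc m) {x} {y} e = pow2-cancel m (ℤP.*-cancelˡ-≡ (ℤ.+ 2) _ _
  (≡.trans (sym (ℤP.*-assoc (ℤ.+ 2) (pow2 m) x)) (≡.trans e (ℤP.*-assoc (ℤ.+ 2) (pow2 m) y))))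

-- For polynomials: the degree is less than `m`.
Low : ℕ → Ser I → Set
Low m G = ∀ L → m ℕ.≤ length L → G L ≡ 0ℤ

-- Two instances occur: `bar` is the identity on the diagonal variables and the transposition on
-- matrix entries, where `Lap` is Σ ∂ᵢⱼ ∂ⱼᵢ. Reindexing by `bar` makes the two cross terms of the
-- product rule equal.
module Laplacian {I : Set} (is : List I) (bar : I → I) (bar² : ∀ p → bar (bar p) ≡ p)
                 (∑-bar : ∀ h → ∑ is (h ∘ bar) ≡ ∑ is h) where

  Lap : Ser I → Ser I
  Lap F = ∑S is (λ p → D p (D (bar p) F))

  -- The carré du champ of `Lap`: half of the failure of the Leibniz rule.
  Γ : Ser I → Ser I → Ser I
  Γ G F = ∑S is (λ p → D p G ⊛ D (bar p) F)

  Lap-cong : ∀ {F G} → F ≋ G → Lap F ≋ Lap G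
  Lap-cong e L = ∑-cong is (λ p → e (bar p ∷ p ∷ L))

  Lap-⊕ : ∀ F G → Lap (F ⊕ G) ≋ Lap F ⊕ Lap G
  Lap-⊕ F G L = ∑-+ is _ _

  Lap-· : ∀ z F → Lap (z · F) ≋ z · Lap F
  Lap-· z F L = ∑-*ˡ is z _

  Lap-∑ : ∀ {A : Set} (xs : List A) f → Lap (∑S xs f) ≋ ∑S xs (Lap ∘ f)
  Lap-∑ xs f L = ∑-comm is xs _

  Comm-Lap : ∀ {F} → Comm F → Comm (Lap F)
  Comm-Lap c = Comm-∑ is (λ p → Comm-D p (Comm-D (bar p) c))

  D-Lap : ∀ {F} q → Comm F → D q (Lap F) ≋ Lap (D q F)
  D-Lap q c L = ∑-cong is (λ p → ≡.trans (DD-comm q p (Comm-D (bar p) c) L) (DD-comm q (bar p) c (p ∷ L)))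

  Lap-⊛ : ∀ G F → Lap (G ⊛ F) ≋ Lap G ⊛ F ⊕ ℤ.+ 2 · Γ G F ⊕ G ⊛ Lap F
  Lap-⊛ G F L = begin
    ∑ is (λ p → (a p + b p) + (c p + d p))              ≡⟨ ∑-+ is _ _ ⟩
    ∑ is (λ p → a p + b p) + ∑ is (λ p → c p + d p)     ≡⟨ cong₂ _+_ (∑-+ is a b) (∑-+ is c d) ⟩
    (∑ is a + ∑ is b) + (∑ is c + ∑ is d)               ≡⟨ cong (λ z → (∑ is a + z) + (∑ is c + ∑ is d)) b≡c ⟩
    (∑ is a + ∑ is c) + (∑ is c + ∑ is d)               ≡⟨ lemma (∑ is a) (∑ is c) (∑ is d) ⟩
    (∑ is a + ℤ.+ 2 * ∑ is c) + ∑ is d                  ≡⟨ cong₂ (λ y z → (y + ℤ.+ 2 * ∑ is c) + z)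
                                                             (sym (⊛-∑ˡ is _ F L)) (sym (⊛-∑ʳ is G _ L)) ⟩
    (Lap G ⊛ F ⊕ ℤ.+ 2 · Γ G F ⊕ G ⊛ Lap F) L ∎
    where
    open ≡-Reasoning
    a b c d : I → ℤ
    a p = (D p (D (bar p) G) ⊛ F) L
    b p = (D (bar p) G ⊛ D p F) L
    c p = (D p G ⊛ D (bar p) F) L
    d p = (G ⊛ D p (D (bar p) F)) L
    b≡c : ∑ is b ≡ ∑ is c
    b≡c = ≡.trans (∑-cong is (λ p → cong (λ q → (D (bar p) G ⊛ D q F) L) (sym (bar² p)))) (∑-bar c)
    lemma : ∀ x y z → (x + y) + (y + z) ≡ (x + ℤ.+ 2 * y) + z
    lemma = solve-∀

  -- The m-fold commutator [Lap, [Lap, … [Lap, G] … ]] applied to F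
  ad : ℕ → Ser I → Ser I → Ser I
  ad zero    G F = G ⊛ F
  ad (suc m) G F = Lap (ad m G F) ⊖ ad m G (Lap F)

  ad-congʳ : ∀ m G {F F′} → F ≋ F′ → ad m G F ≋ ad m G F′
  ad-congʳ zero    G e = ⊛-congˡ {F = G} e
  ad-congʳ (suc m) G e = ⊖-cong (Lap-cong (ad-congʳ m G e)) (ad-congʳ m G (Lap-cong e))

  -- One commutator turns multiplication by `G` into multiplication by `Lap G` plus the first-order
  -- operator 2 Σ ∂ₚG ∂_(bar p). As `Lap` commutes with the derivations, the later commutators act
  -- on the coefficients `Lap G` and ∂ₚG only.
  ad-step : ∀ m {G F} → Comm G → Comm F →
            ad (suc m) G F ≋ ad m (Lap G) F ⊕ ℤ.+ 2 · ∑S is (λ p → ad m (D p G) (D (bar p) F))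
  ad-step zero {G} {F} c d L =
    ≡.trans (cong (_- (G ⊛ Lap F) L) (Lap-⊛ G F L)) (lemma ((Lap G ⊛ F) L) _ _)
    where
    lemma : ∀ x y z → (x + y + z) - z ≡ x + y
    lemma = solve-∀
  ad-step (suc m) {G} {F} c d L = begin
    Lap (ad (suc m) G F) L - ad (suc m) G (Lap F) L
      ≡⟨ cong₂ _-_ (Lap-cong (ad-step m c d) L) (ad-step m c (Comm-Lap d) L) ⟩
    Lap (ad m (Lap G) F ⊕ ℤ.+ 2 · T) L - (ad m (Lap G) (Lap F) L + ℤ.+ 2 * ∑S is (λ p → ad m (D p G) (D (bar p) (Lap F))) L)
      ≡⟨ cong₂ _-_ (≡.trans (Lap-⊕ (ad m (Lap G) F) (ℤ.+ 2 · T) L)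
                     (cong (Lap (ad m (Lap G) F) L +_) (≡.trans (Lap-· (ℤ.+ 2) T L) (cong (ℤ.+ 2 *_) (Lap-∑ is (λ p → ad m (D p G) (D (bar p) F)) L)))))
                   (cong (λ z → ad m (Lap G) (Lap F) L + ℤ.+ 2 * z)
                     (∑-cong is (λ p → ad-congʳ m (D p G) (D-Lap (bar p) d) L))) ⟩
    (Lap (ad m (Lap G) F) L + ℤ.+ 2 * ∑ is u) - (ad m (Lap G) (Lap F) L + ℤ.+ 2 * ∑ is v)
      ≡⟨ lemma (Lap (ad m (Lap G) F) L) (∑ is u) (ad m (Lap G) (Lap F) L) (∑ is v) ⟩
    (Lap (ad m (Lap G) F) L - ad m (Lap G) (Lap F) L) + ℤ.+ 2 * (∑ is u + - ∑ is v)
      ≡⟨ cong (λ z → ad (suc m) (Lap G) F L + ℤ.+ 2 * z)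
           (≡.trans (cong (∑ is u +_) (sym (∑-neg is v))) (sym (∑-+ is u _))) ⟩
    ad (suc m) (Lap G) F L + ℤ.+ 2 * ∑ is (λ p → u p - v p) ∎
    where
    open ≡-Reasoning
    T : Ser I
    T = ∑S is (λ p → ad m (D p G) (D (bar p) F))
    u v : I → ℤ
    u p = Lap (ad m (D p G) (D (bar p) F)) L
    v p = ad m (D p G) (Lap (D (bar p) F)) L
    lemma : ∀ a b c d → (a + ℤ.+ 2 * b) - (c + ℤ.+ 2 * d) ≡ (a - c) + ℤ.+ 2 * (b + - d)
    lemma = solve-∀

  Low-Lap : ∀ {m G} → Low (suc m) G → Low m (Lap G)
  Low-Lap l L m≤ = ∑-zero is (λ p → l (bar p ∷ p ∷ L) (s≤s (ℕP.m≤n⇒m≤1+n m≤)))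

  Low-Lap′ : ∀ {m G} → Low (suc (suc m)) G → Low m (Lap G)
  Low-Lap′ l L m≤ = ∑-zero is (λ p → l (bar p ∷ p ∷ L) (s≤s (s≤s m≤)))

  -- By `ad-step` every commutator lowers the degree of the coefficient by at least one.
  ad-low : ∀ m {G F} → Comm G → Comm F → Low m G → ad m G F ≋ (λ _ → 0ℤ)
  ad-low zero {G} {F} c d l L = ≡.trans (⊛-congʳ {G = F} (λ K → l K z≤n) L) (⊛-zeroˡ F L)
  ad-low (suc m) {G} c d l L = ≡.trans (ad-step m c d L)
    (cong₂ (λ x y → x + ℤ.+ 2 * y) (ad-low m (Comm-Lap c) d (Low-Lap {G = G} l) L)
      (∑-zero is (λ p → ad-low m (Comm-D p c) (Comm-D (bar p) d) (λ K k → l (p ∷ K) (s≤s k)) L)))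

  -- For a `G` with commuting derivatives this is m! times G(∂): the derivation in direction `bar p`
  -- is substituted for the variable p in the part of `G` of degree m.
  contract : ℕ → Ser I → Ser I → Ser I
  contract zero    G F = G [] · F
  contract (suc m) G F = ∑S is (λ p → contract m (D p G) (D (bar p) F))

  -- Only the terms in which every commutator meets a different variable of G survive.
  ad-top : ∀ m {G F} → Comm G → Comm F → Low (suc m) G → ad m G F ≋ pow2 m · contract m G F
  ad-top zero {G} {F} c d l L = ≡.trans (⊛-congʳ {G = F} g L) (≡.trans (⊛-con (G []) F L) (sym (ℤP.*-identityˡ _)))
    where
    g : G ≋ con (G [])
    g []      = refl
    g (p ∷ K) = l (p ∷ K) (s≤s z≤n)
  ad-top (suc m) {G} {F} c d l L = begin
    ad (suc m) G F L
      ≡⟨ ad-step m c d L ⟩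
    ad m (Lap G) F L + ℤ.+ 2 * ∑ is (λ p → ad m (D p G) (D (bar p) F) L)
      ≡⟨ cong₂ (λ x y → x + ℤ.+ 2 * y) (ad-low m (Comm-Lap c) d (Low-Lap′ {G = G} l) L)
           (≡.trans (∑-cong is (λ p → ad-top m (Comm-D p c) (Comm-D (bar p) d) (λ K k → l (p ∷ K) (s≤s k)) L))
                    (∑-*ˡ is (pow2 m) _)) ⟩
    0ℤ + ℤ.+ 2 * (pow2 m * contract (suc m) G F L)
      ≡⟨ ≡.trans (ℤP.+-identityˡ _) (sym (ℤP.*-assoc (ℤ.+ 2) (pow2 m) _)) ⟩
    pow2 (suc m) * contract (suc m) G F L ∎
    where open ≡-Reasoning

  contract-cong : ∀ m {G G′ F F′} → G ≋ G′ → F ≋ F′ → contract m G F ≋ contract m G′ F′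
  contract-cong zero    e f L = cong₂ _*_ (e []) (f L)
  contract-cong (suc m) e f L = ∑-cong is (λ p → contract-cong m (λ K → e (p ∷ K)) (λ K → f (bar p ∷ K)) L)

  contract-⊕ˡ : ∀ m G G′ F → contract m (G ⊕ G′) F ≋ contract m G F ⊕ contract m G′ F
  contract-⊕ˡ zero    G G′ F L = ℤP.*-distribʳ-+ (F L) (G []) (G′ [])
  contract-⊕ˡ (suc m) G G′ F L = ≡.trans (∑-cong is (λ p → contract-⊕ˡ m (D p G) (D p G′) (D (bar p) F) L)) (∑-+ is _ _)

  contract-·ˡ : ∀ m z G F → contract m (z · G) F ≋ z · contract m G F
  contract-·ˡ zero    z G F L = ℤP.*-assoc z (G []) (F L)
  contract-·ˡ (suc m) z G F L = ≡.trans (∑-cong is (λ p → contract-·ˡ m z (D p G) (D (bar p) F) L)) (∑-*ˡ is z _)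

  contract-·ʳ : ∀ m z G F → contract m G (z · F) ≋ z · contract m G F
  contract-·ʳ zero    z G F L = lemma (G []) z (F L)
    where
    lemma : ∀ a b c → a * (b * c) ≡ b * (a * c)
    lemma = solve-∀
  contract-·ʳ (suc m) z G F L = ≡.trans (∑-cong is (λ p → contract-·ʳ m z (D p G) (D (bar p) F) L)) (∑-*ˡ is z _)

  contract-∑ʳ : ∀ {A : Set} m (xs : List A) G f → contract m G (∑S xs f) ≋ ∑S xs (λ x → contract m G (f x))
  contract-∑ʳ zero    xs G f L = sym (∑-*ˡ xs (G []) (λ x → f x L))
  contract-∑ʳ (suc m) xs G f L =
    ≡.trans (∑-cong is (λ p → contract-∑ʳ m xs (D p G) (λ x → D (bar p) (f x)) L)) (∑-comm is xs _)

  Comm-contract : ∀ m {G F} → Comm F → Comm (contract m G F)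
  Comm-contract zero    {G} d = Comm-· (G []) d
  Comm-contract (suc m) d = Comm-∑ is (λ p → Comm-contract m (Comm-D (bar p) d))

  ∂ : (I → ℤ) → Ser I → Ser I
  ∂ u g = ∑S is (λ p → u p · D (bar p) g)

  -- At 0 a linear factor has to absorb exactly one of the m + 1 derivations that hit the product.
  -- All choices contribute the same, whence the constant.
  contract-lin : ∀ m (u : I → ℤ) G {g} → Comm g →
                 contract (suc m) (lin u ⊛ G) g ≋ ℤ.+ suc m · contract m G (∂ u g)
  contract-lin zero u G {g} c L = begin
    ∑ is (λ p → (u p * G [] + 0ℤ * G (p ∷ [])) * g (bar p ∷ L))
      ≡⟨ ∑-cong is (λ p → lemma (u p) (G []) (G (p ∷ [])) (g (bar p ∷ L))) ⟩
    ∑ is (λ p → G [] * (u p * g (bar p ∷ L)))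
      ≡⟨ ∑-*ˡ is (G []) _ ⟩
    G [] * ∂ u g L
      ≡⟨ sym (ℤP.*-identityˡ _) ⟩
    1ℤ * (G [] * ∂ u g L) ∎
    where
    open ≡-Reasoning
    lemma : ∀ a b c d → (a * b + 0ℤ * c) * d ≡ b * (a * d)
    lemma = solve-∀
  contract-lin (suc m) u G {g} c L = begin
    ∑ is (λ p → contract (suc m) (D p (lin u ⊛ G)) (D (bar p) g) L)
      ≡⟨ ∑-cong is (λ p → begin
           contract (suc m) (D p (lin u ⊛ G)) (D (bar p) g) L
             ≡⟨ contract-cong (suc m) {F = D (bar p) g} (D-lin u G p) ≋-refl L ⟩
           contract (suc m) (u p · G ⊕ lin u ⊛ D p G) (D (bar p) g) L
             ≡⟨ contract-⊕ˡ (suc m) (u p · G) (lin u ⊛ D p G) (D (bar p) g) L ⟩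
           contract (suc m) (u p · G) (D (bar p) g) L + contract (suc m) (lin u ⊛ D p G) (D (bar p) g) L
             ≡⟨ cong₂ _+_ (≡.trans (contract-·ˡ (suc m) (u p) G (D (bar p) g) L) (sym (contract-·ʳ (suc m) (u p) G (D (bar p) g) L)))
                          (≡.trans (contract-lin m u (D p G) (Comm-D (bar p) c) L)
                            (cong (ℤ.+ suc m *_) (contract-cong m {D p G} ≋-refl (∂-D (bar p)) L))) ⟩
           contract (suc m) G (u p · D (bar p) g) L + ℤ.+ suc m * contract m (D p G) (D (bar p) (∂ u g)) L ∎) ⟩
    ∑ is (λ p → contract (suc m) G (u p · D (bar p) g) L + ℤ.+ suc m * contract m (D p G) (D (bar p) (∂ u g)) L)
      ≡⟨ ≡.trans (∑-+ is _ _) (cong₂ _+_ (sym (contract-∑ʳ (suc m) is G (λ p → u p · D (bar p) g) L)) (∑-*ˡ is (ℤ.+ suc m) _)) ⟩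
    contract (suc m) G (∂ u g) L + ℤ.+ suc m * contract (suc m) G (∂ u g) L
      ≡⟨ lemma (contract (suc m) G (∂ u g) L) (ℤ.+ suc m) ⟩
    (1ℤ + ℤ.+ suc m) * contract (suc m) G (∂ u g) L ∎
    where
    open ≡-Reasoning
    lemma : ∀ x y → x + y * x ≡ (1ℤ + y) * x
    lemma = solve-∀
    ∂-D : ∀ q → ∂ u (D q g) ≋ D q (∂ u g)
    ∂-D q K = ∑-cong is (λ p → cong (u p *_) (DD-comm (bar p) q c K))

-- The Vandermonde product is harmonic

fins : ∀ n → List (Fin n)
fins zero    = []
fins (suc n) = zero ∷ map suc (fins n)

fins-unique : ∀ n → Unique (fins n)
fins-unique zero    = []
fins-unique (suc n) = AllP.map⁺ (All.universal (λ _ ()) (fins n)) ∷ UniqueP.map⁺ FinP.suc-injective (fins-unique n)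

δ : Fin n → Fin n → ℤ
δ zero    zero    = 1ℤ
δ zero    (suc j) = 0ℤ
δ (suc i) zero    = 0ℤ
δ (suc i) (suc j) = δ i j

δ-refl : ∀ (i : Fin n) → δ i i ≡ 1ℤ
δ-refl zero    = refl
δ-refl (suc i) = δ-refl i

δ-≢ : ∀ {i j : Fin n} → i ≢ j → δ i j ≡ 0ℤ
δ-≢ {i = zero}  {zero}  ne = ⊥-elim (ne refl)
δ-≢ {i = zero}  {suc j} ne = refl
δ-≢ {i = suc i} {zero}  ne = refl
δ-≢ {i = suc i} {suc j} ne = δ-≢ (ne ∘ cong suc)

∑-δ : ∀ (i : Fin n) (f : Fin n → ℤ) → ∑ (fins n) (λ j → δ i j * f j) ≡ f i
∑-δ {suc n} zero    f = ≡.trans (cong₂ _+_ (ℤP.*-identityˡ (f zero))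
  (≡.trans (∑-map suc (fins n) _) (∑-zero (fins n) (λ j → ℤP.*-zeroˡ (f (suc j)))))) (ℤP.+-identityʳ _)
∑-δ {suc n} (suc i) f = ≡.trans (cong₂ _+_ (ℤP.*-zeroˡ (f zero))
  (≡.trans (∑-map suc (fins n) _) (∑-δ i (f ∘ suc)))) (ℤP.+-identityˡ _)

x : Fin n → Ser (Fin n)
x i = lin (δ i)

ℓ : Fin n → Fin n → Ser (Fin n)
ℓ i j = x j ⊖ x i

π : Fin n → List (Fin n) → Ser (Fin n)
π i []       = con 1ℤ
π i (j ∷ js) = ℓ i j ⊛ π i js

-- For i before j the factor is xⱼ - xᵢ, so exponents that increase along the list carry the
-- positive sign.
vand : List (Fin n) → Ser (Fin n)
vand []       = con 1ℤ
vand (i ∷ is) = π i is ⊛ vand is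

Comm-ℓ : ∀ (i j : Fin n) → Comm (ℓ i j)
Comm-ℓ i j = Comm-⊕ (Comm-lin (δ j)) (Comm-⊝ (Comm-lin (δ i)))

Comm-π : ∀ (i : Fin n) js → Comm (π i js)
Comm-π i []       = Comm-con 1ℤ
Comm-π i (j ∷ js) = Comm-⊛ (Comm-ℓ i j) (Comm-π i js)

Comm-vand : ∀ (is : List (Fin n)) → Comm (vand is)
Comm-vand []       = Comm-con 1ℤ
Comm-vand (i ∷ is) = Comm-⊛ (Comm-π i is) (Comm-vand is)

module Diagonal (n : ℕ) where
  open Laplacian (fins n) id (λ _ → refl) (λ _ → refl) public
  open SerSolver (Fin n) using (solve; _:=_; _:+_; _:*_; :-_; _:-_) renaming (con to :con)
  open CommutativeRing (serRing (Fin n)) using (setoid)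
  open Relation.Binary.Reasoning.Setoid setoid

  S : Set
  S = Ser (Fin n)

  O : S
  O _ = 0ℤ

  con-0 : con 0ℤ ≋ O
  con-0 []      = refl
  con-0 (_ ∷ _) = refl

  Γ-sym : ∀ (F G : S) → Γ F G ≋ Γ G F
  Γ-sym F G L = ∑-cong (fins n) (λ p → ⊛-comm (D p F) (D p G) L)

  Γ-⊛ˡ : ∀ (F G H : S) → Γ (F ⊛ G) H ≋ F ⊛ Γ G H ⊕ G ⊛ Γ F H
  Γ-⊛ˡ F G H L = ≡.trans (∑-cong (fins n) (λ p →
      solve 5 (λ f g df dg dh → (df :* g :+ f :* dg) :* dh := f :* (dg :* dh) :+ g :* (df :* dh))
        (λ {_} → ≋-refl) F G (D p F) (D p G) (D p H) L))
    (≡.trans (∑-+ (fins n) _ _) (sym (cong₂ _+_ (⊛-∑ʳ (fins n) F (λ p → D p G ⊛ D p H) L) (⊛-∑ʳ (fins n) G (λ p → D p F ⊛ D p H) L))))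

  Γ-⊛ʳ : ∀ (H F G : S) → Γ H (F ⊛ G) ≋ F ⊛ Γ H G ⊕ G ⊛ Γ H F
  Γ-⊛ʳ H F G L = ≡.trans (Γ-sym H (F ⊛ G) L) (≡.trans (Γ-⊛ˡ F G H L)
    (cong₂ _+_ (⊛-congˡ {F = F} (Γ-sym G H) L) (⊛-congˡ {F = G} (Γ-sym F H) L)))

  Γ-x : ∀ i (H : S) → Γ (x i) H ≋ D i H
  Γ-x i H L = ≡.trans (∑-cong (fins n) (λ p → ⊛-con (δ i p) (D p H) L)) (∑-δ i (λ p → H (p ∷ L)))

  Γ-ℓ : ∀ i j (H : S) → Γ (ℓ i j) H ≋ D j H ⊖ D i H
  Γ-ℓ i j H L = ≡.trans (∑-cong (fins n) (λ p →
      solve 3 (λ a b h → (a :- b) :* h := a :* h :- b :* h) (λ {_} → ≋-refl) (D p (x j)) (D p (x i)) (D p H) L))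
    (≡.trans (∑-+ (fins n) _ _) (cong₂ _+_ (Γ-x j H L) (≡.trans (∑-neg (fins n) _) (cong -_ (Γ-x i H L)))))

  Fresh : Fin n → List (Fin n) → Set
  Fresh i js = All (i ≢_) js

  D-ℓ : ∀ (p i j : Fin n) → D p (ℓ i j) ≋ con (δ j p - δ i p)
  D-ℓ p i j L = sym (≡.trans (con-+ (δ j p) (- δ i p) L) (cong (con (δ j p) L +_) (con-neg (δ i p) L)))

  D-ℓ-0 : ∀ {p i j : Fin n} → p ≢ i → p ≢ j → D p (ℓ i j) ≋ O
  D-ℓ-0 {p} {i} {j} a b = ≋-trans (D-ℓ p i j) (≋-trans
    (λ L → cong (λ z → con z L) (cong₂ _-_ (δ-≢ (b ∘ sym)) (δ-≢ (a ∘ sym)))) con-0)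

  D-π-0 : ∀ {p i} js → p ≢ i → Fresh p js → D p (π i js) ≋ O
  D-π-0 []       a []      = λ _ → refl
  D-π-0 {p} {i} (j ∷ js) a (b ∷ f) L = cong₂ _+_
    (≡.trans (⊛-congʳ {G = π i js} (D-ℓ-0 a b) L) (⊛-zeroˡ (π i js) L))
    (≡.trans (⊛-congˡ {F = ℓ i j} (D-π-0 js a f) L) (≡.trans (⊛-comm (ℓ i j) O L) (⊛-zeroˡ (ℓ i j) L)))

  D-vand-0 : ∀ {p} is → Fresh p is → D p (vand is) ≋ O
  D-vand-0 []       []      = λ _ → refl
  D-vand-0 {p} (i ∷ is) (a ∷ f) L = cong₂ _+_
    (≡.trans (⊛-congʳ {G = vand is} (D-π-0 is a f) L) (⊛-zeroˡ (vand is) L))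
    (≡.trans (⊛-congˡ {F = π i is} (D-vand-0 is f) L) (≡.trans (⊛-comm (π i is) O L) (⊛-zeroˡ (π i is) L)))

  -- Elementary symmetric functions of the cofactors: e₁ omits one factor of π i js, e₂ two.
  e₁ e₂ : Fin n → List (Fin n) → S
  e₁ i []       = O
  e₁ i (j ∷ js) = π i js ⊕ ℓ i j ⊛ e₁ i js
  e₂ i []       = O
  e₂ i (j ∷ js) = e₁ i js ⊕ ℓ i j ⊛ e₂ i js

  D-π : ∀ i js → Fresh i js → D i (π i js) ≋ ⊝ e₁ i js
  D-π i []       []      = λ _ → refl
  D-π i (j ∷ js) (a ∷ f) = begin
    D i (ℓ i j) ⊛ π i js ⊕ ℓ i j ⊛ D i (π i js)
      ≈⟨ ⊕-cong (⊛-congʳ {G = π i js} (≋-trans (D-ℓ i i j) (λ L → cong (λ z → con z L) (cong₂ _-_ (δ-≢ (a ∘ sym)) (δ-refl i)))))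
                (⊛-congˡ {F = ℓ i j} (D-π i js f)) ⟩
    con (- 1ℤ) ⊛ π i js ⊕ ℓ i j ⊛ (⊝ e₁ i js)
      ≈⟨ solve 3 (λ p l e → :con (- 1ℤ) :* p :+ l :* (:- e) := :- (p :+ l :* e)) (λ {_} → ≋-refl) (π i js) (ℓ i j) (e₁ i js) ⟩
    ⊝ (π i js ⊕ ℓ i j ⊛ e₁ i js) ∎

  -- The sum over k of the products of `π j` and `π i` with both factors containing xₖ omitted; this
  -- will be their Γ.
  h : Fin n → Fin n → List (Fin n) → S
  h j i []       = O
  h j i (k ∷ ks) = π j ks ⊛ π i ks ⊕ ℓ j k ⊛ ℓ i k ⊛ h j i ks

  ⊛-O : ∀ (F : S) → F ⊛ O ≋ O
  ⊛-O F = ≋-trans (⊛-comm F O) (⊛-zeroˡ F)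

  Γ-ππ : ∀ {j i} ks → j ≢ i → Fresh j ks → Fresh i ks → Unique ks → Γ (π j ks) (π i ks) ≋ h j i ks
  Γ-ππ []       ne _ _ _ L = ∑-zero (fins n) (λ p → ⊛-zeroˡ O L)
  Γ-ππ {j} {i} (k ∷ ks) ne (j≢k ∷ fj) (i≢k ∷ fi) (fk ∷ u) = begin
    Γ (ℓ j k ⊛ π j ks) (ℓ i k ⊛ π i ks)
      ≈⟨ Γ-⊛ˡ (ℓ j k) (π j ks) (ℓ i k ⊛ π i ks) ⟩
    ℓ j k ⊛ Γ (π j ks) (ℓ i k ⊛ π i ks) ⊕ π j ks ⊛ Γ (ℓ j k) (ℓ i k ⊛ π i ks)
      ≈⟨ ⊕-cong
           (⊛-congˡ {F = ℓ j k} (≋-trans (Γ-⊛ʳ (π j ks) (ℓ i k) (π i ks))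
             (⊕-cong (⊛-congˡ {F = ℓ i k} (Γ-ππ ks ne fj fi u)) (⊛-congˡ {F = π i ks} Γ-πℓ))))
           (⊛-congˡ {F = π j ks} (≋-trans (Γ-⊛ʳ (ℓ j k) (ℓ i k) (π i ks))
             (⊕-cong (⊛-congˡ {F = ℓ i k} Γ-ℓπ) (⊛-congˡ {F = π i ks} Γ-ℓℓ)))) ⟩
    ℓ j k ⊛ (ℓ i k ⊛ h j i ks ⊕ π i ks ⊛ con 0ℤ) ⊕ π j ks ⊛ (ℓ i k ⊛ con 0ℤ ⊕ π i ks ⊛ con 1ℤ)
      ≈⟨ solve 5 (λ a b p q h → a :* (b :* h :+ q :* :con 0ℤ) :+ p :* (b :* :con 0ℤ :+ q :* :con 1ℤ) := p :* q :+ a :* b :* h)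
           (λ {_} → ≋-refl) (ℓ j k) (ℓ i k) (π j ks) (π i ks) (h j i ks) ⟩
    π j ks ⊛ π i ks ⊕ ℓ j k ⊛ ℓ i k ⊛ h j i ks ∎
    where
    Γ-πℓ : Γ (π j ks) (ℓ i k) ≋ con 0ℤ
    Γ-πℓ L = ≡.trans (Γ-sym (π j ks) (ℓ i k) L) (≡.trans (Γ-ℓ i k (π j ks) L)
      (≡.trans (cong₂ _-_ (D-π-0 ks (j≢k ∘ sym) fk L) (D-π-0 ks (ne ∘ sym) fi L)) (sym (con-0 L))))
    Γ-ℓπ : Γ (ℓ j k) (π i ks) ≋ con 0ℤ
    Γ-ℓπ L = ≡.trans (Γ-ℓ j k (π i ks) L)
      (≡.trans (cong₂ _-_ (D-π-0 ks (i≢k ∘ sym) fk L) (D-π-0 ks ne fj L)) (sym (con-0 L)))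
    Γ-ℓℓ : Γ (ℓ j k) (ℓ i k) ≋ con 1ℤ
    Γ-ℓℓ L = ≡.trans (Γ-ℓ j k (ℓ i k) L)
      (≡.trans (cong₂ _-_ (≡.trans (D-ℓ k i k L) (cong (λ z → con z L) (cong₂ _-_ (δ-refl k) (δ-≢ i≢k)))) (D-ℓ-0 ne j≢k L)) (ℤP.+-identityʳ _))

  -- Partial fractions with denominators cleared: 1/(xₖ - xⱼ) - 1/(xₖ - xᵢ) = (xⱼ - xᵢ) / ((xₖ -
  -- xᵢ)(xₖ - xⱼ)), summed over k.
  e₁-h : ∀ j i ks → π j ks ⊛ e₁ i ks ⊕ ℓ i j ⊛ h j i ks ≋ π i ks ⊛ e₁ j ks
  e₁-h j i [] = begin
    con 1ℤ ⊛ O ⊕ ℓ i j ⊛ O ≈⟨ ⊕-cong {F = con 1ℤ ⊛ O} ≋-refl (≋-trans (⊛-O (ℓ i j)) (≋-sym con-0)) ⟩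
    con 1ℤ ⊛ O ⊕ con 0ℤ ≈⟨ solve 1 (λ o → :con 1ℤ :* o :+ :con 0ℤ := :con 1ℤ :* o) (λ {_} → ≋-refl) O ⟩
    con 1ℤ ⊛ O ∎
  e₁-h j i (k ∷ ks) = begin
    ℓ j k ⊛ P ⊛ (Q ⊕ ℓ i k ⊛ E) ⊕ ℓ i j ⊛ (P ⊛ Q ⊕ ℓ j k ⊛ ℓ i k ⊛ H)
      ≈⟨ solve 8 (λ xi xj xk p q e f h →
           (xk :- xj) :* p :* (q :+ (xk :- xi) :* e) :+ (xj :- xi) :* (p :* q :+ (xk :- xj) :* (xk :- xi) :* h)
           := (xk :- xi) :* p :* q :+ (xk :- xj) :* (xk :- xi) :* (p :* e :+ (xj :- xi) :* h)) (λ {_} → ≋-refl)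
           (x i) (x j) (x k) P Q E F H ⟩
    ℓ i k ⊛ P ⊛ Q ⊕ ℓ j k ⊛ ℓ i k ⊛ (P ⊛ E ⊕ ℓ i j ⊛ H)
      ≈⟨ ⊕-cong {F = ℓ i k ⊛ P ⊛ Q} ≋-refl (⊛-congˡ {F = ℓ j k ⊛ ℓ i k} (e₁-h j i ks)) ⟩
    ℓ i k ⊛ P ⊛ Q ⊕ ℓ j k ⊛ ℓ i k ⊛ (Q ⊛ F)
      ≈⟨ solve 5 (λ a b p q f → b :* p :* q :+ a :* b :* (q :* f) := b :* q :* (p :+ a :* f)) (λ {_} → ≋-refl) (ℓ j k) (ℓ i k) P Q F ⟩
    ℓ i k ⊛ Q ⊛ (P ⊕ ℓ j k ⊛ F) ∎
    where
    P Q E F H : S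
    P = π j ks
    Q = π i ks
    E = e₁ i ks
    F = e₁ j ks
    H = h j i ks

  -- After division by both products the pair j, k contributes (1/(xⱼ - xᵢ) - 1/(xₖ - xᵢ))/(xⱼ - xₖ)
  -- = -1/((xⱼ - xᵢ)(xₖ - xᵢ)), so the poles along xⱼ = xₖ cancel and a term of -e₂ is left.
  Γ-vand-π : ∀ i js → Fresh i js → Unique js → Γ (vand js) (π i js) ≋ ⊝ (vand js ⊛ e₂ i js)
  Γ-vand-π i [] _ _ L = ≡.trans (∑-zero (fins n) (λ p → ⊛-zeroˡ O L)) (sym (cong -_ (⊛-O (con 1ℤ) L)))
  Γ-vand-π i (j ∷ ks) (i≢j ∷ fi) (fj ∷ u) = begin
    Γ (π j ks ⊛ V) (ℓ i j ⊛ π i ks)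
      ≈⟨ Γ-⊛ˡ (π j ks) V (ℓ i j ⊛ π i ks) ⟩
    π j ks ⊛ Γ V (ℓ i j ⊛ π i ks) ⊕ V ⊛ Γ (π j ks) (ℓ i j ⊛ π i ks)
      ≈⟨ ⊕-cong
           (⊛-congˡ {F = π j ks} (≋-trans (Γ-⊛ʳ V (ℓ i j) (π i ks))
             (⊕-cong (⊛-congˡ {F = ℓ i j} (Γ-vand-π i ks fi u)) (⊛-congˡ {F = π i ks} Γ-Vℓ))))
           (⊛-congˡ {F = V} (≋-trans (Γ-⊛ʳ (π j ks) (ℓ i j) (π i ks))
             (⊕-cong (⊛-congˡ {F = ℓ i j} (Γ-ππ ks (i≢j ∘ sym) fj fi u)) (⊛-congˡ {F = π i ks} Γ-πℓ)))) ⟩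
    π j ks ⊛ (ℓ i j ⊛ (⊝ (V ⊛ e₂ i ks)) ⊕ π i ks ⊛ con 0ℤ) ⊕ V ⊛ (ℓ i j ⊛ h j i ks ⊕ π i ks ⊛ (⊝ e₁ j ks))
      ≈⟨ solve 7 (λ p l v e q hh f → p :* (l :* (:- (v :* e)) :+ q :* :con 0ℤ) :+ v :* (l :* hh :+ q :* (:- f))
           := v :* (l :* hh :- q :* f) :- p :* l :* v :* e) (λ {_} → ≋-refl) (π j ks) (ℓ i j) V (e₂ i ks) (π i ks) (h j i ks) (e₁ j ks) ⟩
    V ⊛ (ℓ i j ⊛ h j i ks ⊖ π i ks ⊛ e₁ j ks) ⊖ π j ks ⊛ ℓ i j ⊛ V ⊛ e₂ i ks
      ≈⟨ ⊖-cong (⊛-congˡ {F = V} (⊖-cong {F = ℓ i j ⊛ h j i ks} ≋-refl (≋-sym (e₁-h j i ks)))) (≋-refl {F = π j ks ⊛ ℓ i j ⊛ V ⊛ e₂ i ks}) ⟩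
    V ⊛ (ℓ i j ⊛ h j i ks ⊖ (π j ks ⊛ e₁ i ks ⊕ ℓ i j ⊛ h j i ks)) ⊖ π j ks ⊛ ℓ i j ⊛ V ⊛ e₂ i ks
      ≈⟨ solve 6 (λ p l v e hh f → v :* (l :* hh :- (p :* f :+ l :* hh)) :- p :* l :* v :* e := :- (p :* v :* (f :+ l :* e)))
           (λ {_} → ≋-refl) (π j ks) (ℓ i j) V (e₂ i ks) (h j i ks) (e₁ i ks) ⟩
    ⊝ (π j ks ⊛ V ⊛ (e₁ i ks ⊕ ℓ i j ⊛ e₂ i ks)) ∎
    where
    V : S
    V = vand ks
    Γ-Vℓ : Γ V (ℓ i j) ≋ con 0ℤ
    Γ-Vℓ L = ≡.trans (Γ-sym V (ℓ i j) L) (≡.trans (Γ-ℓ i j V L)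
      (≡.trans (cong₂ _-_ (D-vand-0 ks fj L) (D-vand-0 ks fi L)) (sym (con-0 L))))
    Γ-πℓ : Γ (π j ks) (ℓ i j) ≋ ⊝ e₁ j ks
    Γ-πℓ L = ≡.trans (Γ-sym (π j ks) (ℓ i j) L) (≡.trans (Γ-ℓ i j (π j ks) L)
      (≡.trans (cong₂ _-_ (D-π j ks fj L) (D-π-0 ks i≢j fi L)) (ℤP.+-identityʳ _)))

  Lap-ℓ : ∀ i j → Lap (ℓ i j) ≋ O
  Lap-ℓ i j L = ∑-zero (fins n) (λ _ → refl)

  -- Every letter other than i occurs linearly, and ∂ᵢ² omits each pair of factors in two orders.
  Lap-π : ∀ i js → Fresh i js → Unique js → Lap (π i js) ≋ ℤ.+ 2 · e₂ i js
  Lap-π i [] _ _ L = ∑-zero (fins n) (λ _ → refl)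
  Lap-π i (j ∷ js) (a ∷ f) (g ∷ u) = begin
    Lap (ℓ i j ⊛ π i js)
      ≈⟨ Lap-⊛ (ℓ i j) (π i js) ⟩
    Lap (ℓ i j) ⊛ π i js ⊕ ℤ.+ 2 · Γ (ℓ i j) (π i js) ⊕ ℓ i j ⊛ Lap (π i js)
      ≈⟨ ⊕-cong (⊕-cong (≋-trans (⊛-congʳ {G = π i js} (Lap-ℓ i j)) (≋-trans (⊛-zeroˡ (π i js)) (≋-sym con-0)))
                        (≋-trans (·-cong (ℤ.+ 2) Γ-ℓπ) (≋-sym (⊛-con (ℤ.+ 2) (e₁ i js)))))
                (⊛-congˡ {F = ℓ i j} (≋-trans (Lap-π i js f u) (≋-sym (⊛-con (ℤ.+ 2) (e₂ i js))))) ⟩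
    con 0ℤ ⊕ con (ℤ.+ 2) ⊛ e₁ i js ⊕ ℓ i j ⊛ (con (ℤ.+ 2) ⊛ e₂ i js)
      ≈⟨ solve 3 (λ a l b → :con 0ℤ :+ :con (ℤ.+ 2) :* a :+ l :* (:con (ℤ.+ 2) :* b) := :con (ℤ.+ 2) :* (a :+ l :* b))
           (λ {_} → ≋-refl) (e₁ i js) (ℓ i j) (e₂ i js) ⟩
    con (ℤ.+ 2) ⊛ (e₁ i js ⊕ ℓ i j ⊛ e₂ i js)
      ≈⟨ ⊛-con (ℤ.+ 2) (e₁ i js ⊕ ℓ i j ⊛ e₂ i js) ⟩
    ℤ.+ 2 · (e₁ i js ⊕ ℓ i j ⊛ e₂ i js) ∎
    where
    Γ-ℓπ : Γ (ℓ i j) (π i js) ≋ e₁ i js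
    Γ-ℓπ L = ≡.trans (Γ-ℓ i j (π i js) L)
      (≡.trans (cong₂ _-_ (D-π-0 js (a ∘ sym) g L) (D-π i js f L)) (≡.trans (ℤP.+-identityˡ _) (ℤP.neg-involutive _)))

  -- When the first letter is split off, the 2 e₂ of `Lap-π` cancels against the doubled cross term
  -- of `Γ-vand-π`.
  Lap-vand : ∀ is → Unique is → Lap (vand is) ≋ O
  Lap-vand [] _ L = ∑-zero (fins n) (λ _ → refl)
  Lap-vand (i ∷ is) (f ∷ u) = begin
    Lap (π i is ⊛ V)
      ≈⟨ Lap-⊛ (π i is) V ⟩
    Lap (π i is) ⊛ V ⊕ ℤ.+ 2 · Γ (π i is) V ⊕ π i is ⊛ Lap V
      ≈⟨ ⊕-cong (⊕-cong (⊛-congʳ {G = V} (≋-trans (Lap-π i is f u) (≋-sym (⊛-con (ℤ.+ 2) (e₂ i is)))))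
                        (≋-trans (·-cong (ℤ.+ 2) (≋-trans (Γ-sym (π i is) V) (Γ-vand-π i is f u))) (≋-sym (⊛-con (ℤ.+ 2) (⊝ (V ⊛ e₂ i is))))))
                (⊛-congˡ {F = π i is} (≋-trans (Lap-vand is u) (≋-sym con-0))) ⟩
    con (ℤ.+ 2) ⊛ e₂ i is ⊛ V ⊕ con (ℤ.+ 2) ⊛ (⊝ (V ⊛ e₂ i is)) ⊕ π i is ⊛ con 0ℤ
      ≈⟨ solve 3 (λ e v p → :con (ℤ.+ 2) :* e :* v :+ :con (ℤ.+ 2) :* (:- (v :* e)) :+ p :* :con 0ℤ := :con 0ℤ)
           (λ {_} → ≋-refl) (e₂ i is) V (π i is) ⟩
    con 0ℤ
      ≈⟨ con-0 ⟩
    O ∎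
    where
    V : S
    V = vand is

  -- For f the restriction of an invariant function, g i j will be that of ∂ᵢⱼ ∂ⱼᵢ.
  module _ (f : S) (g : Fin n → Fin n → S) (div : ∀ {i j} → i ≢ j → ℓ i j ⊛ g i j ≋ D j f ⊖ D i f) where

    Γ-π-quot : ∀ i js → Fresh i js → Γ (π i js) f ≋ π i js ⊛ ∑S js (g i)
    Γ-π-quot i [] _ L = ≡.trans (∑-zero (fins n) (λ p → ⊛-zeroˡ (D p f) L)) (sym (⊛-O (con 1ℤ) L))
    Γ-π-quot i (j ∷ js) (a ∷ fr) = begin
      Γ (ℓ i j ⊛ π i js) f
        ≈⟨ Γ-⊛ˡ (ℓ i j) (π i js) f ⟩
      ℓ i j ⊛ Γ (π i js) f ⊕ π i js ⊛ Γ (ℓ i j) f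
        ≈⟨ ⊕-cong (⊛-congˡ {F = ℓ i j} (Γ-π-quot i js fr)) (⊛-congˡ {F = π i js} (≋-trans (Γ-ℓ i j f) (≋-sym (div a)))) ⟩
      ℓ i j ⊛ (π i js ⊛ ∑S js (g i)) ⊕ π i js ⊛ (ℓ i j ⊛ g i j)
        ≈⟨ solve 4 (λ l p s q → l :* (p :* s) :+ p :* (l :* q) := l :* p :* (q :+ s)) (λ {_} → ≋-refl) (ℓ i j) (π i js) (∑S js (g i)) (g i j) ⟩
      ℓ i j ⊛ π i js ⊛ (g i j ⊕ ∑S js (g i)) ∎

    quot : List (Fin n) → S
    quot []       = O
    quot (i ∷ is) = ∑S is (g i) ⊕ quot is

    -- Logarithmic differentiation: the factor xⱼ - xᵢ of `vand` contributes (∂ⱼf - ∂ᵢf)/(xⱼ - xᵢ),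
    -- which is `g i j`.
    Γ-vand-quot : ∀ is → Unique is → Γ (vand is) f ≋ vand is ⊛ quot is
    Γ-vand-quot [] _ L = ≡.trans (∑-zero (fins n) (λ p → ⊛-zeroˡ (D p f) L)) (sym (⊛-O (con 1ℤ) L))
    Γ-vand-quot (i ∷ is) (a ∷ u) = begin
      Γ (π i is ⊛ vand is) f
        ≈⟨ Γ-⊛ˡ (π i is) (vand is) f ⟩
      π i is ⊛ Γ (vand is) f ⊕ vand is ⊛ Γ (π i is) f
        ≈⟨ ⊕-cong (⊛-congˡ {F = π i is} (Γ-vand-quot is u)) (⊛-congˡ {F = vand is} (Γ-π-quot i is a)) ⟩
      π i is ⊛ (vand is ⊛ quot is) ⊕ vand is ⊛ (π i is ⊛ ∑S is (g i))
        ≈⟨ solve 4 (λ p v q s → p :* (v :* q) :+ v :* (p :* s) := p :* v :* (s :+ q)) (λ {_} → ≋-refl)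
             (π i is) (vand is) (quot is) (∑S is (g i)) ⟩
      π i is ⊛ vand is ⊛ (∑S is (g i) ⊕ quot is) ∎

-- Functions of matrices and the radial part of the Laplacian

pairs : ∀ n → List (Fin n × Fin n)
pairs n = concatMap (λ i → map (i ,_) (fins n)) (fins n)

∑-pairs : ∀ n (f : Fin n × Fin n → ℤ) → ∑ (pairs n) f ≡ ∑ (fins n) (λ i → ∑ (fins n) (λ j → f (i , j)))
∑-pairs n f = ≡.trans (∑-concatMap (λ i → map (i ,_) (fins n)) (fins n) f) (∑-cong (fins n) (λ i → ∑-map (i ,_) (fins n) f))

∑-pairs-swap : ∀ n f → ∑ (pairs n) (f ∘ Prod.swap) ≡ ∑ (pairs n) f
∑-pairs-swap n f = ≡.trans (∑-pairs n _) (≡.trans (∑-comm (fins n) (fins n) _) (sym (∑-pairs n f)))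

δ-subst : ∀ {n} (i j : Fin n) (f : Fin n → ℤ) → δ i j * f j ≡ δ i j * f i
δ-subst i j f with i FinP.≟ j
... | yes refl = refl
... | no ne = ≡.trans (cong (_* f j) (δ-≢ ne)) (sym (cong (_* f i) (δ-≢ ne)))

∑-δ′ : ∀ {n} (i : Fin n) (f g : Fin n → ℤ) → ∑ (fins n) (λ j → δ i j * f j + g j) ≡ f i + ∑ (fins n) g
∑-δ′ {n} i f g = ≡.trans (∑-+ (fins n) _ g) (cong (_+ ∑ (fins n) g) (∑-δ i f))

module Matrices (n : ℕ) where
  private
    module X = Diagonal n
    Idx : Set
    Idx = Fin n × Fin n
  open Laplacian (pairs n) Prod.swap (λ _ → refl) (∑-pairs-swap n) public
  open SerSolver (Fin n) using (solve; _:=_; _:+_; _:*_; :-_; _:-_)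

  diag : Fin n → Idx
  diag i = i , i

  Res : Ser Idx → Ser (Fin n)
  Res F = diag ^* F

  -- Derivative of F along the commutator of the matrix of variables with the (a,b) elementary matrix

  sub : Fin n → Fin n → Idx → Ser Idx → Ser Idx
  sub a b (k , l) F L = δ b k * F ((a , l) ∷ L) - δ a l * F ((k , b) ∷ L)

  conj : Fin n → Fin n → Ser Idx → Ser Idx
  conj a b F []      = 0ℤ
  conj a b F (p ∷ L) = sub a b p F L + conj a b (D p F) L

  conj-cong : ∀ a b {F G} → F ≋ G → conj a b F ≋ conj a b G
  conj-cong a b e []            = refl
  conj-cong a b e ((k , l) ∷ L) =
    cong₂ _+_ (cong₂ (λ y z → δ b k * y - δ a l * z) (e _) (e _)) (conj-cong a b (λ K → e ((k , l) ∷ K)) L)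

  conj-⊕ : ∀ a b F G → conj a b (F ⊕ G) ≋ conj a b F ⊕ conj a b G
  conj-⊕ a b F G []            = refl
  conj-⊕ a b F G (p@(k , l) ∷ L) = ≡.trans
    (cong (sub a b p (F ⊕ G) L +_) (conj-⊕ a b (D p F) (D p G) L))
    (lemma (δ b k) (δ a l) (F _) (G _) (F _) (G _) (conj a b (D p F) L) (conj a b (D p G) L))
    where
    lemma : ∀ s t u v w y z z′ → (s * (u + v) - t * (w + y)) + (z + z′) ≡ ((s * u - t * w) + z) + ((s * v - t * y) + z′)
    lemma = solve-∀

  conj-· : ∀ a b z F → conj a b (z · F) ≋ z · conj a b F
  conj-· a b z F []            = sym (ℤP.*-zeroʳ z)
  conj-· a b z F (p@(k , l) ∷ L) = ≡.trans
    (cong (sub a b p (z · F) L +_) (conj-· a b z (D p F) L))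
    (lemma (δ b k) (δ a l) z (F ((a , l) ∷ L)) (F ((k , b) ∷ L)) (conj a b (D p F) L))
    where
    lemma : ∀ s t z u w y → (s * (z * u) - t * (z * w)) + z * y ≡ z * ((s * u - t * w) + y)
    lemma = solve-∀

  conj-0 : ∀ a b → conj a b (λ _ → 0ℤ) ≋ (λ _ → 0ℤ)
  conj-0 a b L = ≡.trans (conj-· a b 0ℤ (λ _ → 0ℤ) L) (ℤP.*-zeroˡ (conj a b (λ _ → 0ℤ) L))

  conj-⊝ : ∀ a b F → conj a b (⊝ F) ≋ ⊝ conj a b F
  conj-⊝ a b F L = ≡.trans (conj-cong a b (λ K → sym (ℤP.-1*i≡-i (F K))) L)
    (≡.trans (conj-· a b (- 1ℤ) F L) (ℤP.-1*i≡-i _))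

  conj-∑ : ∀ {A : Set} a b (xs : List A) f → conj a b (∑S xs f) ≋ ∑S xs (conj a b ∘ f)
  conj-∑ a b []       f L = conj-0 a b L
  conj-∑ a b (y ∷ xs) f L = ≡.trans (conj-⊕ a b (f y) (∑S xs f) L) (cong (conj a b (f y) L +_) (conj-∑ a b xs f L))

  sub-⊛ : ∀ a b p F G → sub a b p (F ⊛ G) ≋ sub a b p F ⊛ G ⊕ F ⊛ sub a b p G
  sub-⊛ a b (k , l) F G L = sym (≡.trans
    (cong₂ _+_
      (≡.trans (⊛-distribʳ G (δ b k · D (a , l) F) (⊝ (δ a l · D (k , b) F)) L)
        (cong₂ _+_ (·-⊛ (δ b k) (D (a , l) F) G L)
          (≡.trans (neg-⊛ (δ a l · D (k , b) F) G L) (cong -_ (·-⊛ (δ a l) (D (k , b) F) G L)))))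
      (≡.trans (⊛-comm F (sub a b (k , l) G) L) (≡.trans (⊛-distribʳ F (δ b k · D (a , l) G) (⊝ (δ a l · D (k , b) G)) L)
        (cong₂ _+_ (≡.trans (·-⊛ (δ b k) (D (a , l) G) F L) (cong (δ b k *_) (⊛-comm (D (a , l) G) F L)))
          (≡.trans (neg-⊛ (δ a l · D (k , b) G) F L)
            (cong -_ (≡.trans (·-⊛ (δ a l) (D (k , b) G) F L) (cong (δ a l *_) (⊛-comm (D (k , b) G) F L)))))))))
    (lemma (δ b k) (δ a l) ((D (a , l) F ⊛ G) L) ((D (k , b) F ⊛ G) L) ((F ⊛ D (a , l) G) L) ((F ⊛ D (k , b) G) L)))
    where
    neg-⊛ : ∀ (F G : Ser Idx) → (⊝ F) ⊛ G ≋ ⊝ (F ⊛ G)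
    neg-⊛ F G K = ≡.trans (⊛-congʳ {G = G} (λ K → sym (ℤP.-1*i≡-i (F K))) K)
      (≡.trans (·-⊛ (- 1ℤ) F G K) (ℤP.-1*i≡-i _))
    lemma : ∀ s t u v w y → (s * u + - (t * v)) + (s * w + - (t * y)) ≡ s * (u + w) - t * (v + y)
    lemma = solve-∀

  conj-⊛ : ∀ a b F G → conj a b (F ⊛ G) ≋ conj a b F ⊛ G ⊕ F ⊛ conj a b G
  conj-⊛ a b F G [] = lemma (F []) (G [])
    where
    lemma : ∀ x y → 0ℤ ≡ 0ℤ * y + x * 0ℤ
    lemma = solve-∀
  conj-⊛ a b F G (p ∷ L) = begin
    sub a b p (F ⊛ G) L + conj a b (D p F ⊛ G ⊕ F ⊛ D p G) L
      ≡⟨ cong₂ _+_ (sub-⊛ a b p F G L) (≡.trans (conj-⊕ a b (D p F ⊛ G) (F ⊛ D p G) L)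
           (cong₂ _+_ (conj-⊛ a b (D p F) G L) (conj-⊛ a b F (D p G) L))) ⟩
    ((sub a b p F ⊛ G) L + (F ⊛ sub a b p G) L)
      + (((conj a b (D p F) ⊛ G) L + (D p F ⊛ conj a b G) L) + ((conj a b F ⊛ D p G) L + (F ⊛ conj a b (D p G)) L))
      ≡⟨ lemma ((sub a b p F ⊛ G) L) ((F ⊛ sub a b p G) L) ((conj a b (D p F) ⊛ G) L) ((D p F ⊛ conj a b G) L)
           ((conj a b F ⊛ D p G) L) ((F ⊛ conj a b (D p G)) L) ⟩
    (((sub a b p F ⊛ G) L + (conj a b (D p F) ⊛ G) L) + (conj a b F ⊛ D p G) L)
      + ((D p F ⊛ conj a b G) L + ((F ⊛ sub a b p G) L + (F ⊛ conj a b (D p G)) L))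
      ≡⟨ sym (cong₂ (λ y z → (y + (conj a b F ⊛ D p G) L) + ((D p F ⊛ conj a b G) L + z))
           (⊛-distribʳ G (sub a b p F) (conj a b (D p F)) L) (⊛-distribˡ F (sub a b p G) (conj a b (D p G)) L)) ⟩
    (conj a b F ⊛ G ⊕ F ⊛ conj a b G) (p ∷ L) ∎
    where
    open ≡-Reasoning
    lemma : ∀ s t u v w y → (s + t) + ((u + v) + (w + y)) ≡ ((s + u) + w) + (v + (t + y))
    lemma = solve-∀

  -- `Lap` belongs to the trace form tr XY, which conjugation preserves. In coordinates four sums
  -- with a Kronecker delta arise and cancel in pairs.
  conj-Lap : ∀ a b F → conj a b (Lap F) ≋ Lap (conj a b F)
  conj-Lap a b F L = sym (begin
    ∑ (pairs n) (λ p → sub a b (Prod.swap p) F (p ∷ L) + (sub a b p (D (Prod.swap p) F) L + conj a b (D p (D (Prod.swap p) F)) L))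
      ≡⟨ ∑-cong (pairs n) (λ p → sym (ℤP.+-assoc (sub a b (Prod.swap p) F (p ∷ L)) _ _)) ⟩
    ∑ (pairs n) (λ p → (sub a b (Prod.swap p) F (p ∷ L) + sub a b p (D (Prod.swap p) F) L) + conj a b (D p (D (Prod.swap p) F)) L)
      ≡⟨ ∑-+ (pairs n) _ _ ⟩
    ∑ (pairs n) (λ p → sub a b (Prod.swap p) F (p ∷ L) + sub a b p (D (Prod.swap p) F) L)
      + ∑ (pairs n) (λ p → conj a b (D p (D (Prod.swap p) F)) L)
      ≡⟨ cong₂ _+_ cancel (sym (conj-∑ a b (pairs n) (λ p → D p (D (Prod.swap p) F)) L)) ⟩
    0ℤ + conj a b (Lap F) L
      ≡⟨ ℤP.+-identityˡ _ ⟩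
    conj a b (Lap F) L ∎)
    where
    open ≡-Reasoning
    f g : Fin n → ℤ
    f k = F ((a , k) ∷ (k , b) ∷ L)
    g k = F ((k , b) ∷ (a , k) ∷ L)
    cancel : ∑ (pairs n) (λ p → sub a b (Prod.swap p) F (p ∷ L) + sub a b p (D (Prod.swap p) F) L) ≡ 0ℤ
    cancel = begin
      ∑ (pairs n) (λ p → sub a b (Prod.swap p) F (p ∷ L) + sub a b p (D (Prod.swap p) F) L)
        ≡⟨ ∑-pairs n _ ⟩
      ∑ (fins n) (λ k → ∑ (fins n) (λ l →
        (δ b l * F ((a , k) ∷ (k , l) ∷ L) - δ a k * F ((l , b) ∷ (k , l) ∷ L))
        + (δ b k * F ((l , k) ∷ (a , l) ∷ L) - δ a l * F ((l , k) ∷ (k , b) ∷ L))))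
        ≡⟨ ∑-cong (fins n) (λ k → ≡.trans (∑-cong (fins n) (λ l → reorder (δ b l * F ((a , k) ∷ (k , l) ∷ L)) (δ a k) _ (δ b k) _ (δ a l) (F ((l , k) ∷ (k , b) ∷ L))))
             (≡.trans (∑-+ (fins n) _ _) (cong₂ _+_
               (≡.trans (∑-+ (fins n) _ _) (cong₂ _+_ (∑-δ b _) (≡.trans (∑-neg (fins n) _) (cong -_ (∑-δ a _)))))
               (≡.trans (∑-+ (fins n) _ _) (cong₂ _+_ (∑-*ˡ (fins n) (δ b k) _) (≡.trans (∑-neg (fins n) _) (cong -_ (∑-*ˡ (fins n) (δ a k) _)))))))) ⟩
      ∑ (fins n) (λ k → (f k - f k) + (δ b k * ∑ (fins n) (λ l → F ((l , k) ∷ (a , l) ∷ L)) - δ a k * ∑ (fins n) (λ l → F ((l , b) ∷ (k , l) ∷ L))))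
        ≡⟨ ≡.trans (∑-+ (fins n) _ _) (cong₂ _+_ (∑-zero (fins n) (λ k → ℤP.+-inverseʳ (f k)))
             (≡.trans (∑-+ (fins n) _ _) (cong₂ _+_ (∑-δ b _) (≡.trans (∑-neg (fins n) _) (cong -_ (∑-δ a _)))))) ⟩
      0ℤ + (∑ (fins n) g - ∑ (fins n) g)
        ≡⟨ ≡.trans (ℤP.+-identityˡ _) (ℤP.+-inverseʳ (∑ (fins n) g)) ⟩
      0ℤ ∎
      where
      reorder : ∀ u s v t w r y → (u - s * v) + (t * w - r * y) ≡ (u - r * y) + (t * w - s * v)
      reorder = solve-∀

  -- Infinitesimal invariance under conjugation, in the off-diagonal directions from which the
  -- difference quotients on the diagonal arise.
  record Inv (F : Ser Idx) : Set where
    constructor mkInv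
    field inv : ∀ {a b} → a ≢ b → conj a b F ≋ (λ _ → 0ℤ)
  open Inv public

  Inv-Lap : ∀ {F} → Inv F → Inv (Lap F)
  Inv-Lap {F} i .inv {a} {b} ne L = ≡.trans (conj-Lap a b F L) (∑-zero (pairs n) (λ p → inv i ne _))

  Inv-⊖ : ∀ {F G} → Inv F → Inv G → Inv (F ⊖ G)
  Inv-⊖ {F} {G} i j .inv {a} {b} ne L = ≡.trans (conj-⊕ a b F (⊝ G) L)
    (cong₂ _+_ (inv i ne L) (≡.trans (conj-⊝ a b G L) (cong -_ (inv j ne L))))

  Inv-⊛ : ∀ {F G} → Inv F → Inv G → Inv (F ⊛ G)
  Inv-⊛ {F} {G} i j .inv {a} {b} ne L = ≡.trans (conj-⊛ a b F G L)
    (cong₂ _+_ (≡.trans (⊛-congʳ {G = G} (inv i ne) L) (⊛-zeroˡ G L))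
      (≡.trans (⊛-congˡ {F = F} (inv j ne) L) (≡.trans (⊛-comm F (λ _ → 0ℤ) L) (⊛-zeroˡ F L))))

  Inv-ad : ∀ m {G F} → Inv G → Inv F → Inv (ad m G F)
  Inv-ad zero    i j = Inv-⊛ i j
  Inv-ad (suc m) i j = Inv-⊖ (Inv-Lap (Inv-ad m i j)) (Inv-ad m i (Inv-Lap j))

  Comm-ad : ∀ m {G F} → Comm G → Comm F → Comm (ad m G F)
  Comm-ad zero    i j = Comm-⊛ i j
  Comm-ad (suc m) i j = Comm-⊕ (Comm-Lap (Comm-ad m i j)) (Comm-⊝ (Comm-ad m i (Comm-Lap j)))

  -- At a diagonal matrix the vector field behind `conj a b` has a single coordinate that can be
  -- nonzero, namely x_b - x_a in direction (a , b).
  Res-conj : ∀ a b {G} → Comm G → Res (conj a b G) ≋ ℓ a b ⊛ Res (D (a , b) G)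
  Res-conj a b {G} c []      = sym (ℤP.*-zeroˡ (G ((a , b) ∷ [])))
  Res-conj a b {G} c (i ∷ L) = begin
    (δ b i * G ((a , i) ∷ K) - δ a i * G ((i , b) ∷ K)) + Res (conj a b (D (i , i) G)) L
      ≡⟨ cong₂ _+_
           (cong₂ _-_ (δ-subst b i (λ j → G ((a , j) ∷ K))) (δ-subst a i (λ j → G ((j , b) ∷ K))))
           (Res-conj a b (Comm-D (i , i) c) L) ⟩
    (δ b i * g - δ a i * g) + (ℓ a b ⊛ Res (D (a , b) (D (i , i) G))) L
      ≡⟨ cong₂ _+_
           (sym (≡.trans (⊛-con (δ b i - δ a i) (Res (D (a , b) G)) L) (lemma (δ b i) (δ a i) g)))
           (⊛-congˡ {F = ℓ a b} (λ M → DD-comm (a , b) (i , i) c (map diag M)) L) ⟩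
    (con (δ b i - δ a i) ⊛ Res (D (a , b) G)) L + (ℓ a b ⊛ Res (D (i , i) (D (a , b) G))) L
      ≡⟨ cong (_+ (ℓ a b ⊛ D i (Res (D (a , b) G))) L) (⊛-congʳ {G = Res (D (a , b) G)} (≋-sym (X.D-ℓ i a b)) L) ⟩
    (D i (ℓ a b) ⊛ Res (D (a , b) G)) L + (ℓ a b ⊛ D i (Res (D (a , b) G))) L ∎
    where
    open ≡-Reasoning
    K : List Idx
    K = map diag L
    g : ℤ
    g = G ((a , b) ∷ K)
    lemma : ∀ s t u → (s - t) * u ≡ s * u - t * u
    lemma = solve-∀

  module _ {F : Ser Idx} (c : Comm F) (iF : Inv F) where

    private
      quotient : Fin n → Fin n → Ser (Fin n)
      quotient i j = Res (D (i , j) (D (j , i) F))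

      -- Apply `Res-conj` to ∂ⱼᵢF. The conjugation kills `F`, so on ∂ⱼᵢF only its commutator with
      -- ∂ⱼᵢ remains, and that is ∂ⱼⱼ - ∂ᵢᵢ.
      divides : ∀ {i j} → i ≢ j → ℓ i j ⊛ quotient i j ≋ D j (Res F) ⊖ D i (Res F)
      divides {i} {j} ne L = ≡.trans (sym (Res-conj i j (Comm-D (j , i) c) L)) (begin
        conj i j (D (j , i) F) K
          ≡⟨ lemma (sub i j (j , i) F K) _ ⟩
        conj i j F ((j , i) ∷ K) - sub i j (j , i) F K
          ≡⟨ cong₂ _-_ (inv iF ne ((j , i) ∷ K)) (cong₂ (λ s t → s * F ((i , i) ∷ K) - t * F ((j , j) ∷ K)) (δ-refl j) (δ-refl i)) ⟩
        0ℤ - (1ℤ * F ((i , i) ∷ K) - 1ℤ * F ((j , j) ∷ K))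
          ≡⟨ lemma′ (F ((i , i) ∷ K)) (F ((j , j) ∷ K)) ⟩
        F ((j , j) ∷ K) - F ((i , i) ∷ K) ∎)
        where
        open ≡-Reasoning
        K : List Idx
        K = map diag L
        lemma : ∀ s t → t ≡ (s + t) - s
        lemma = solve-∀
        lemma′ : ∀ s t → 0ℤ - (1ℤ * s - 1ℤ * t) ≡ t - s
        lemma′ = solve-∀

      dividesᵀ : ∀ {i j} → i ≢ j → ℓ i j ⊛ quotient j i ≋ D j (Res F) ⊖ D i (Res F)
      dividesᵀ {i} {j} ne L = ≡.trans
        (solve 3 (λ a b q → (b :- a) :* q := :- ((a :- b) :* q)) (λ {_} → ≋-refl) (x i) (x j) (quotient j i) L)
        (≡.trans (cong -_ (divides (ne ∘ sym) L)) (lemma (Res F (i ∷ L)) _))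
        where
        lemma : ∀ s t → - (s - t) ≡ t - s
        lemma = solve-∀

      -- The diagonal will supply `Lap` of the restriction, and each of the two triangles one copy
      -- of Γ with the Vandermonde product.
      ∑∑-quot : ∀ is → ∑S is (λ i → ∑S is (quotient i)) ≋
                ∑S is (λ i → quotient i i) ⊕ (X.quot (Res F) quotient divides is ⊕ X.quot (Res F) (λ i j → quotient j i) dividesᵀ is)
      ∑∑-quot []       L = refl
      ∑∑-quot (i ∷ is) L = ≡.trans
        (cong ((quotient i i L + ∑S is (quotient i) L) +_)
          (≡.trans (∑-+ is _ _) (cong (∑ is (λ j → quotient j i L) +_) (∑∑-quot is L))))
        (lemma (quotient i i L) (∑S is (quotient i) L) (∑ is (λ j → quotient j i L)) _ _ _)
        where
        lemma : ∀ a b c d e f → (a + b) + (c + (d + (e + f))) ≡ (a + d) + ((b + e) + (c + f))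
        lemma = solve-∀

    -- Harish-Chandra's radial part of the Laplacian
    vand-Res-Lap : vand (fins n) ⊛ Res (Lap F) ≋ X.Lap (vand (fins n) ⊛ Res F)
    vand-Res-Lap = begin
      V ⊛ Res (Lap F)
        ≈⟨ ⊛-congˡ {F = V} (≋-trans (λ L → ∑-pairs n _) (∑∑-quot (fins n))) ⟩
      V ⊛ (X.Lap f ⊕ (X.quot f quotient divides (fins n) ⊕ X.quot f (λ i j → quotient j i) dividesᵀ (fins n)))
        ≈⟨ ⊛-distribˡ V (X.Lap f) _ ⟩
      V ⊛ X.Lap f ⊕ V ⊛ (X.quot f quotient divides (fins n) ⊕ X.quot f (λ i j → quotient j i) dividesᵀ (fins n))
        ≈⟨ ⊕-cong {F = V ⊛ X.Lap f} ≋-refl (≋-trans (⊛-distribˡ V (X.quot f quotient divides (fins n)) _) (⊕-cong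
             (≋-sym (X.Γ-vand-quot f quotient divides (fins n) (fins-unique n)))
             (≋-sym (X.Γ-vand-quot f (λ i j → quotient j i) dividesᵀ (fins n) (fins-unique n))))) ⟩
      V ⊛ X.Lap f ⊕ (X.Γ V f ⊕ X.Γ V f)
        ≈⟨ (λ L → lemma ((V ⊛ X.Lap f) L) (X.Γ V f L)) ⟩
      X.O ⊕ ℤ.+ 2 · X.Γ V f ⊕ V ⊛ X.Lap f
        -- Harmonicity of the Vandermonde product supplies the missing summand of the product rule.
        ≈⟨ ⊕-cong {G = V ⊛ X.Lap f} (⊕-cong {G = ℤ.+ 2 · X.Γ V f}
             (≋-sym (≋-trans (⊛-congʳ {G = f} (X.Lap-vand (fins n) (fins-unique n))) (⊛-zeroˡ f))) ≋-refl) ≋-refl ⟩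
      X.Lap V ⊛ f ⊕ ℤ.+ 2 · X.Γ V f ⊕ V ⊛ X.Lap f
        ≈⟨ ≋-sym (X.Lap-⊛ V f) ⟩
      X.Lap (V ⊛ f) ∎
      where
      open Relation.Binary.Reasoning.Setoid (CommutativeRing.setoid (serRing (Fin n)))
      V f : Ser (Fin n)
      V = vand (fins n)
      f = Res F
      lemma : ∀ s t → s + (t + t) ≡ (0ℤ + ℤ.+ 2 * t) + s
      lemma = solve-∀

  -- The map F ↦ vand · Res F intertwines the two Laplacians by `vand-Res-Lap`, and multiplication
  -- by `G` with multiplication by `Res G`; hence it intertwines all their commutators.
  vand-Res-ad : ∀ m {G F} → Comm G → Inv G → Comm F → Inv F →
                vand (fins n) ⊛ Res (ad m G F) ≋ X.ad m (Res G) (vand (fins n) ⊛ Res F)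
  vand-Res-ad zero {G} {F} cG iG cF iF L = ≡.trans (⊛-congˡ {F = vand (fins n)} (^*-⊛ diag G F) L)
    (solve 3 (λ v g f → v :* (g :* f) := g :* (v :* f)) (λ {_} → ≋-refl) (vand (fins n)) (Res G) (Res F) L)
  vand-Res-ad (suc m) {G} {F} cG iG cF iF L = begin
    (V ⊛ (Res (Lap (ad m G F)) ⊖ Res (ad m G (Lap F)))) L
      ≡⟨ solve 3 (λ v a b → v :* (a :- b) := v :* a :- v :* b) (λ {_} → ≋-refl) V (Res (Lap (ad m G F))) (Res (ad m G (Lap F))) L ⟩
    (V ⊛ Res (Lap (ad m G F))) L - (V ⊛ Res (ad m G (Lap F))) L
      ≡⟨ cong₂ _-_
           (≡.trans (vand-Res-Lap (Comm-ad m cG cF) (Inv-ad m iG iF) L) (X.Lap-cong (vand-Res-ad m cG iG cF iF) L))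
           (≡.trans (vand-Res-ad m cG iG (Comm-Lap cF) (Inv-Lap iF) L) (X.ad-congʳ m (Res G) (vand-Res-Lap cF iF) L)) ⟩
    X.ad (suc m) (Res G) (V ⊛ Res F) L ∎
    where
    open ≡-Reasoning
    V : Ser (Fin n)
    V = vand (fins n)

  -- The operator G(∂) need not be a polynomial in the Laplacian, but for degree at most m it is an
  -- iterated commutator up to constants. The same power of 2 appears on both sides and is
  -- cancelled.
  vand-Res-contract : ∀ m {G F} → Comm G → Inv G → Low (suc m) G → Comm F → Inv F →
                      vand (fins n) ⊛ Res (contract m G F) ≋ X.contract m (Res G) (vand (fins n) ⊛ Res F)
  vand-Res-contract m {G} {F} cG iG lG cF iF L = pow2-cancel m (begin
    pow2 m * (V ⊛ Res (contract m G F)) L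
      ≡⟨ sym (≡.trans (⊛-comm V (pow2 m · Res (contract m G F)) L)
           (≡.trans (·-⊛ (pow2 m) (Res (contract m G F)) V L) (cong (pow2 m *_) (⊛-comm (Res (contract m G F)) V L)))) ⟩
    (V ⊛ Res (pow2 m · contract m G F)) L
      ≡⟨ ⊛-congˡ {F = V} (λ K → sym (ad-top m cG cF lG (map diag K))) L ⟩
    (V ⊛ Res (ad m G F)) L
      ≡⟨ vand-Res-ad m cG iG cF iF L ⟩
    X.ad m (Res G) (V ⊛ Res F) L
      ≡⟨ X.ad-top m (Comm-^* diag cG) (Comm-⊛ (Comm-vand (fins n)) (Comm-^* diag cF))
           (λ K k → lG (map diag K) (subst (suc m ℕ.≤_) (sym (ListP.length-map diag K)) k)) L ⟩
    pow2 m * X.contract m (Res G) (V ⊛ Res F) L ∎)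
    where
    open ≡-Reasoning
    V : Ser (Fin n)
    V = vand (fins n)

  -- Seen as an iterated commutator, the contraction is built from invariant operations.
  Inv-contract : ∀ m {G F} → Comm G → Inv G → Low (suc m) G → Comm F → Inv F → Inv (contract m G F)
  Inv-contract m {G} {F} cG iG lG cF iF .inv {a} {b} ne L = pow2-cancel m (begin
    pow2 m * conj a b (contract m G F) L
      ≡⟨ sym (conj-· a b (pow2 m) (contract m G F) L) ⟩
    conj a b (pow2 m · contract m G F) L
      ≡⟨ conj-cong a b (≋-sym (ad-top m cG cF lG)) L ⟩
    conj a b (ad m G F) L
      ≡⟨ inv (Inv-ad m iG iF) ne L ⟩
    0ℤ
      ≡⟨ sym (ℤP.*-zeroʳ (pow2 m)) ⟩
    pow2 m * 0ℤ ∎)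
    where open ≡-Reasoning

-- Alternating multilinear forms

infixr 7 _⋏_
-- The first letter either is fed to `v` or passes over `v` into `f`, at the cost of a sign. Forms
-- are functions on lists of all lengths.
_⋏_ : (I → ℤ) → Ser I → Ser I
(v ⋏ f) []       = 0ℤ
(v ⋏ f) (y ∷ ys) = v y * f ys - (v ⋏ D y f) ys

_⋏*_ : List (I → ℤ) → Ser I → Ser I
us ⋏* f = foldr _⋏_ f us

wedge : List (I → ℤ) → Ser I
wedge us = us ⋏* con 1ℤ

⋏-cong : ∀ {v w : I → ℤ} {f g} → (∀ y → v y ≡ w y) → f ≋ g → v ⋏ f ≋ w ⋏ g
⋏-cong e e′ []       = refl
⋏-cong e e′ (y ∷ ys) = cong₂ _-_ (cong₂ _*_ (e y) (e′ ys)) (⋏-cong e (λ K → e′ (y ∷ K)) ys)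

⋏-congʳ : ∀ (v : I → ℤ) {f g} → f ≋ g → v ⋏ f ≋ v ⋏ g
⋏-congʳ v = ⋏-cong {v = v} (λ _ → refl)

⋏-⊕ʳ : ∀ (v : I → ℤ) f g → v ⋏ (f ⊕ g) ≋ v ⋏ f ⊕ v ⋏ g
⋏-⊕ʳ v f g []       = refl
⋏-⊕ʳ v f g (y ∷ ys) = ≡.trans (cong (λ s → v y * (f ys + g ys) - s) (⋏-⊕ʳ v (D y f) (D y g) ys))
  (lemma (v y) (f ys) (g ys) _ _)
  where
  lemma : ∀ a b c d e → a * (b + c) - (d + e) ≡ (a * b - d) + (a * c - e)
  lemma = solve-∀

⋏-·ʳ : ∀ (v : I → ℤ) z f → v ⋏ (z · f) ≋ z · (v ⋏ f)
⋏-·ʳ v z f []       = sym (ℤP.*-zeroʳ z)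
⋏-·ʳ v z f (y ∷ ys) = ≡.trans (cong (λ s → v y * (z * f ys) - s) (⋏-·ʳ v z (D y f) ys)) (lemma (v y) z (f ys) _)
  where
  lemma : ∀ a b c d → a * (b * c) - b * d ≡ b * (a * c - d)
  lemma = solve-∀

⋏-·ˡ : ∀ (v : I → ℤ) z f → (λ y → z * v y) ⋏ f ≋ z · (v ⋏ f)
⋏-·ˡ v z f []       = sym (ℤP.*-zeroʳ z)
⋏-·ˡ v z f (y ∷ ys) = ≡.trans (cong (λ s → z * v y * f ys - s) (⋏-·ˡ v z (D y f) ys)) (lemma (v y) z (f ys) _)
  where
  lemma : ∀ a b c d → b * a * c - b * d ≡ b * (a * c - d)
  lemma = solve-∀

⋏-zeroʳ : ∀ (v : I → ℤ) {f} → f ≋ (λ _ → 0ℤ) → v ⋏ f ≋ (λ _ → 0ℤ)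
⋏-zeroʳ v {f} e L = ≡.trans (⋏-congʳ v e L) (≡.trans (⋏-·ʳ v 0ℤ (λ _ → 0ℤ) L) (ℤP.*-zeroˡ ((v ⋏ (λ _ → 0ℤ)) L)))

⋏-zeroˡ : ∀ {v : I → ℤ} f → (∀ y → v y ≡ 0ℤ) → v ⋏ f ≋ (λ _ → 0ℤ)
⋏-zeroˡ {v = v} f e L = ≡.trans (⋏-cong {g = f} (λ y → ≡.trans (e y) (sym (ℤP.*-zeroˡ (v y)))) ≋-refl L)
  (≡.trans (⋏-·ˡ v 0ℤ f L) (ℤP.*-zeroˡ ((v ⋏ f) L)))

⋏-anti : ∀ (v w : I → ℤ) f → v ⋏ w ⋏ f ≋ ⊝ (w ⋏ v ⋏ f)
⋏-anti v w f []       = refl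
⋏-anti v w f (y ∷ ys) = begin
  v y * (w ⋏ f) ys - (v ⋏ D y (w ⋏ f)) ys
    ≡⟨ cong (λ s → v y * (w ⋏ f) ys - s) (expand v w) ⟩
  v y * (w ⋏ f) ys - (w y * (v ⋏ f) ys + - 1ℤ * (v ⋏ w ⋏ D y f) ys)
    ≡⟨ cong (λ z → v y * (w ⋏ f) ys - (w y * (v ⋏ f) ys + - 1ℤ * z)) (⋏-anti v w (D y f) ys) ⟩
  v y * (w ⋏ f) ys - (w y * (v ⋏ f) ys + - 1ℤ * - (w ⋏ v ⋏ D y f) ys)
    ≡⟨ lemma (v y * (w ⋏ f) ys) (w y * (v ⋏ f) ys) _ ⟩
  - (w y * (v ⋏ f) ys - (v y * (w ⋏ f) ys + - 1ℤ * (w ⋏ v ⋏ D y f) ys))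
    ≡⟨ cong (λ z → - (w y * (v ⋏ f) ys - z)) (sym (expand w v)) ⟩
  - (w y * (v ⋏ f) ys - (w ⋏ D y (v ⋏ f)) ys) ∎
  where
  open ≡-Reasoning
  lemma : ∀ a b c → a - (b + - 1ℤ * - c) ≡ - (b - (a + - 1ℤ * c))
  lemma = solve-∀
  expand : ∀ v w → (v ⋏ D y (w ⋏ f)) ys ≡ w y * (v ⋏ f) ys + - 1ℤ * (v ⋏ w ⋏ D y f) ys
  expand v w = ≡.trans (⋏-congʳ v {D y (w ⋏ f)} {(w y · f) ⊕ (- 1ℤ · (w ⋏ D y f))} (λ K → cong (w y * f K +_) (sym (ℤP.-1*i≡-i _))) ys)
    (≡.trans (⋏-⊕ʳ v (w y · f) (- 1ℤ · (w ⋏ D y f)) ys) (cong₂ _+_ (⋏-·ʳ v (w y) f ys) (⋏-·ʳ v (- 1ℤ) (w ⋏ D y f) ys)))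

⋏*-⊕ : ∀ (us : List (I → ℤ)) f g → us ⋏* (f ⊕ g) ≋ us ⋏* f ⊕ us ⋏* g
⋏*-⊕ []       f g L = refl
⋏*-⊕ (u ∷ us) f g L = ≡.trans (⋏-congʳ u (⋏*-⊕ us f g) L) (⋏-⊕ʳ u (us ⋏* f) (us ⋏* g) L)

⋏*-zero : ∀ (us : List (I → ℤ)) {f} → f ≋ (λ _ → 0ℤ) → us ⋏* f ≋ (λ _ → 0ℤ)
⋏*-zero []       e = e
⋏*-zero (u ∷ us) e = ⋏-zeroʳ u (⋏*-zero us e)

-- The relation serves to transport vanishing from right to left, so the signs of permutations need
-- not be tracked.
_∝_ : ∀ {X : Set} → (X → ℤ) → (X → ℤ) → Set
f ∝ g = ∃[ c ] (∀ y → f y ≡ c * g y)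

≋⇒∝ : ∀ {X : Set} {f g : X → ℤ} → (∀ y → f y ≡ g y) → f ∝ g
≋⇒∝ {g = g} e = 1ℤ , λ y → ≡.trans (e y) (sym (ℤP.*-identityˡ (g y)))

∝-trans : ∀ {X : Set} {f g h : X → ℤ} → f ∝ g → g ∝ h → f ∝ h
∝-trans {h = h} (c , e) (d , e′) = c * d , λ y → ≡.trans (e y) (≡.trans (cong (c *_) (e′ y)) (sym (ℤP.*-assoc c d (h y))))

∝-zero : ∀ {X : Set} {f g : X → ℤ} → f ∝ g → (∀ y → g y ≡ 0ℤ) → ∀ y → f y ≡ 0ℤ
∝-zero (c , e) z y = ≡.trans (e y) (≡.trans (cong (c *_) (z y)) (ℤP.*-zeroʳ c))

⋏-∝ : ∀ (v : I → ℤ) {f g} → f ∝ g → (v ⋏ f) ∝ (v ⋏ g)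
⋏-∝ v {f} {g} (c , e) = c , λ L → ≡.trans (⋏-congʳ v e L) (⋏-·ʳ v c g L)

⋏-anti-∝ : ∀ (v w : I → ℤ) f → (v ⋏ w ⋏ f) ∝ (w ⋏ v ⋏ f)
⋏-anti-∝ v w f = - 1ℤ , λ L → ≡.trans (⋏-anti v w f L) (sym (ℤP.-1*i≡-i _))

wedge-↭ : ∀ {us vs : List (I → ℤ)} → us ↭ vs → wedge us ∝ wedge vs
wedge-↭ refl         = ≋⇒∝ (λ _ → refl)
wedge-↭ (prep u r)   = ⋏-∝ u (wedge-↭ r)
wedge-↭ (swap {xs = xs} u v r) = ∝-trans (⋏-anti-∝ u v (wedge xs)) (⋏-∝ v (⋏-∝ u (wedge-↭ r)))
wedge-↭ (trans r s)  = ∝-trans (wedge-↭ r) (wedge-↭ s)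

x≡-x⇒x≡0 : ∀ x → x ≡ - x → x ≡ 0ℤ
x≡-x⇒x≡0 x e = ℤP.*-cancelˡ-≡ (ℤ.+ 2) x 0ℤ (≡.trans (lemma x) (≡.trans (cong (_+ x) e) (ℤP.+-inverseˡ x)))
  where
  lemma : ∀ x → ℤ.+ 2 * x ≡ x + x
  lemma = solve-∀

⋏-self : ∀ (v : I → ℤ) f → v ⋏ v ⋏ f ≋ (λ _ → 0ℤ)
⋏-self v f L = x≡-x⇒x≡0 _ (⋏-anti v v f L)

⋏-dup : ∀ {u : I → ℤ} vs → Any (u ∝_) vs → u ⋏ wedge vs ≋ (λ _ → 0ℤ)
⋏-dup {u = u} (v ∷ vs) (here (c , e)) L = ≡.trans (⋏-cong {g = v ⋏ wedge vs} e ≋-refl L)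
  (≡.trans (⋏-·ˡ v c (v ⋏ wedge vs) L) (≡.trans (cong (c *_) (⋏-self v (wedge vs) L)) (ℤP.*-zeroʳ c)))
⋏-dup {u = u} (v ∷ vs) (there m) = ∝-zero (⋏-anti-∝ u v (wedge vs)) (⋏-zeroʳ v (⋏-dup vs m))

wedge-dup : ∀ us (u : I → ℤ) vs → Any (u ∝_) (us ++ vs) → wedge (us ++ u ∷ vs) ≋ (λ _ → 0ℤ)
wedge-dup us u vs m = ∝-zero (wedge-↭ (↭P.shift u us vs)) (⋏-dup (us ++ vs) m)

wedge-zero : ∀ us {u : I → ℤ} vs → (∀ y → u y ≡ 0ℤ) → wedge (us ++ u ∷ vs) ≋ (λ _ → 0ℤ)
wedge-zero us {u} vs e = ∝-zero (wedge-↭ (↭P.shift u us vs)) (⋏-zeroˡ (wedge (us ++ vs)) e)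

Low-⋏ : ∀ m (u : I → ℤ) f → Low m f → Low (suc m) (u ⋏ f)
Low-⋏ zero    u f l L       k       = ⋏-zeroʳ u (λ K → l K z≤n) L
Low-⋏ (suc m) u f l (y ∷ L) (s≤s k) = cong₂ _-_ (≡.trans (cong (u y *_) (l L k)) (ℤP.*-zeroʳ (u y)))
  (Low-⋏ m u (D y f) (λ K j → l (y ∷ K) (s≤s j)) L k)

Low-wedge : ∀ (us : List (I → ℤ)) → Low (suc (length us)) (wedge us)
Low-wedge []       (y ∷ L) k = refl
Low-wedge (u ∷ us) = Low-⋏ (suc (length us)) u (wedge us) (Low-wedge us)

Alt : Ser I → Set
Alt f = ∀ pre p q post → f (pre ++ p ∷ q ∷ post) ≡ - f (pre ++ q ∷ p ∷ post)

Alt-⋏ : ∀ (v : I → ℤ) {f} → Alt f → Alt (v ⋏ f)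
Alt-⋏ v {f} a [] p q post = begin
  v p * f (q ∷ post) - (v q * f (p ∷ post) - (v ⋏ D q (D p f)) post)
    ≡⟨ cong (λ z → v p * f (q ∷ post) - (v q * f (p ∷ post) - z))
         (≡.trans (⋏-congʳ v {D q (D p f)} { - 1ℤ · D p (D q f)} (λ K → ≡.trans (a [] p q K) (sym (ℤP.-1*i≡-i _))) post) (⋏-·ʳ v (- 1ℤ) (D p (D q f)) post)) ⟩
  v p * f (q ∷ post) - (v q * f (p ∷ post) - - 1ℤ * (v ⋏ D p (D q f)) post)
    ≡⟨ lemma (v p * f (q ∷ post)) (v q * f (p ∷ post)) _ ⟩
  - (v q * f (p ∷ post) - (v p * f (q ∷ post) - (v ⋏ D p (D q f)) post)) ∎
  where
  open ≡-Reasoning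
  lemma : ∀ a b c → a - (b - - 1ℤ * c) ≡ - (b - (a - c))
  lemma = solve-∀
Alt-⋏ v {f} a (y ∷ pre) p q post = ≡.trans
  (cong₂ (λ s t → v y * s - t) (a pre p q post) (Alt-⋏ v {D y f} (λ pre → a (y ∷ pre)) pre p q post))
  (lemma (v y) (f (pre ++ q ∷ p ∷ post)) _)
  where
  lemma : ∀ a b c → a * - b - - c ≡ - (a * b - c)
  lemma = solve-∀

Alt-wedge : ∀ (us : List (I → ℤ)) → Alt (wedge us)
Alt-wedge []       []       p q post = refl
Alt-wedge []       (_ ∷ _)  p q post = refl
Alt-wedge (u ∷ us) = Alt-⋏ u (Alt-wedge us)

sq : (A → ℤ) → (A → ℤ)
sq f L = f L * f L

Disj : (I → ℤ) → Ser I → Set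
Disj v f = ∀ pre y post → v y * f (pre ++ y ∷ post) ≡ 0ℤ

Disj-⋏ : ∀ {v w : I → ℤ} {f} → (∀ y → v y * w y ≡ 0ℤ) → Disj v f → Disj v (w ⋏ f)
Disj-⋏ {v = v} {w} {f} o d [] y post = begin
  v y * (w y * f post - (w ⋏ D y f) post)
    ≡⟨ lemma (v y) (w y) (f post) _ ⟩
  (v y * w y) * f post - v y * (w ⋏ D y f) post
    ≡⟨ cong₂ (λ s t → s * f post - t) (o y) (≡.trans (sym (⋏-·ʳ w (v y) (D y f) post)) (⋏-zeroʳ w (λ K → d [] y K) post)) ⟩
  0ℤ * f post - 0ℤ
    ≡⟨ ≡.trans (ℤP.+-identityʳ _) (ℤP.*-zeroˡ (f post)) ⟩
  0ℤ ∎
  where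
  open ≡-Reasoning
  lemma : ∀ a b c d → a * (b * c - d) ≡ (a * b) * c - a * d
  lemma = solve-∀
Disj-⋏ {v = v} {w} {f} o d (z ∷ pre) y post = ≡.trans
  (lemma (v y) (w z) (f (pre ++ y ∷ post)) _)
  (cong₂ (λ s t → s - t)
    (≡.trans (cong (w z *_) (d pre y post)) (ℤP.*-zeroʳ (w z)))
    (Disj-⋏ {v = v} {w} {D z f} o (λ pre → d (z ∷ pre)) pre y post))
  where
  lemma : ∀ a b c d → a * (b * c - d) ≡ b * (a * c) - a * d
  lemma = solve-∀

Disj-wedge : ∀ {v : I → ℤ} {us} → All (λ u → ∀ y → v y * u y ≡ 0ℤ) us → Disj v (wedge us)
Disj-wedge {v = v} [] []      y post = ℤP.*-zeroʳ (v y)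
Disj-wedge {v = v} [] (_ ∷ _) y post = ℤP.*-zeroʳ (v y)
Disj-wedge {v = v} {u ∷ us} (o ∷ os) = Disj-⋏ {v = v} {u} {wedge us} o (Disj-wedge {v = v} os)

-- A letter at which `v` is nonzero kills `f`, so the two terms of `v ⋏ f` are never both nonzero
-- and the square has no cross term.
sq-⋏ : ∀ (v : I → ℤ) f → Disj v f → sq (v ⋏ f) ≋ lin (sq v) ⊛ sq f
sq-⋏ v f d []       = sym (ℤP.*-zeroˡ (sq f []))
sq-⋏ v f d (y ∷ ys) = begin
  (v y * f ys - w) * (v y * f ys - w)
    ≡⟨ lemma (v y) (f ys) w ⟩
  sq v y * sq f ys + (w * w + - (ℤ.+ 2) * f ys * (v y * w))
    ≡⟨ cong (λ z → sq v y * sq f ys + (w * w + - (ℤ.+ 2) * f ys * z)) cross ⟩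
  sq v y * sq f ys + (w * w + - (ℤ.+ 2) * f ys * 0ℤ)
    ≡⟨ cong (λ z → sq v y * sq f ys + (w * w + z)) (ℤP.*-zeroʳ (- (ℤ.+ 2) * f ys)) ⟩
  sq v y * sq f ys + (w * w + 0ℤ)
    ≡⟨ cong (sq v y * sq f ys +_) (≡.trans (ℤP.+-identityʳ _) (sq-⋏ v (D y f) (λ pre → d (y ∷ pre)) ys)) ⟩
  sq v y * sq f ys + (lin (sq v) ⊛ D y (sq f)) ys
    ≡⟨ sym (D-lin (sq v) (sq f) y ys) ⟩
  (lin (sq v) ⊛ sq f) (y ∷ ys) ∎
  where
  open ≡-Reasoning
  w : ℤ
  w = (v ⋏ D y f) ys
  cross : v y * w ≡ 0ℤ
  cross = ≡.trans (sym (⋏-·ʳ v (v y) (D y f) ys)) (⋏-zeroʳ v (λ K → d [] y K) ys)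
  lemma : ∀ a b w → (a * b - w) * (a * b - w) ≡ (a * a) * (b * b) + (w * w + - (ℤ.+ 2) * b * (a * w))
  lemma = solve-∀

∏lin : List (I → ℤ) → Ser I
∏lin = foldr (λ u F → lin u ⊛ F) (con 1ℤ)

-- For vectors with disjoint supports at most one term of the determinant is nonzero, so its square
-- is the permanent of the squares, and a product of linear forms computes a permanent.
sq-wedge : ∀ {us : List (I → ℤ)} → AllPairs (λ u v → ∀ y → u y * v y ≡ 0ℤ) us → sq (wedge us) ≋ ∏lin (map sq us)
sq-wedge [] []      = refl
sq-wedge [] (_ ∷ _) = refl
sq-wedge {us = u ∷ us} (o ∷ os) = ≋-trans (sq-⋏ u (wedge us) (Disj-wedge {v = u} o)) (⊛-congˡ {F = lin (sq u)} (sq-wedge os))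

-- Derivations acting on alternating forms

-- κ y lists the letters by which the derivation replaces y.
act₁ : (I → List I) → (I → ℤ) → (I → ℤ)
act₁ κ v y = ∑ (κ y) v

ext : (I → List I) → List I → List (List I)
ext κ []       = []
ext κ (y ∷ ys) = map (_∷ ys) (κ y) ++ map (y ∷_) (ext κ ys)

act : (I → List I) → Ser I → Ser I
act κ f []       = 0ℤ
act κ f (y ∷ ys) = ∑ (κ y) (λ z → f (z ∷ ys)) + act κ (D y f) ys

∑-ext : ∀ (κ : I → List I) f L → ∑ (ext κ L) f ≡ act κ f L
∑-ext κ f []       = refl
∑-ext κ f (y ∷ ys) = ≡.trans (∑-++ (map (_∷ ys) (κ y)) _ f)
  (cong₂ _+_ (∑-map (_∷ ys) (κ y) f) (≡.trans (∑-map (y ∷_) (ext κ ys) f) (∑-ext κ (D y f) ys)))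

act-cong : ∀ (κ : I → List I) {f g} → f ≋ g → act κ f ≋ act κ g
act-cong κ {f} {g} e L = ≡.trans (sym (∑-ext κ f L)) (≡.trans (∑-cong (ext κ L) e) (∑-ext κ g L))

act-⊕ : ∀ (κ : I → List I) f g → act κ (f ⊕ g) ≋ act κ f ⊕ act κ g
act-⊕ κ f g L = ≡.trans (sym (∑-ext κ (f ⊕ g) L)) (≡.trans (∑-+ (ext κ L) f g) (cong₂ _+_ (∑-ext κ f L) (∑-ext κ g L)))

act-· : ∀ (κ : I → List I) z f → act κ (z · f) ≋ z · act κ f
act-· κ z f L = ≡.trans (sym (∑-ext κ (z · f) L)) (≡.trans (∑-*ˡ (ext κ L) z f) (cong (z *_) (∑-ext κ f L)))

act-con : ∀ (κ : I → List I) z → act κ (con z) ≋ (λ _ → 0ℤ)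
act-con κ z []      = refl
act-con κ z (y ∷ L) = cong₂ _+_ (∑-0 (κ y)) (≡.trans (sym (∑-ext κ (λ _ → 0ℤ) L)) (∑-0 (ext κ L)))

act-⋏ : ∀ (κ : I → List I) v f → act κ (v ⋏ f) ≋ act₁ κ v ⋏ f ⊕ v ⋏ act κ f
act-⋏ κ v f []       = refl
act-⋏ κ v f (y ∷ ys) = begin
  ∑ (κ y) (λ z → v z * f ys - (v ⋏ D z f) ys) + act κ (v y · f ⊕ (⊝ (v ⋏ D y f))) ys
    ≡⟨ cong₂ _+_ (≡.trans (∑-+ (κ y) _ _) (cong₂ _+_ (∑-*ʳ (κ y) (f ys) v) (≡.trans (∑-neg (κ y) _) (cong -_ (sym (⋏-∑ (κ y) ys))))))
         (≡.trans (act-cong κ {v y · f ⊕ (⊝ (v ⋏ D y f))} {v y · f ⊕ (- 1ℤ) · (v ⋏ D y f)} (λ K → cong (v y * f K +_) (sym (ℤP.-1*i≡-i _))) ys)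
           (≡.trans (act-⊕ κ (v y · f) ((- 1ℤ) · (v ⋏ D y f)) ys) (cong₂ _+_ (act-· κ (v y) f ys)
             (≡.trans (act-· κ (- 1ℤ) (v ⋏ D y f) ys) (cong (- 1ℤ *_) (act-⋏ κ v (D y f) ys)))))) ⟩
  (a * f ys - p) + (v y * act κ f ys + - 1ℤ * (q + r))
    ≡⟨ lemma (a * f ys) p (v y * act κ f ys) q r ⟩
  (a * f ys - q) + (v y * act κ f ys - (p + r))
    ≡⟨ cong (λ z → (a * f ys - q) + (v y * act κ f ys - z)) (sym (⋏-⊕ʳ v (∑S (κ y) (λ z → D z f)) (act κ (D y f)) ys)) ⟩
  (act₁ κ v ⋏ f) (y ∷ ys) + (v ⋏ act κ f) (y ∷ ys) ∎
  where
  open ≡-Reasoning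
  a p q r : ℤ
  a = act₁ κ v y
  p = (v ⋏ ∑S (κ y) (λ z → D z f)) ys
  q = (act₁ κ v ⋏ D y f) ys
  r = (v ⋏ act κ (D y f)) ys
  lemma : ∀ s p t q r → (s - p) + (t + - 1ℤ * (q + r)) ≡ (s - q) + (t - (p + r))
  lemma = solve-∀
  ⋏-∑ : ∀ zs K → (v ⋏ ∑S zs (λ z → D z f)) K ≡ ∑ zs (λ z → (v ⋏ D z f) K)
  ⋏-∑ []       K = ⋏-zeroʳ v (λ _ → refl) K
  ⋏-∑ (z ∷ zs) K = ≡.trans (⋏-⊕ʳ v (D z f) (∑S zs (λ z → D z f)) K) (cong ((v ⋏ D z f) K +_) (⋏-∑ zs K))

act-∝ : ∀ (κ : I → List I) {f g} → f ∝ g → act κ f ∝ act κ g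
act-∝ κ {f} {g} (c , e) = c , λ L → ≡.trans (act-cong κ e L) (act-· κ c g L)

⋏*-cong : ∀ (us : List (I → ℤ)) {f g} → f ≋ g → us ⋏* f ≋ us ⋏* g
⋏*-cong []       e = e
⋏*-cong (u ∷ us) e = ⋏-congʳ u (⋏*-cong us e)

act-wedge : ∀ (κ : I → List I) (φ : A → I → ℤ) Ss →
            (∀ us S ws → Ss ≡ us ++ S ∷ ws → wedge (map φ us ++ act₁ κ (φ S) ∷ map φ ws) ≋ (λ _ → 0ℤ)) →
            act κ (wedge (map φ Ss)) ≋ (λ _ → 0ℤ)
act-wedge κ φ Ss h = go [] Ss refl
  where
  -- The derivation has already passed the factors `us`, which stay outside as they are.
  go : ∀ us ws → Ss ≡ us ++ ws → map φ us ⋏* act κ (wedge (map φ ws)) ≋ (λ _ → 0ℤ)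
  go us []       e = ⋏*-zero (map φ us) (act-con κ 1ℤ)
  go us (w ∷ ws) e L = ≡.trans
    (⋏*-cong (map φ us) (act-⋏ κ (φ w) W) L)
    (≡.trans (⋏*-⊕ (map φ us) (act₁ κ (φ w) ⋏ W) (φ w ⋏ act κ W) L)
      (cong₂ _+_
        (≡.trans (cong (λ f → f L) (sym (ListP.foldr-++ _⋏_ (con 1ℤ) (map φ us) (act₁ κ (φ w) ∷ map φ ws)))) (h us w ws e L))
        (≡.trans (cong (λ f → f L) (sym (≡.trans (cong (_⋏* act κ W) (ListP.map-++ φ us (w ∷ []))) (ListP.foldr-++ _⋏_ (act κ W) (map φ us) (φ w ∷ [])))))
          (go (us ++ w ∷ []) ws (≡.trans e (sym (ListP.++-assoc us (w ∷ []) ws))) L))))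
    where
    W : Ser _
    W = wedge (map φ ws)

Unique-resp-↭ : ∀ {X : Set} {xs ys : List X} → xs ↭ ys → Unique xs → Unique ys
Unique-resp-↭ {X} r = ↭ₛP.Unique-resp-↭ (≡.setoid X) (↭⇒↭ₛ r)

-- Gram forms of alternating forms on words

-- F(i₁j₁,…,iᵣjᵣ) is a Gram matrix in (i₁…iᵣ), (j₁…jᵣ).

Gram : ∀ {n} → Ser (Fin n × Fin n) → Set
Gram {n} F = ∀ r → Σ (List (Ser (Fin n))) λ Φs →
  ∀ L → length L ≡ r → F L ≡ ∑ Φs (λ Φ → Φ (map proj₁ L) * Φ (map proj₂ L))

strings : ∀ n → ℕ → List (List (Fin n))
strings n zero    = [ [] ]
strings n (suc m) = concatMap (λ i → map (i ∷_) (strings n m)) (fins n)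

∑-strings : ∀ n m f → ∑ (strings n (suc m)) f ≡ ∑ (fins n) (λ i → ∑ (strings n m) (f ∘ (i ∷_)))
∑-strings n m f = ≡.trans (∑-concatMap (λ i → map (i ∷_) (strings n m)) (fins n) f)
  (∑-cong (fins n) (λ i → ∑-map (i ∷_) (strings n m) f))

stringsBelow : ∀ n → ℕ → List (List (Fin n))
stringsBelow n zero    = []
stringsBelow n (suc N) = strings n N ++ stringsBelow n N

module Tensors (n : ℕ) where
  private
    module M = Matrices n
    module X = Diagonal n
    Y : Set
    Y = List (Fin n)
  open M using (conj; sub; Inv; inv; mkInv; Res; diag)

  κ₀ : Fin n → Fin n → Fin n → List (Fin n)
  κ₀ a b y = if does (y FinP.≟ b) then [ a ] else []

  ∑-κ₀ : ∀ a b y f → ∑ (κ₀ a b y) f ≡ δ b y * f a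
  ∑-κ₀ a b y f with y FinP.≟ b
  ... | yes refl = ≡.trans (ℤP.+-identityʳ (f a)) (≡.trans (sym (ℤP.*-identityˡ (f a))) (cong (_* f a) (sym (δ-refl y))))
  ... | no ne    = ≡.trans (sym (ℤP.*-zeroˡ (f a))) (cong (_* f a) (sym (δ-≢ (ne ∘ sym))))

  κ₁ : Fin n → Fin n → Y → List Y
  κ₁ a b = ext (κ₀ a b)

  ∑-κ₁ : ∀ a b i T (f : Y → ℤ) → ∑ (κ₁ a b (i ∷ T)) f ≡ δ b i * f (a ∷ T) + ∑ (κ₁ a b T) (f ∘ (i ∷_))
  ∑-κ₁ a b i T f = ≡.trans (∑-++ (map (_∷ T) (κ₀ a b i)) _ f)
    (cong₂ _+_ (≡.trans (∑-map (_∷ T) (κ₀ a b i) f) (∑-κ₀ a b i _)) (∑-map (i ∷_) (κ₁ a b T) f))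

  -- On the span of `𝒯`, with its words as an orthonormal basis, `κ₁ a b` and `κ₁ b a` are
  -- transposes of each other.
  Adjoint : List Y → Set
  Adjoint 𝒯 = ∀ a b (H : Y → Y → ℤ) →
    ∑ 𝒯 (λ T → ∑ (κ₁ a b T) (λ T′ → H T′ T)) ≡ ∑ 𝒯 (λ T → ∑ (κ₁ b a T) (λ T′ → H T T′))

  strings-adjoint : ∀ m → Adjoint (strings n m)
  strings-adjoint zero    a b H = refl
  strings-adjoint (suc m) a b H = begin
    ∑ (strings n (suc m)) (λ T → ∑ (κ₁ a b T) (λ T′ → H T′ T))
      ≡⟨ ∑-strings n m _ ⟩
    ∑ (fins n) (λ i → ∑ (strings n m) (λ T → ∑ (κ₁ a b (i ∷ T)) (λ T′ → H T′ (i ∷ T))))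
      ≡⟨ ∑-cong (fins n) (λ i → ≡.trans (∑-cong (strings n m) (λ T → ∑-κ₁ a b i T _)) (≡.trans (∑-+ (strings n m) _ _)
           (cong (_+ ∑ (strings n m) (λ T → ∑ (κ₁ a b T) (λ T′ → H (i ∷ T′) (i ∷ T)))) (∑-*ˡ (strings n m) (δ b i) _)))) ⟩
    ∑ (fins n) (λ i → δ b i * ∑ (strings n m) (λ T → H (a ∷ T) (i ∷ T)) + ∑ (strings n m) (λ T → ∑ (κ₁ a b T) (λ T′ → H (i ∷ T′) (i ∷ T))))
      ≡⟨ ∑-δ′ b _ _ ⟩
    ∑ (strings n m) (λ T → H (a ∷ T) (b ∷ T)) + ∑ (fins n) (λ i → ∑ (strings n m) (λ T → ∑ (κ₁ a b T) (λ T′ → H (i ∷ T′) (i ∷ T))))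
      ≡⟨ cong (∑ (strings n m) (λ T → H (a ∷ T) (b ∷ T)) +_) (∑-cong (fins n) (λ i → strings-adjoint m a b (λ T T′ → H (i ∷ T) (i ∷ T′)))) ⟩
    ∑ (strings n m) (λ T → H (a ∷ T) (b ∷ T)) + ∑ (fins n) (λ i → ∑ (strings n m) (λ T → ∑ (κ₁ b a T) (λ T′ → H (i ∷ T) (i ∷ T′))))
      ≡⟨ sym (∑-δ′ a _ _) ⟩
    ∑ (fins n) (λ i → δ a i * ∑ (strings n m) (λ T → H (i ∷ T) (b ∷ T)) + ∑ (strings n m) (λ T → ∑ (κ₁ b a T) (λ T′ → H (i ∷ T) (i ∷ T′))))
      ≡⟨ sym (∑-cong (fins n) (λ i → ≡.trans (∑-cong (strings n m) (λ T → ∑-κ₁ b a i T _)) (≡.trans (∑-+ (strings n m) _ _)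
           (cong (_+ ∑ (strings n m) (λ T → ∑ (κ₁ b a T) (λ T′ → H (i ∷ T) (i ∷ T′)))) (∑-*ˡ (strings n m) (δ a i) _))))) ⟩
    ∑ (fins n) (λ i → ∑ (strings n m) (λ T → ∑ (κ₁ b a (i ∷ T)) (λ T′ → H (i ∷ T) T′)))
      ≡⟨ sym (∑-strings n m _) ⟩
    ∑ (strings n (suc m)) (λ T → ∑ (κ₁ b a T) (λ T′ → H T T′)) ∎
    where open ≡-Reasoning

  stringsBelow-adjoint : ∀ N → Adjoint (stringsBelow n N)
  stringsBelow-adjoint zero    a b H = refl
  stringsBelow-adjoint (suc N) a b H = ≡.trans (∑-++ (strings n N) _ _)
    (≡.trans (cong₂ _+_ (strings-adjoint N a b H) (stringsBelow-adjoint N a b H)) (sym (∑-++ (strings n N) _ _)))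

  module Pairing (𝒯 : List Y) where

    -- A matrix unit is to act on the first letter of a word, and the two words share the rest T.
    -- For forms that alternate inside each word the first position represents all of them, up to a
    -- positive factor.
    gram : Ser Y → Ser Y → Ser (Fin n × Fin n)
    gram f g []            = f [] * g []
    gram f g ((i , j) ∷ L) = ∑ 𝒯 (λ T → gram (D (i ∷ T) f) (D (j ∷ T) g) L)

    gram-cong : ∀ {f f′ g g′} → f ≋ f′ → g ≋ g′ → gram f g ≋ gram f′ g′
    gram-cong e e′ []            = cong₂ _*_ (e []) (e′ [])
    gram-cong e e′ ((i , j) ∷ L) = ∑-cong 𝒯 (λ T → gram-cong (λ K → e ((i ∷ T) ∷ K)) (λ K → e′ ((j ∷ T) ∷ K)) L)

    gram-⊕ˡ : ∀ f f′ g → gram (f ⊕ f′) g ≋ gram f g ⊕ gram f′ g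
    gram-⊕ˡ f f′ g []            = ℤP.*-distribʳ-+ (g []) (f []) (f′ [])
    gram-⊕ˡ f f′ g ((i , j) ∷ L) = ≡.trans (∑-cong 𝒯 (λ T → gram-⊕ˡ (D (i ∷ T) f) (D (i ∷ T) f′) (D (j ∷ T) g) L)) (∑-+ 𝒯 _ _)

    gram-⊕ʳ : ∀ f g g′ → gram f (g ⊕ g′) ≋ gram f g ⊕ gram f g′
    gram-⊕ʳ f g g′ []            = ℤP.*-distribˡ-+ (f []) (g []) (g′ [])
    gram-⊕ʳ f g g′ ((i , j) ∷ L) = ≡.trans (∑-cong 𝒯 (λ T → gram-⊕ʳ (D (i ∷ T) f) (D (j ∷ T) g) (D (j ∷ T) g′) L)) (∑-+ 𝒯 _ _)

    gram-·ˡ : ∀ z f g → gram (z · f) g ≋ z · gram f g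
    gram-·ˡ z f g []            = ℤP.*-assoc z (f []) (g [])
    gram-·ˡ z f g ((i , j) ∷ L) = ≡.trans (∑-cong 𝒯 (λ T → gram-·ˡ z (D (i ∷ T) f) (D (j ∷ T) g) L)) (∑-*ˡ 𝒯 z _)

    gram-·ʳ : ∀ z f g → gram f (z · g) ≋ z · gram f g
    gram-·ʳ z f g []            = lemma (f []) z (g [])
      where
      lemma : ∀ a b c → a * (b * c) ≡ b * (a * c)
      lemma = solve-∀
    gram-·ʳ z f g ((i , j) ∷ L) = ≡.trans (∑-cong 𝒯 (λ T → gram-·ʳ z (D (i ∷ T) f) (D (j ∷ T) g) L)) (∑-*ˡ 𝒯 z _)

    gram-∑ˡ : ∀ {A : Set} (xs : List A) f g → gram (∑S xs f) g ≋ ∑S xs (λ x → gram (f x) g)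
    gram-∑ˡ []       f g L = ≡.trans (gram-·ˡ 0ℤ (λ _ → 0ℤ) g L) (ℤP.*-zeroˡ (gram (λ _ → 0ℤ) g L))
    gram-∑ˡ (x ∷ xs) f g L = ≡.trans (gram-⊕ˡ (f x) (∑S xs f) g L) (cong (gram (f x) g L +_) (gram-∑ˡ xs f g L))

    gram-∑ʳ : ∀ {A : Set} (xs : List A) f g → gram f (∑S xs g) ≋ ∑S xs (λ x → gram f (g x))
    gram-∑ʳ []       f g L = ≡.trans (gram-·ʳ 0ℤ f (λ _ → 0ℤ) L) (ℤP.*-zeroˡ (gram f (λ _ → 0ℤ) L))
    gram-∑ʳ (x ∷ xs) f g L = ≡.trans (gram-⊕ʳ f (g x) (∑S xs g) L) (cong (gram f (g x) L +_) (gram-∑ʳ xs f g L))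

    gram-zeroˡ : ∀ {f} g → f ≋ (λ _ → 0ℤ) → gram f g ≋ (λ _ → 0ℤ)
    gram-zeroˡ {f} g e = ≋-trans (gram-cong {g = g} e ≋-refl) (gram-∑ˡ [] (λ (_ : Y) → f) g)

    gram-zeroʳ : ∀ f {g} → g ≋ (λ _ → 0ℤ) → gram f g ≋ (λ _ → 0ℤ)
    gram-zeroʳ f {g} e = ≋-trans (gram-cong {f} ≋-refl e) (gram-∑ʳ [] f (λ (_ : Y) → g))

    Low-gram : ∀ m {f g} → Low m f → Low m (gram f g)
    Low-gram zero    {g = g} l L _ = gram-zeroˡ g (λ K → l K z≤n) L
    Low-gram (suc m) l ((i , j) ∷ L) (s≤s k) = ∑-zero 𝒯 (λ T → Low-gram m (λ K j → l ((i ∷ T) ∷ K) (s≤s j)) L k)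

    -- Interchanging two pairs changes the sign of both forms; the sums over their tails are
    -- interchanged along with them.
    Comm-gram : ∀ {f g} → Alt f → Alt g → Comm (gram f g)
    Comm-gram α β .perm = go α β
      where
      Alt-D : ∀ {f : Ser Y} y → Alt f → Alt (D y f)
      Alt-D y a pre = a (y ∷ pre)
      swapped : ∀ {f : Ser Y} y z → Alt f → D y (D z f) ≋ (- 1ℤ) · D z (D y f)
      swapped y z a K = ≡.trans (a [] z y K) (sym (ℤP.-1*i≡-i _))
      lemma : ∀ x → - 1ℤ * (- 1ℤ * x) ≡ x
      lemma = solve-∀
      go : ∀ {f g} → Alt f → Alt g → ∀ {L L′} → L ↭ L′ → gram f g L ≡ gram f g L′
      go α β refl = refl
      go {f} {g} α β (prep (i , j) r) = ∑-cong 𝒯 (λ T → go (Alt-D {f} (i ∷ T) α) (Alt-D {g} (j ∷ T) β) r)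
      go {f} {g} α β (swap {xs = L} (i , j) (i′ , j′) r) = ≡.trans
        (∑-cong 𝒯 (λ T → ∑-cong 𝒯 (λ T′ → ≡.trans
          (gram-cong (swapped {f} (i′ ∷ T′) (i ∷ T) α) (swapped {g} (j′ ∷ T′) (j ∷ T) β) L)
          (≡.trans (gram-·ˡ (- 1ℤ) (D (i ∷ T) (D (i′ ∷ T′) f)) _ L)
            (≡.trans (cong (- 1ℤ *_) (gram-·ʳ (- 1ℤ) (D (i ∷ T) (D (i′ ∷ T′) f)) (D (j ∷ T) (D (j′ ∷ T′) g)) L))
              (≡.trans (lemma _) (go (Alt-D {D (i′ ∷ T′) f} (i ∷ T) (Alt-D {f} (i′ ∷ T′) α)) (Alt-D {D (j′ ∷ T′) g} (j ∷ T) (Alt-D {g} (j′ ∷ T′) β)) r)))))))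
        (∑-comm 𝒯 𝒯 _)
      go α β (trans r s) = ≡.trans (go α β r) (go α β s)

    -- The derivation of words also replaces letters inside the shared tails. These terms agree on
    -- both sides by adjointness, and what remains are the replacements of first letters that define
    -- `conj`.
    conj-gram : Adjoint 𝒯 → ∀ a b f g → conj a b (gram f g) ≋ gram (act (κ₁ a b) f) g ⊖ gram f (act (κ₁ b a) g)
    conj-gram adj a b f g [] = lemma (f []) (g [])
      where
      lemma : ∀ x y → 0ℤ ≡ 0ℤ * y - x * 0ℤ
      lemma = solve-∀
    conj-gram adj a b f g ((i , j) ∷ L) = begin
      (δ b i * ∑ 𝒯 (λ T → gram (f⟨ a ∷ T ⟩) (g⟨ j ∷ T ⟩) L) - δ a j * ∑ 𝒯 (λ T → gram (f⟨ i ∷ T ⟩) (g⟨ b ∷ T ⟩) L))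
        + conj a b (∑S 𝒯 (λ T → gram (f⟨ i ∷ T ⟩) (g⟨ j ∷ T ⟩))) L
        ≡⟨ cong₂ _+_ (cong₂ _-_ (sym (∑-*ˡ 𝒯 (δ b i) _)) (sym (∑-*ˡ 𝒯 (δ a j) _)))
             (≡.trans (M.conj-∑ a b 𝒯 (λ T → gram (f⟨ i ∷ T ⟩) (g⟨ j ∷ T ⟩)) L)
               (≡.trans (∑-cong 𝒯 (λ T → conj-gram adj a b (f⟨ i ∷ T ⟩) (g⟨ j ∷ T ⟩) L)) (≡.trans (∑-+ 𝒯 _ _) (cong (∑ 𝒯 w +_) (∑-neg 𝒯 w′))))) ⟩
      (∑ 𝒯 u - ∑ 𝒯 u′) + (∑ 𝒯 w - ∑ 𝒯 w′)
        ≡⟨ lemma (∑ 𝒯 u) (∑ 𝒯 u′) (∑ 𝒯 v) (∑ 𝒯 w) (∑ 𝒯 w′) ⟩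
      ((∑ 𝒯 u + ∑ 𝒯 v) + ∑ 𝒯 w) - ((∑ 𝒯 u′ + ∑ 𝒯 v) + ∑ 𝒯 w′)
        ≡⟨ cong (λ z → ((∑ 𝒯 u + ∑ 𝒯 v) + ∑ 𝒯 w) - ((∑ 𝒯 u′ + z) + ∑ 𝒯 w′)) (adj a b (λ T T′ → gram (f⟨ i ∷ T ⟩) (g⟨ j ∷ T′ ⟩) L)) ⟩
      ((∑ 𝒯 u + ∑ 𝒯 v) + ∑ 𝒯 w) - ((∑ 𝒯 u′ + ∑ 𝒯 v′) + ∑ 𝒯 w′)
        ≡⟨ sym (cong₂ _-_ (≡.trans (∑-cong 𝒯 expandˡ) (≡.trans (∑-+ 𝒯 _ w) (cong (_+ ∑ 𝒯 w) (∑-+ 𝒯 u v))))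
                          (≡.trans (∑-cong 𝒯 expandʳ) (≡.trans (∑-+ 𝒯 _ w′) (cong (_+ ∑ 𝒯 w′) (∑-+ 𝒯 u′ v′))))) ⟩
      gram (act (κ₁ a b) f) g ((i , j) ∷ L) - gram f (act (κ₁ b a) g) ((i , j) ∷ L) ∎
      where
      open ≡-Reasoning
      f⟨_⟩ g⟨_⟩ : Y → Ser Y
      f⟨ y ⟩ = D y f
      g⟨ y ⟩ = D y g
      u v w u′ v′ w′ : Y → ℤ
      u T = δ b i * gram (f⟨ a ∷ T ⟩) (g⟨ j ∷ T ⟩) L
      v T = ∑ (κ₁ a b T) (λ T′ → gram (f⟨ i ∷ T′ ⟩) (g⟨ j ∷ T ⟩) L)
      w T = gram (act (κ₁ a b) (f⟨ i ∷ T ⟩)) (g⟨ j ∷ T ⟩) L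
      u′ T = δ a j * gram (f⟨ i ∷ T ⟩) (g⟨ b ∷ T ⟩) L
      v′ T = ∑ (κ₁ b a T) (λ T′ → gram (f⟨ i ∷ T ⟩) (g⟨ j ∷ T′ ⟩) L)
      w′ T = gram (f⟨ i ∷ T ⟩) (act (κ₁ b a) (g⟨ j ∷ T ⟩)) L
      lemma : ∀ u u′ v w w′ → (u - u′) + (w - w′) ≡ ((u + v) + w) - ((u′ + v) + w′)
      lemma = solve-∀
      expandˡ : ∀ T → gram (D (i ∷ T) (act (κ₁ a b) f)) (g⟨ j ∷ T ⟩) L ≡ (u T + v T) + w T
      expandˡ T = ≡.trans (gram-⊕ˡ (∑S (κ₁ a b (i ∷ T)) f⟨_⟩) (act (κ₁ a b) (f⟨ i ∷ T ⟩)) (g⟨ j ∷ T ⟩) L)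
        (cong (_+ w T) (≡.trans (gram-∑ˡ (κ₁ a b (i ∷ T)) f⟨_⟩ (g⟨ j ∷ T ⟩) L) (∑-κ₁ a b i T _)))
      expandʳ : ∀ T → gram (f⟨ i ∷ T ⟩) (D (j ∷ T) (act (κ₁ b a) g)) L ≡ (u′ T + v′ T) + w′ T
      expandʳ T = ≡.trans (gram-⊕ʳ (f⟨ i ∷ T ⟩) (∑S (κ₁ b a (j ∷ T)) g⟨_⟩) (act (κ₁ b a) (g⟨ j ∷ T ⟩)) L)
        (cong (_+ w′ T) (≡.trans (gram-∑ʳ (κ₁ b a (j ∷ T)) (f⟨ i ∷ T ⟩) g⟨_⟩ L) (∑-κ₁ b a j T _)))

    -- One functional for each choice of tails T₁, ..., Tᵣ. It turns a form on words into a form on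
    -- first letters, which gives the vectors of the Gram matrix.
    tails : ℕ → List (Ser Y → Ser (Fin n))
    tails zero    = [ (λ f _ → f []) ]
    tails (suc r) = concatMap (λ T → map (λ t f → λ { [] → 0ℤ ; (i ∷ is) → t (D (i ∷ T) f) is }) (tails r)) 𝒯

    gram-tails : ∀ f g L → gram f g L ≡ ∑ (tails (length L)) (λ t → t f (map proj₁ L) * t g (map proj₂ L))
    gram-tails f g []            = sym (ℤP.+-identityʳ _)
    gram-tails f g ((i , j) ∷ L) = sym (≡.trans (∑-concatMap _ 𝒯 _) (∑-cong 𝒯 (λ T →
      ≡.trans (∑-map _ (tails (length L)) _) (sym (gram-tails (D (i ∷ T) f) (D (j ∷ T) g) L)))))

    Gram-gram : ∀ f → Gram (gram f f)
    Gram-gram f r = map (λ t → t f) (tails r) , λ { L refl → ≡.trans (gram-tails f f L) (sym (∑-map (λ t → t f) (tails (length L)) _)) }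

    marg : Ser Y → Ser (Fin n)
    marg f []      = f []
    marg f (i ∷ L) = ∑ 𝒯 (λ T → marg (D (i ∷ T) f) L)

    marg₁ : (Y → ℤ) → (Fin n → ℤ)
    marg₁ u i = ∑ 𝒯 (λ T → u (i ∷ T))

    Res-gram : ∀ f → Res (gram f f) ≋ marg (sq f)
    Res-gram f []      = refl
    Res-gram f (i ∷ L) = ∑-cong 𝒯 (λ T → Res-gram (D (i ∷ T) f) L)

    marg-cong : ∀ {f g} → f ≋ g → marg f ≋ marg g
    marg-cong e []      = e []
    marg-cong e (i ∷ L) = ∑-cong 𝒯 (λ T → marg-cong (λ K → e ((i ∷ T) ∷ K)) L)

    marg-⊕ : ∀ f g → marg (f ⊕ g) ≋ marg f ⊕ marg g
    marg-⊕ f g []      = refl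
    marg-⊕ f g (i ∷ L) = ≡.trans (∑-cong 𝒯 (λ T → marg-⊕ (D (i ∷ T) f) (D (i ∷ T) g) L)) (∑-+ 𝒯 _ _)

    -- The product distributes the letters among its factors, and each letter carries its own sum
    -- over tails to the factor that receives it.
    marg-⊛ : ∀ f g → marg (f ⊛ g) ≋ marg f ⊛ marg g
    marg-⊛ f g []      = refl
    marg-⊛ f g (i ∷ L) = begin
      ∑ 𝒯 (λ T → marg (D (i ∷ T) f ⊛ g ⊕ f ⊛ D (i ∷ T) g) L)
        ≡⟨ ∑-cong 𝒯 (λ T → ≡.trans (marg-⊕ (D (i ∷ T) f ⊛ g) (f ⊛ D (i ∷ T) g) L)
             (cong₂ _+_ (marg-⊛ (D (i ∷ T) f) g L) (marg-⊛ f (D (i ∷ T) g) L))) ⟩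
      ∑ 𝒯 (λ T → (marg (D (i ∷ T) f) ⊛ marg g) L + (marg f ⊛ marg (D (i ∷ T) g)) L)
        ≡⟨ ≡.trans (∑-+ 𝒯 _ _) (sym (cong₂ _+_ (⊛-∑ˡ 𝒯 (λ T → marg (D (i ∷ T) f)) (marg g) L) (⊛-∑ʳ 𝒯 (marg f) (λ T → marg (D (i ∷ T) g)) L))) ⟩
      (marg f ⊛ marg g) (i ∷ L) ∎
      where open ≡-Reasoning

    marg-zero : ∀ {f} → f ≋ (λ _ → 0ℤ) → marg f ≋ (λ _ → 0ℤ)
    marg-zero e []      = e []
    marg-zero e (i ∷ L) = ∑-zero 𝒯 (λ T → marg-zero (λ K → e ((i ∷ T) ∷ K)) L)

    marg-con : ∀ z → marg (con z) ≋ con z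
    marg-con z []      = refl
    marg-con z (i ∷ L) = ∑-zero 𝒯 (λ T → marg-zero (λ _ → refl) L)

    marg-lin : ∀ u → marg (lin u) ≋ lin (marg₁ u)
    marg-lin u []      = refl
    marg-lin u (i ∷ L) = ≡.trans (∑-cong 𝒯 (λ T → marg-con (u (i ∷ T)) L)) (go L)
      where
      go : ∀ L → ∑ 𝒯 (λ T → con (u (i ∷ T)) L) ≡ con (marg₁ u i) L
      go []      = refl
      go (_ ∷ _) = ∑-0 𝒯

    marg-∏lin : ∀ us → marg (∏lin us) ≋ ∏lin (map marg₁ us)
    marg-∏lin []       = marg-con 1ℤ
    marg-∏lin (u ∷ us) = ≋-trans (marg-⊛ (lin u) (∏lin us)) (⊛-cong (marg-lin u) (marg-∏lin us))

-- Minors and the volume form of the representation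

-- On words of length |S| this is the minor with columns S.
ε : List (Fin n) → Ser (Fin n)
ε S = wedge (map δ S)

Xs : List (Fin n) → Ser (Fin n)
Xs S = ∏lin (map δ S)

χ : List (Fin n) → Fin n → ℤ
χ S i = ∑ S (λ s → δ s i)

sq-δ : ∀ (s i : Fin n) → sq (δ s) i ≡ δ s i
sq-δ s i with s FinP.≟ i
... | yes refl = ≡.trans (cong (λ z → z * z) (δ-refl s)) (sym (δ-refl s))
... | no ne    = ≡.trans (cong (λ z → z * z) (δ-≢ ne)) (sym (δ-≢ ne))

δ-orth : ∀ {s t : Fin n} → s ≢ t → ∀ i → δ s i * δ t i ≡ 0ℤ
δ-orth {s = s} {t} ne i with s FinP.≟ i
... | yes refl = ≡.trans (cong (δ s s *_) (δ-≢ (ne ∘ sym))) (ℤP.*-zeroʳ (δ s s))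
... | no s≢i   = ≡.trans (cong (_* δ t i) (δ-≢ s≢i)) (ℤP.*-zeroˡ (δ t i))

lin-cong : ∀ {u v : I → ℤ} → (∀ i → u i ≡ v i) → lin u ≋ lin v
lin-cong e []      = refl
lin-cong e (i ∷ L) = cong (λ z → con z L) (e i)

lin-· : ∀ (c : ℤ) (u : I → ℤ) → lin (λ i → u i * c) ≋ c · lin u
lin-· c u []          = sym (ℤP.*-zeroʳ c)
lin-· c u (i ∷ [])    = ℤP.*-comm (u i) c
lin-· c u (i ∷ _ ∷ _) = sym (ℤP.*-zeroʳ c)

∏lin-cong : ∀ (xs : List A) {f g : A → I → ℤ} → (∀ x → x ∈ xs → ∀ i → f x i ≡ g x i) → ∏lin (map f xs) ≋ ∏lin (map g xs)
∏lin-cong []       e = ≋-refl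
∏lin-cong (x ∷ xs) e = ⊛-cong (lin-cong (e x (here refl))) (∏lin-cong xs (λ y m → e y (there m)))

-- The minor is ±1 on the arrangements of `S` and 0 on all other words; the product of the variables
-- in `S` has the derivatives 1 and 0 there.
sq-ε : ∀ {S : List (Fin n)} → Unique S → sq (ε S) ≋ Xs S
sq-ε {S = S} u = ≋-trans (sq-wedge (AllPairsP.map⁺ (AllPairs.map δ-orth u)))
  (≋-trans (λ L → cong (λ us → ∏lin us L) (sym (ListP.map-∘ S))) (∏lin-cong S (λ s _ → sq-δ s)))

-- `pre` collects the letters that have already passed over `δ s` and been absorbed by the form.
⋏-support : ∀ (s : Fin n) {S} (f : Ser (Fin n)) pre → (∀ L → f L ≡ 0ℤ ⊎ (pre ++ L ↭ S)) →
            ∀ L → (δ s ⋏ f) L ≡ 0ℤ ⊎ (pre ++ L ↭ s ∷ S)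
⋏-support s f pre h []       = inj₁ refl
⋏-support s f pre h (y ∷ ys) with first | second
  where
  first : (δ s y * f ys ≡ 0ℤ) ⊎ (pre ++ y ∷ ys ↭ s ∷ _)
  first with s FinP.≟ y | h ys
  ... | no ne    | _      = inj₁ (≡.trans (cong (_* f ys) (δ-≢ ne)) (ℤP.*-zeroˡ (f ys)))
  ... | yes refl | inj₁ e = inj₁ (≡.trans (cong (δ s s *_) e) (ℤP.*-zeroʳ (δ s s)))
  ... | yes refl | inj₂ r = inj₂ (↭-trans (↭P.shift s pre ys) (prep s r))
  second : ((δ s ⋏ D y f) ys ≡ 0ℤ) ⊎ (pre ++ y ∷ ys ↭ s ∷ _)
  second with ⋏-support s (D y f) (pre ++ [ y ]) (λ L → subst (λ K → f (y ∷ L) ≡ 0ℤ ⊎ (K ↭ _)) (sym (ListP.++-assoc pre [ y ] L)) (h (y ∷ L))) ys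
  ... | inj₁ e = inj₁ e
  ... | inj₂ r = inj₂ (subst (_↭ _) (ListP.++-assoc pre [ y ] ys) r)
... | inj₂ r | _      = inj₂ r
... | inj₁ _ | inj₂ r = inj₂ r
... | inj₁ e | inj₁ e′ = inj₁ (cong₂ _-_ e e′)

ε-support : ∀ (S : List (Fin n)) L → ε S L ≡ 0ℤ ⊎ (L ↭ S)
ε-support []      []      = inj₂ refl
ε-support []      (_ ∷ _) = inj₁ refl
ε-support (s ∷ S) L       = ⋏-support s (ε S) [] (ε-support S) L

ε-orth : ∀ {S S′ : List (Fin n)} → ¬ (S ↭ S′) → ∀ L → ε S L * ε S′ L ≡ 0ℤ
ε-orth {S = S} {S′} ne L with ε-support S L | ε-support S′ L
... | inj₁ e | _      = ≡.trans (cong (_* ε S′ L) e) (ℤP.*-zeroˡ (ε S′ L))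
... | inj₂ _ | inj₁ e = ≡.trans (cong (ε S L *_) e) (ℤP.*-zeroʳ (ε S L))
... | inj₂ r | inj₂ s = ⊥-elim (ne (↭-trans (↭-sym r) s))

-- `closed` says that replacing one letter of a member by a new one gives a member up to order: the
-- span of the `ε S` is stable under the off-diagonal matrix units. `distinct` makes the `ε S`
-- orthogonal.
record Family (𝒮 : List (List (Fin n))) : Set where
  field
    nodup    : All Unique 𝒮
    distinct : AllPairs (λ S S′ → ¬ (S ↭ S′)) 𝒮
    closed   : ∀ {S a b R} → S ∈ 𝒮 → S ↭ a ∷ R → a ≢ b → b ∉ R → ∃[ S′ ] (S′ ∈ 𝒮 × (b ∷ R ↭ S′))

-- δ! k m = k! if k = m and 0 otherwise.
δ! : ℕ → ℕ → ℤ
δ! zero    zero    = 1ℤ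
δ! zero    (suc m) = 0ℤ
δ! (suc k) zero    = 0ℤ
δ! (suc k) (suc m) = ℤ.+ suc m * δ! k m

-- Equal to k! for k < N: the number of arrangements of k letters, found by searching all words
-- shorter than N.
norm : ℕ → ℕ → ℤ
norm k zero    = 0ℤ
norm k (suc N) = δ! k N + norm k N

δ!-nonneg : ∀ k m → 0ℤ ℤ.≤ δ! k m
δ!-nonneg zero    zero    = +≤+ z≤n
δ!-nonneg zero    (suc m) = +≤+ z≤n
δ!-nonneg (suc k) zero    = +≤+ z≤n
δ!-nonneg (suc k) (suc m) = subst (ℤ._≤ ℤ.+ suc m * δ! k m) (ℤP.*-zeroʳ (ℤ.+ suc m)) (ℤP.*-monoˡ-≤-nonNeg (ℤ.+ suc m) (δ!-nonneg k m))

δ!-pos : ∀ k → 0ℤ ℤ.< δ! k k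
δ!-pos zero    = +<+ (s≤s z≤n)
δ!-pos (suc k) = subst (ℤ._< ℤ.+ suc k * δ! k k) (ℤP.*-zeroʳ (ℤ.+ suc k)) (ℤP.*-monoˡ-<-pos (ℤ.+ suc k) (δ!-pos k))

norm-nonneg : ∀ k N → 0ℤ ℤ.≤ norm k N
norm-nonneg k zero    = +≤+ z≤n
norm-nonneg k (suc N) = ℤP.+-mono-≤ (δ!-nonneg k N) (norm-nonneg k N)

norm-pos : ∀ {k N} → k ℕ.< N → 0ℤ ℤ.< norm k N
norm-pos {k} {suc N} (s≤s k≤N) with k ℕP.≟ N
... | yes refl = ℤP.+-mono-<-≤ (δ!-pos k) (norm-nonneg k k)
... | no ne    = ℤP.+-mono-≤-< (δ!-nonneg k N) (norm-pos (ℕP.≤∧≢⇒< k≤N ne))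

*-pos : ∀ {a b} → 0ℤ ℤ.< a → 0ℤ ℤ.< b → 0ℤ ℤ.< a * b
*-pos {ℤ.+ suc a} {b} p q = subst (ℤ._< ℤ.+ suc a * b) (ℤP.*-zeroʳ (ℤ.+ suc a)) (ℤP.*-monoˡ-<-pos (ℤ.+ suc a) q)
*-pos {ℤ.+ zero} (+<+ ())
*-pos { ℤ.-[1+ _ ]} ()

module _ (n : ℕ) where
  private module X = Diagonal n

  one : Ser (Fin n)
  one _ = 1ℤ

  -- The series `one` is the exponential of the sum of the variables and is fixed by every
  -- derivation, so that `contract-lin` can be used to count words.
  ∑-strings-contract : ∀ m f K → ∑ (strings n m) f ≡ X.contract m f one K
  ∑-strings-contract zero    f K = ≡.trans (ℤP.+-identityʳ (f [])) (sym (ℤP.*-identityʳ (f [])))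
  ∑-strings-contract (suc m) f K = ≡.trans (∑-strings n m f) (∑-cong (fins n) (λ i → ∑-strings-contract m (D i f) K))

  ∑-strings-lin : ∀ m s f → ∑ (strings n (suc m)) (lin (δ s) ⊛ f) ≡ ℤ.+ suc m * ∑ (strings n m) f
  ∑-strings-lin m s f = begin
    ∑ (strings n (suc m)) (lin (δ s) ⊛ f)        ≡⟨ ∑-strings-contract (suc m) (lin (δ s) ⊛ f) [] ⟩
    X.contract (suc m) (lin (δ s) ⊛ f) one []    ≡⟨ X.contract-lin m (δ s) f {one} (comm (λ _ → refl)) [] ⟩
    ℤ.+ suc m * X.contract m f (X.∂ (δ s) one) [] ≡⟨ cong (ℤ.+ suc m *_) (X.contract-cong m {f} ≋-refl (λ K → ∑-δ s (λ _ → 1ℤ)) []) ⟩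
    ℤ.+ suc m * X.contract m f one []            ≡⟨ cong (ℤ.+ suc m *_) (sym (∑-strings-contract m f [])) ⟩
    ℤ.+ suc m * ∑ (strings n m) f                ∎
    where open ≡-Reasoning

  ∑-strings-Xs : ∀ m (S : List (Fin n)) → ∑ (strings n m) (Xs S) ≡ δ! (length S) m
  ∑-strings-Xs zero    []      = refl
  ∑-strings-Xs (suc m) []      = ≡.trans (∑-strings n m _) (∑-zero (fins n) (λ i → ∑-0 (strings n m)))
  ∑-strings-Xs zero    (s ∷ S) = cong (_+ 0ℤ) (ℤP.*-zeroˡ (Xs S []))
  ∑-strings-Xs (suc m) (s ∷ S) = ≡.trans (∑-strings-lin m s (Xs S)) (cong (ℤ.+ suc m *_) (∑-strings-Xs m S))

  -- A member of `S` begins (|S| - 1)! arrangements. For empty `S` the predecessor is harmless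
  -- because `χ` vanishes.
  ∑-strings-Xs-at : ∀ m (S : List (Fin n)) i → ∑ (strings n m) (λ T → Xs S (i ∷ T)) ≡ χ S i * δ! (ℕ.pred (length S)) m
  ∑-strings-Xs-at m [] i = ∑-0 (strings n m)
  ∑-strings-Xs-at m (s ∷ S) i = begin
    ∑ (strings n m) (λ T → Xs (s ∷ S) (i ∷ T))
      ≡⟨ ∑-cong (strings n m) (λ T → D-lin (δ s) (Xs S) i T) ⟩
    ∑ (strings n m) (λ T → δ s i * Xs S T + (lin (δ s) ⊛ D i (Xs S)) T)
      ≡⟨ ∑-+ (strings n m) _ _ ⟩
    ∑ (strings n m) (λ T → δ s i * Xs S T) + ∑ (strings n m) (lin (δ s) ⊛ D i (Xs S))
      ≡⟨ cong₂ _+_ (≡.trans (∑-*ˡ (strings n m) (δ s i) _) (cong (δ s i *_) (∑-strings-Xs m S))) (rest m S) ⟩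
    δ s i * δ! (length S) m + χ S i * δ! (length S) m
      ≡⟨ sym (ℤP.*-distribʳ-+ (δ! (length S) m) (δ s i) (χ S i)) ⟩
    χ (s ∷ S) i * δ! (length S) m ∎
    where
    open ≡-Reasoning
    lemma : ∀ a b c → a * (b * c) ≡ b * (a * c)
    lemma = solve-∀
    rest : ∀ m S → ∑ (strings n m) (lin (δ s) ⊛ D i (Xs S)) ≡ χ S i * δ! (length S) m
    rest zero    []      = refl
    rest zero    (t ∷ S) = ≡.trans (cong (_+ 0ℤ) (ℤP.*-zeroˡ (Xs (t ∷ S) (i ∷ [])))) (sym (ℤP.*-zeroʳ (χ (t ∷ S) i)))
    rest (suc m) []      = ≡.trans (∑-strings-lin m s (D i (Xs []))) (≡.trans (cong (ℤ.+ suc m *_) (∑-0 (strings n m))) (ℤP.*-zeroʳ (ℤ.+ suc m)))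
    rest (suc m) (t ∷ S) = ≡.trans (∑-strings-lin m s (D i (Xs (t ∷ S))))
      (≡.trans (cong (ℤ.+ suc m *_) (∑-strings-Xs-at m (t ∷ S) i)) (lemma (ℤ.+ suc m) (χ (t ∷ S) i) (δ! (length S) m)))

record Good {n} (F : Ser (Fin n × Fin n)) : Set where
  field
    isComm : Comm F
    isInv  : Matrices.Inv n F
    isGram : Gram F

module Forms (n N : ℕ) where
  open Tensors n
  open Pairing (stringsBelow n N)
  open Matrices n using (Res; mkInv; inv)
  open DecMem (FinP._≟_ {n}) using (_∈?_)

  Ω : List (List (Fin n)) → Ser (List (Fin n))
  Ω 𝒮 = wedge (map ε 𝒮)

  form : List (List (Fin n)) → Ser (Fin n × Fin n)
  form 𝒮 = gram (Ω 𝒮) (Ω 𝒮)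

  Low-form : ∀ 𝒮 → Low (suc (length 𝒮)) (form 𝒮)
  Low-form 𝒮 = Low-gram (suc (length 𝒮)) (subst (λ k → Low (suc k) (Ω 𝒮)) (ListP.length-map ε 𝒮) (Low-wedge (map ε 𝒮)))

  act₁-δ : ∀ a b s y → act₁ (κ₀ a b) (δ s) y ≡ δ b y * δ s a
  act₁-δ a b s y = ∑-κ₀ a b y (δ s)

  -- The derivation sends `δ a` to `δ b` and every other `δ s` to 0, so without the letter `a` each
  -- term of the Leibniz rule has a zero factor.
  act-ε-∉ : ∀ {a b} S → a ∉ S → act (κ₀ a b) (ε S) ≋ (λ _ → 0ℤ)
  act-ε-∉ {a} {b} S a∉ = act-wedge (κ₀ a b) δ S (λ { us s ws refl → wedge-zero (map δ us) (map δ ws)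
    (λ y → ≡.trans (act₁-δ a b s y) (≡.trans (cong (δ b y *_) (δ-≢ {i = s} (λ { refl → a∉ (∈-insert us) }))) (ℤP.*-zeroʳ (δ b y)))) })

  act-ε-∷ : ∀ {a b} R → a ∉ R → act (κ₀ a b) (ε (a ∷ R)) ≋ ε (b ∷ R)
  act-ε-∷ {a} {b} R a∉ L = ≡.trans (act-⋏ (κ₀ a b) (δ a) (ε R) L)
    (≡.trans (cong₂ _+_
      (⋏-cong {g = ε R} (λ y → ≡.trans (act₁-δ a b a y) (≡.trans (cong (δ b y *_) (δ-refl a)) (ℤP.*-identityʳ _))) ≋-refl L)
      (⋏-zeroʳ (δ a) (act-ε-∉ R a∉) L)) (ℤP.+-identityʳ _))

  act₁-ext : ∀ {I : Set} (κ : I → List I) (f : Ser I) y → act₁ (ext κ) f y ≡ act κ f y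
  act₁-ext κ f y = ∑-ext κ f y

  ε-∝ : ∀ {S S′ : List (Fin n)} → S ↭ S′ → ε S ∝ ε S′
  ε-∝ r = wedge-↭ (↭P.map⁺ δ r)

  module _ {𝒮 : List (List (Fin n))} (fam : Family 𝒮) where
    open Family fam

    -- The derivation sends `ε S` to 0 or, up to sign, to the `ε S′` in which b has replaced a. This
    -- S′ differs from S and is in the family, so a factor of the wedge is repeated.
    Ω-annihilated : ∀ {a b} → a ≢ b → act (κ₁ a b) (Ω 𝒮) ≋ (λ _ → 0ℤ)
    Ω-annihilated {a} {b} a≢b = act-wedge (κ₁ a b) ε 𝒮 go
      where
      go : ∀ us S ws → 𝒮 ≡ us ++ S ∷ ws → wedge (map ε us ++ act₁ (κ₁ a b) (ε S) ∷ map ε ws) ≋ (λ _ → 0ℤ)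
      go us S ws e with a ∈? S
      ... | no a∉ = wedge-zero (map ε us) (map ε ws) (λ y → ≡.trans (act₁-ext (κ₀ a b) (ε S) y) (act-ε-∉ S a∉ y))
      ... | yes a∈ with ∈-∃++ a∈
      ... | (ys , zs , refl) = replace (b ∈? R)
        where
        R : List (Fin n)
        R = ys ++ zs
        r : S ↭ a ∷ R
        r = ↭P.shift a ys zs
        S∈ : S ∈ 𝒮
        S∈ = subst (S ∈_) (sym e) (∈-insert us)
        uS : Unique (a ∷ R)
        uS = Unique-resp-↭ r (All.lookup nodup S∈)
        a∉R : a ∉ R
        a∉R = AllP.All¬⇒¬Any (AllPairs.head uS)
        v∝ : act₁ (κ₁ a b) (ε S) ∝ ε (b ∷ R)
        v∝ = ∝-trans (≋⇒∝ (act₁-ext (κ₀ a b) (ε S))) (∝-trans (act-∝ (κ₀ a b) (ε-∝ r)) (≋⇒∝ (act-ε-∷ R a∉R)))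
        replace : _ → wedge (map ε us ++ act₁ (κ₁ a b) (ε S) ∷ map ε ws) ≋ (λ _ → 0ℤ)
        replace (yes b∈) = wedge-zero (map ε us) (map ε ws) (∝-zero v∝ (⋏-dup (map δ R)
          (AnyP.map⁺ (Any.map (λ { refl → ≋⇒∝ (λ _ → refl) }) b∈))))
        replace (no b∉) with closed S∈ r a≢b b∉
        ... | S′ , S′∈ , r′ = wedge-dup (map ε us) (act₁ (κ₁ a b) (ε S)) (map ε ws)
          (subst (Any _) (ListP.map-++ ε us ws) (AnyP.map⁺ (Any.map (λ { refl → ∝-trans v∝ (ε-∝ r′) }) S′∈rest)))
          where
          S′≢S : S′ ≢ S
          S′≢S refl with ↭P.∈-resp-↭ (↭-trans r′ r) (here refl)
          ... | here b≡a  = a≢b (sym b≡a)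
          ... | there b∈R = b∉ b∈R
          S′∈rest : S′ ∈ us ++ ws
          S′∈rest with ∈-++⁻ us (subst (S′ ∈_) e S′∈)
          ... | inj₁ m         = ∈-++⁺ˡ m
          ... | inj₂ (here eq) = ⊥-elim (S′≢S eq)
          ... | inj₂ (there m) = ∈-++⁺ʳ us m

    Good-form : Good (form 𝒮)
    Good-form = record
      { isComm = Comm-gram (Alt-wedge (map ε 𝒮)) (Alt-wedge (map ε 𝒮))
      ; isInv  = mkInv (λ {a} {b} ne L → ≡.trans (conj-gram (stringsBelow-adjoint N) a b (Ω 𝒮) (Ω 𝒮) L)
          (cong₂ _-_ (gram-zeroˡ (Ω 𝒮) (Ω-annihilated ne) L) (gram-zeroʳ (Ω 𝒮) (Ω-annihilated (ne ∘ sym)) L)))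
      ; isGram = Gram-gram (Ω 𝒮) }

    scale : List (List (Fin n)) → ℤ
    scale []       = 1ℤ
    scale (S ∷ 𝒮′) = norm (ℕ.pred (length S)) N * scale 𝒮′

    marg₁-sq-ε : ∀ {S} → Unique S → ∀ i → marg₁ (sq (ε S)) i ≡ χ S i * norm (ℕ.pred (length S)) N
    marg₁-sq-ε {S} u i = ≡.trans (∑-cong (stringsBelow n N) (λ T → sq-ε u (i ∷ T))) (go N)
      where
      go : ∀ N → ∑ (stringsBelow n N) (λ T → Xs S (i ∷ T)) ≡ χ S i * norm (ℕ.pred (length S)) N
      go zero    = sym (ℤP.*-zeroʳ (χ S i))
      go (suc N) = ≡.trans (∑-++ (strings n N) _ _) (≡.trans (cong₂ _+_ (∑-strings-Xs-at n N S i) (go N))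
        (sym (ℤP.*-distribˡ-+ (χ S i) (δ! (ℕ.pred (length S)) N) _)))

    ∏lin-scale : ∀ 𝒮′ → ∏lin (map (λ S i → χ S i * norm (ℕ.pred (length S)) N) 𝒮′) ≋ scale 𝒮′ · ∏lin (map χ 𝒮′)
    ∏lin-scale []       L = sym (ℤP.*-identityˡ _)
    ∏lin-scale (S ∷ 𝒮′) = ≋-trans (⊛-cong (lin-· c (χ S)) (∏lin-scale 𝒮′))
      (≋-trans (·-⊛ c (lin (χ S)) (scale 𝒮′ · P)) (λ L → ≡.trans
        (cong (c *_) (≡.trans (⊛-comm (lin (χ S)) (scale 𝒮′ · P) L)
          (≡.trans (·-⊛ (scale 𝒮′) P (lin (χ S)) L) (cong (scale 𝒮′ *_) (⊛-comm P (lin (χ S)) L)))))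
        (sym (ℤP.*-assoc c (scale 𝒮′) _))))
      where
      c : ℤ
      c = norm (ℕ.pred (length S)) N
      P : Ser (Fin n)
      P = ∏lin (map χ 𝒮′)

    -- On the diagonal the Gram form is a sum of squares of Ω. By `sq-wedge` the square is a product
    -- over the members, and summing out the tails turns each factor into X_S times (|S| - 1)!, once
    -- N exceeds |S| - 1.
    Res-form : Res (form 𝒮) ≋ scale 𝒮 · ∏lin (map χ 𝒮)
    Res-form = ≋-trans (Res-gram (Ω 𝒮))
      (≋-trans (marg-cong (sq-wedge (AllPairsP.map⁺ (AllPairs.map ε-orth distinct))))
      (≋-trans (marg-∏lin (map sq (map ε 𝒮)))
      (≋-trans (λ L → cong (λ us → ∏lin us L) (≡.trans (sym (ListP.map-∘ (map ε 𝒮))) (sym (ListP.map-∘ 𝒮))))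
      (≋-trans (∏lin-cong 𝒮 (λ S m → marg₁-sq-ε (All.lookup nodup m)))
        (∏lin-scale 𝒮)))))

    scale-pos : All (λ S → ℕ.pred (length S) ℕ.< N) 𝒮 → 0ℤ ℤ.< scale 𝒮
    scale-pos = go 𝒮
      where
      go : ∀ 𝒮′ → All (λ S → ℕ.pred (length S) ℕ.< N) 𝒮′ → 0ℤ ℤ.< scale 𝒮′
      go []       []       = +<+ (s≤s z≤n)
      go (S ∷ 𝒮′) (p ∷ ps) = *-pos (norm-pos p) (go 𝒮′ ps)

length-fins : ∀ n → length (fins n) ≡ n
length-fins zero    = refl
length-fins (suc n) = cong suc (≡.trans (ListP.length-map suc (fins n)) (length-fins n))

∈-fins : ∀ (i : Fin n) → i ∈ fins n
∈-fins zero    = here refl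
∈-fins (suc i) = there (∈-map⁺ suc (∈-fins i))

-- The determinant and Cayley's operator

singles : ∀ n → List (List (Fin n))
singles n = map [_] (fins n)

singles-family : ∀ n → Family (singles n)
singles-family n = record
  { nodup    = AllP.map⁺ (All.universal (λ _ → [] ∷ []) (fins n))
  ; distinct = AllPairsP.map⁺ (AllPairs.map (λ ne r → ne (ListP.∷-injectiveˡ (↭P.↭-singleton-inv r))) (fins-unique n))
  ; closed   = closed }
  where
  closed : ∀ {S a b R} → S ∈ singles n → S ↭ a ∷ R → a ≢ b → b ∉ R → ∃[ S′ ] (S′ ∈ singles n × (b ∷ R ↭ S′))
  closed {S} {a} {b} {R} m r _ _ with ∈-map⁻ [_] m
  ... | s , _ , refl = [ b ] , ∈-map⁺ [_] (∈-fins b) , ↭-reflexive (cong (b ∷_) (ListP.∷-injectiveʳ (↭P.↭-singleton-inv (↭-sym r))))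

-- For singletons the bound 1 leaves only the empty tail. The value at i₁j₁, ..., iₙjₙ is then the
-- product of the signs of i and of j, which is the corresponding derivative of the determinant.
det : ∀ n → Ser (Fin n × Fin n)
det n = Forms.form n 1 (singles n)

-- A product of factors 0!, hence equal to 1.
detScale : ℕ → ℤ
detScale n = Forms.scale n 1 (singles-family n) (singles n)

detScale-pos : ∀ n → 0ℤ ℤ.< detScale n
detScale-pos n = Forms.scale-pos n 1 (singles-family n) (AllP.map⁺ (All.universal (λ _ → s≤s z≤n) (fins n)))

Low-det : ∀ n → Low (suc n) (det n)
Low-det n = subst (λ k → Low (suc k) (det n)) (≡.trans (ListP.length-map [_] (fins n)) (length-fins n)) (Forms.Low-form n 1 (singles n))

Res-det : ∀ n → Matrices.Res n (det n) ≋ detScale n · Xs (fins n)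
Res-det n = ≋-trans (Forms.Res-form n 1 (singles-family n)) (·-cong (detScale n)
  (≋-trans (λ L → cong (λ us → ∏lin us L) (sym (ListP.map-∘ (fins n)))) (∏lin-cong (fins n) (λ s _ i → ℤP.+-identityʳ (δ s i)))))

det-good : ∀ n → Good (det n)
det-good n = Forms.Good-form n 1 (singles-family n)

module _ (n : ℕ) where
  private
    module M = Matrices n
    module X = Diagonal n

  -- `G` is read at (i , j) and `F` at (j , i), so the sum over j meets Φ₂ and Ψ₁ only, the sum over
  -- i meets Φ₁ and Ψ₂ only, and the double sum factors. The induction differentiates Φ₁ and Φ₂ by
  -- different letters, whence four families; when Φ₁ = Φ₂ and Ψ₁ = Ψ₂ the result is again of Gram
  -- type.
  contract-gram : ∀ {W U : Set} m r (ws : List W) (us : List U) (Φ₁ Φ₂ : W → Ser (Fin n)) (Ψ₁ Ψ₂ : U → Ser (Fin n)) {G F} →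
    (∀ K → length K ≡ m → G K ≡ ∑ ws (λ w → Φ₁ w (map proj₁ K) * Φ₂ w (map proj₂ K))) →
    (∀ K → length K ≡ m ℕ.+ r → F K ≡ ∑ us (λ u → Ψ₁ u (map proj₁ K) * Ψ₂ u (map proj₂ K))) →
    ∀ L → length L ≡ r → M.contract m G F L ≡
      ∑ ws (λ w → ∑ us (λ u → X.contract m (Φ₂ w) (Ψ₁ u) (map proj₁ L) * X.contract m (Φ₁ w) (Ψ₂ u) (map proj₂ L)))
  contract-gram zero r ws us Φ₁ Φ₂ Ψ₁ Ψ₂ {G} {F} g f L e = begin
    G [] * F L
      ≡⟨ cong₂ _*_ (g [] refl) (f L e) ⟩
    ∑ ws (λ w → Φ₁ w [] * Φ₂ w []) * ∑ us (λ u → Ψ₁ u L₁ * Ψ₂ u L₂)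
      ≡⟨ sym (∑-*ʳ ws _ _) ⟩
    ∑ ws (λ w → (Φ₁ w [] * Φ₂ w []) * ∑ us (λ u → Ψ₁ u L₁ * Ψ₂ u L₂))
      ≡⟨ ∑-cong ws (λ w → ≡.trans (sym (∑-*ˡ us (Φ₁ w [] * Φ₂ w []) _)) (∑-cong us (λ u → lemma (Φ₁ w []) (Φ₂ w []) (Ψ₁ u L₁) (Ψ₂ u L₂)))) ⟩
    ∑ ws (λ w → ∑ us (λ u → (Φ₂ w [] * Ψ₁ u L₁) * (Φ₁ w [] * Ψ₂ u L₂))) ∎
    where
    open ≡-Reasoning
    L₁ L₂ : List (Fin n)
    L₁ = map proj₁ L
    L₂ = map proj₂ L
    lemma : ∀ a b c d → (a * b) * (c * d) ≡ (b * c) * (a * d)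
    lemma = solve-∀
  contract-gram (suc m) r ws us Φ₁ Φ₂ Ψ₁ Ψ₂ {G} {F} g f L e = begin
    ∑ (pairs n) (λ p → M.contract m (D p G) (D (Prod.swap p) F) L)
      ≡⟨ ∑-pairs n _ ⟩
    ∑ (fins n) (λ i → ∑ (fins n) (λ j → M.contract m (D (i , j) G) (D (j , i) F) L))
      ≡⟨ ∑-cong (fins n) (λ i → ∑-cong (fins n) (λ j → contract-gram m r ws us
           (D i ∘ Φ₁) (D j ∘ Φ₂) (D j ∘ Ψ₁) (D i ∘ Ψ₂)
           (λ K k → g ((i , j) ∷ K) (cong suc k)) (λ K k → f ((j , i) ∷ K) (cong suc k)) L e)) ⟩
    ∑ (fins n) (λ i → ∑ (fins n) (λ j → ∑ ws (λ w → ∑ us (λ u → p w u j * q w u i))))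
      ≡⟨ ∑-cong (fins n) (λ i → ≡.trans (∑-comm (fins n) ws _) (∑-cong ws (λ w → ≡.trans (∑-comm (fins n) us _) (∑-cong us (λ u → ∑-*ʳ (fins n) (q w u i) _))))) ⟩
    ∑ (fins n) (λ i → ∑ ws (λ w → ∑ us (λ u → ∑ (fins n) (p w u) * q w u i)))
      ≡⟨ ≡.trans (∑-comm (fins n) ws _) (∑-cong ws (λ w → ≡.trans (∑-comm (fins n) us _) (∑-cong us (λ u → ∑-*ˡ (fins n) (∑ (fins n) (p w u)) _)))) ⟩
    ∑ ws (λ w → ∑ us (λ u → ∑ (fins n) (p w u) * ∑ (fins n) (q w u))) ∎
    where
    open ≡-Reasoning
    p q : _ → _ → Fin n → ℤ
    p w u j = X.contract m (D j (Φ₂ w)) (D j (Ψ₁ u)) (map proj₁ L)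
    q w u i = X.contract m (D i (Φ₁ w)) (D i (Ψ₂ u)) (map proj₂ L)

  Gram-contract : ∀ m {G F} → Gram G → Gram F → Gram (M.contract m G F)
  Gram-contract m {G} {F} g f r with g m | f (m ℕ.+ r)
  ... | Φs , eG | Ψs , eF = concatMap (λ Φ → map (X.contract m Φ) Ψs) Φs , λ L e →
    ≡.trans (contract-gram m r Φs Ψs id id id id eG eF L e)
      (sym (≡.trans (∑-concatMap _ Φs _) (∑-cong Φs (λ Φ → ∑-map (X.contract m Φ) Ψs _))))

  -- Cayley's operator det(∂), which strips a full column.
  Good-contract : ∀ {F} → Good F → Good (M.contract n (det n) F)
  Good-contract {F} good = record
    { isComm = M.Comm-contract n {det n} isComm
    ; isInv  = M.Inv-contract n (Good.isComm (det-good n)) (Good.isInv (det-good n)) (Low-det n) isComm isInv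
    ; isGram = Gram-contract n (Good.isGram (det-good n)) isGram }
    where open Good good

  contract-Xs : ∀ S {g} → Comm g → ∀ K → X.contract (length S) (Xs S) g K ≡ δ! (length S) (length S) * g (S ++ K)
  contract-Xs []      c K = refl
  contract-Xs (s ∷ S) {g} c K = begin
    X.contract (suc (length S)) (lin (δ s) ⊛ Xs S) g K
      ≡⟨ X.contract-lin (length S) (δ s) (Xs S) c K ⟩
    ℤ.+ suc (length S) * X.contract (length S) (Xs S) (X.∂ (δ s) g) K
      ≡⟨ cong (ℤ.+ suc (length S) *_) (X.contract-cong (length S) {Xs S} ≋-refl (λ L → ∑-δ s (λ i → g (i ∷ L))) K) ⟩
    ℤ.+ suc (length S) * X.contract (length S) (Xs S) (D s g) K
      ≡⟨ cong (ℤ.+ suc (length S) *_) (contract-Xs S (Comm-D s c) K) ⟩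
    ℤ.+ suc (length S) * (δ! (length S) (length S) * g (s ∷ S ++ K))
      ≡⟨ sym (ℤP.*-assoc (ℤ.+ suc (length S)) (δ! (length S) (length S)) _) ⟩
    δ! (suc (length S)) (suc (length S)) * g (s ∷ S ++ K) ∎
    where open ≡-Reasoning

  -- On the diagonal the determinant is x₁ ⋯ xₙ, so Cayley's operator becomes ∂₁ ⋯ ∂ₙ up to a
  -- positive constant, and that prefixes every letter once.
  vand-Res-column : ∀ {F} → Good F → ∀ K →
    (vand (fins n) ⊛ M.Res (M.contract n (det n) F)) K ≡ detScale n * δ! n n * (vand (fins n) ⊛ M.Res F) (fins n ++ K)
  vand-Res-column {F} good K = begin
    (vand (fins n) ⊛ M.Res (M.contract n (det n) F)) K
      ≡⟨ M.vand-Res-contract n (Good.isComm (det-good n)) (Good.isInv (det-good n)) (Low-det n) isComm isInv K ⟩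
    X.contract n (M.Res (det n)) g K
      ≡⟨ X.contract-cong n {F = g} (Res-det n) ≋-refl K ⟩
    X.contract n (detScale n · Xs (fins n)) g K
      ≡⟨ X.contract-·ˡ n (detScale n) (Xs (fins n)) g K ⟩
    detScale n * X.contract n (Xs (fins n)) g K
      ≡⟨ cong (detScale n *_) (subst (λ k → X.contract k (Xs (fins n)) g K ≡ δ! k k * g (fins n ++ K)) (length-fins n)
           (contract-Xs (fins n) (Comm-⊛ (Comm-vand (fins n)) (Comm-^* M.diag isComm)) K)) ⟩
    detScale n * (δ! n n * g (fins n ++ K))
      ≡⟨ sym (ℤP.*-assoc (detScale n) (δ! n n) _) ⟩
    detScale n * δ! n n * g (fins n ++ K) ∎
    where
    open ≡-Reasoning
    open Good good
    g : Ser (Fin n)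
    g = vand (fins n) ⊛ M.Res F

-- Nonnegativity of the alternating coefficients

suc² : Fin n × Fin n → Fin (suc n) × Fin (suc n)
suc² = Prod.map suc suc

conj-suc : ∀ a b (F : Ser (Fin (suc n) × Fin (suc n))) → Matrices.conj n a b (suc² ^* F) ≋ suc² ^* Matrices.conj (suc n) (suc a) (suc b) F
conj-suc a b F []            = refl
conj-suc {n} a b F ((k , l) ∷ L) = cong (Matrices.sub n a b (k , l) (suc² ^* F) L +_) (conj-suc a b (D (suc k , suc l) F) L)

-- Restriction to the matrices whose first row and column vanish; the remaining conjugations
-- preserve this block.
Good-suc : ∀ {F : Ser (Fin (suc n) × Fin (suc n))} → Good F → Good (suc² ^* F)
Good-suc {n} {F} good = record
  { isComm = Comm-^* suc² isComm
  ; isInv  = Matrices.mkInv (λ {a} {b} ne L → ≡.trans (conj-suc a b F L) (Matrices.inv isInv (ne ∘ FinP.suc-injective) (map suc² L)))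
  ; isGram = λ r → map (suc ^*_) (proj₁ (isGram r)) , λ L e → ≡.trans
      (proj₂ (isGram r) (map suc² L) (≡.trans (ListP.length-map suc² L) e))
      (sym (≡.trans (∑-map (suc ^*_) (proj₁ (isGram r)) _) (∑-cong (proj₁ (isGram r)) (λ Φ → cong₂ (λ K K′ → Φ K * Φ K′) (fst L) (snd L))))) }
  where
  open Good good
  fst : ∀ L → map suc (map proj₁ L) ≡ map proj₁ (map suc² L)
  fst L = ≡.trans (sym (ListP.map-∘ L)) (ListP.map-∘ L)
  snd : ∀ L → map suc (map proj₂ L) ≡ map proj₂ (map suc² L)
  snd L = ≡.trans (sym (ListP.map-∘ L)) (ListP.map-∘ L)

suc^*-x : ∀ (i : Fin n) → suc ^* x (suc i) ≋ x i
suc^*-x i = ^*-lin suc (δ (suc i))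

suc^*-x₀ : suc ^* x zero ≋ (λ (_ : List (Fin n)) → 0ℤ)
suc^*-x₀ []          = refl
suc^*-x₀ (_ ∷ [])    = refl
suc^*-x₀ (_ ∷ _ ∷ _) = refl

suc^*-ℓ : ∀ (i j : Fin n) → suc ^* ℓ (suc i) (suc j) ≋ ℓ i j
suc^*-ℓ i j L = cong₂ _-_ (suc^*-x j L) (suc^*-x i L)

suc^*-π : ∀ (i : Fin n) js → suc ^* π (suc i) (map suc js) ≋ π i js
suc^*-π i []       = ^*-con suc 1ℤ
suc^*-π i (j ∷ js) = ≋-trans (^*-⊛ suc (ℓ (suc i) (suc j)) (π (suc i) (map suc js))) (⊛-cong (suc^*-ℓ i j) (suc^*-π i js))

suc^*-vand : ∀ (is : List (Fin n)) → suc ^* vand (map suc is) ≋ vand is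
suc^*-vand []       = ^*-con suc 1ℤ
suc^*-vand (i ∷ is) = ≋-trans (^*-⊛ suc (π (suc i) (map suc is)) (vand (map suc is))) (⊛-cong (suc^*-π i is) (suc^*-vand is))

suc^*-π₀ : ∀ (js : List (Fin n)) → suc ^* π zero (map suc js) ≋ Xs js
suc^*-π₀ []       = ^*-con suc 1ℤ
suc^*-π₀ (j ∷ js) = ≋-trans (^*-⊛ suc (ℓ zero (suc j)) (π zero (map suc js)))
  (⊛-cong (λ L → ≡.trans (cong₂ _-_ (suc^*-x j L) (suc^*-x₀ L)) (ℤP.+-identityʳ _)) (suc^*-π₀ js))

suc^*-Xs : ∀ (js : List (Fin n)) → suc ^* Xs (map suc js) ≋ Xs js
suc^*-Xs []       = ^*-con suc 1ℤ
suc^*-Xs (j ∷ js) = ≋-trans (^*-⊛ suc (x (suc j)) (Xs (map suc js))) (⊛-cong (suc^*-x j) (suc^*-Xs js))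

-- The strictly increasing vector with first entry d₀ and successive gaps 1 + dᵢ
stair : Vec ℕ n → Vec ℕ n
stair []       = []
stair (d ∷ ds) = V.map (d ℕ.+_) (0 ∷ V.map suc (stair ds))

lst : Vec ℕ n → List (Fin n)
lst []      = []
lst (m ∷ l) = replicate m zero ++ map suc (lst l)

-- Raising all exponents by one adds a full column to the diagram.
lst-suc : ∀ (l : Vec ℕ n) → lst (V.map suc l) ↭ fins n ++ lst l
lst-suc []      = refl
lst-suc {suc n} (m ∷ l) = prep zero (↭-trans
  (↭P.++⁺ˡ (replicate m zero) (↭-trans (↭P.map⁺ suc (lst-suc l)) (↭-reflexive (ListP.map-++ suc (fins n) (lst l)))))
  (↭P.shifts (replicate m zero) (map suc (fins n))))

D-Xs-suc : ∀ (js : List (Fin n)) → D zero (Xs (map suc js)) ≋ (λ _ → 0ℤ)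
D-Xs-suc []       L = refl
D-Xs-suc (j ∷ js) L = ≡.trans (D-lin (δ (suc j)) (Xs (map suc js)) zero L) (cong₂ _+_ (ℤP.*-zeroˡ (Xs (map suc js) L))
  (≡.trans (⊛-congˡ {F = x (suc j)} (D-Xs-suc js) L) (≡.trans (⊛-comm (x (suc j)) (λ _ → 0ℤ) L) (⊛-zeroˡ (x (suc j)) L))))

x₀-replicate : ∀ m (g : Ser (Fin (suc n))) K →
  (x zero ⊛ g) (replicate (suc m) zero ++ map suc K) ≡ ℤ.+ suc m * g (replicate m zero ++ map suc K)
x₀-replicate zero g K = begin
  (x zero ⊛ g) (zero ∷ map suc K)
    ≡⟨ D-lin (δ zero) g zero (map suc K) ⟩
  1ℤ * g (map suc K) + (x zero ⊛ D zero g) (map suc K)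
    ≡⟨ cong (1ℤ * g (map suc K) +_) (≡.trans (^*-⊛ suc (x zero) (D zero g) K)
         (≡.trans (⊛-congʳ {G = suc ^* D zero g} suc^*-x₀ K) (⊛-zeroˡ (suc ^* D zero g) K))) ⟩
  1ℤ * g (map suc K) + 0ℤ
    ≡⟨ ℤP.+-identityʳ _ ⟩
  1ℤ * g (map suc K) ∎
  where open ≡-Reasoning
x₀-replicate (suc m) g K = ≡.trans (D-lin (δ zero) g zero L)
  (≡.trans (cong (1ℤ * g L +_) (x₀-replicate m (D zero g) K)) (lemma (g L) (ℤ.+ suc m)))
  where
  L : List _
  L = replicate (suc m) zero ++ map suc K
  lemma : ∀ a b → 1ℤ * a + b * a ≡ (1ℤ + b) * a
  lemma = solve-∀

Xs-suc-replicate : ∀ m (js : List (Fin n)) h K →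
  (Xs (map suc js) ⊛ h) (replicate m zero ++ map suc K) ≡ (Xs js ⊛ (λ L → h (replicate m zero ++ map suc L))) K
Xs-suc-replicate zero    js h K = ≡.trans (^*-⊛ suc (Xs (map suc js)) h K) (⊛-congʳ {G = suc ^* h} (suc^*-Xs js) K)
Xs-suc-replicate (suc m) js h K = ≡.trans
  (cong (_+ (Xs (map suc js) ⊛ D zero h) L) (≡.trans (⊛-congʳ {G = h} (D-Xs-suc js) L) (⊛-zeroˡ h L)))
  (≡.trans (ℤP.+-identityˡ _) (Xs-suc-replicate m js (D zero h) K))
  where
  L : List _
  L = replicate m zero ++ map suc K

-- Multiplication by the product of all variables shifts every exponent by one, which for
-- derivatives at 0 costs the positive factor ∏ (lᵢ + 1).
Xs-nonneg : ∀ n (l : Vec ℕ n) h → 0ℤ ℤ.≤ h (lst l) → 0ℤ ℤ.≤ (Xs (fins n) ⊛ h) (lst (V.map suc l))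
Xs-nonneg zero    []      h p = subst (0ℤ ℤ.≤_) (sym (ℤP.*-identityˡ (h []))) p
Xs-nonneg (suc n) (m ∷ l) h p = subst (0ℤ ℤ.≤_) (sym e)
  (subst (ℤ._≤ ℤ.+ suc m * (Xs (fins n) ⊛ (λ L → h (replicate m zero ++ map suc L))) K) (ℤP.*-zeroʳ (ℤ.+ suc m)) (ℤP.*-monoˡ-≤-nonNeg (ℤ.+ suc m)
    (Xs-nonneg n l (λ L → h (replicate m zero ++ map suc L)) p)))
  where
  K : List (Fin n)
  K = lst (V.map suc l)
  e : (x zero ⊛ Xs (map suc (fins n)) ⊛ h) (replicate (suc m) zero ++ map suc K)
      ≡ ℤ.+ suc m * (Xs (fins n) ⊛ (λ L → h (replicate m zero ++ map suc L))) K
  e = ≡.trans (⊛-assoc (x zero) (Xs (map suc (fins n))) h (replicate (suc m) zero ++ map suc K))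
    (≡.trans (x₀-replicate m (Xs (map suc (fins n)) ⊛ h) K)
      (cong (ℤ.+ suc m *_) (Xs-suc-replicate m (fins n) h K)))

sq-nonneg : ∀ z → 0ℤ ℤ.≤ z * z
sq-nonneg (ℤ.+ zero)   = +≤+ z≤n
sq-nonneg (ℤ.+ suc m)  = +≤+ z≤n
sq-nonneg (ℤ.-[1+ m ]) = +≤+ z≤n

∑-nonneg : ∀ {A : Set} (xs : List A) {f} → (∀ x → 0ℤ ℤ.≤ f x) → 0ℤ ℤ.≤ ∑ xs f
∑-nonneg []       p = +≤+ z≤n
∑-nonneg (x ∷ xs) p = ℤP.+-mono-≤ (p x) (∑-nonneg xs p)

cancel-pos : ∀ {c y} → 0ℤ ℤ.< c → 0ℤ ℤ.≤ c * y → 0ℤ ℤ.≤ y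
cancel-pos {ℤ.+ suc c} {y} p q = ℤP.*-cancelˡ-≤-pos 0ℤ y (ℤ.+ suc c) (subst (ℤ._≤ ℤ.+ suc c * y) (sym (ℤP.*-zeroʳ (ℤ.+ suc c))) q)
cancel-pos {ℤ.+ zero} (+<+ ())
cancel-pos { ℤ.-[1+ _ ]} ()

Res-suc : ∀ (F : Ser (Fin (suc n) × Fin (suc n))) → suc ^* Matrices.Res (suc n) F ≋ Matrices.Res n (suc² ^* F)
Res-suc F L = cong F (≡.trans (sym (ListP.map-∘ L)) (ListP.map-∘ L))

-- Induction on the number of variables and, inside, on the least exponent d. While d is positive a
-- full column can be stripped. At d = 0 nothing is lost by setting x₀ = 0; the Vandermonde product
-- becomes the product of the other variables times their Vandermonde product, and the extra factor
-- takes up the unit gaps of `stair`.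
vand-Res-nonneg : ∀ n {F} → Good F → ∀ ds → 0ℤ ℤ.≤ (vand (fins n) ⊛ Matrices.Res n F) (lst (stair ds))
vand-Res-nonneg zero {F} good [] with Good.isGram good 0
... | Φs , e = subst (0ℤ ℤ.≤_) (sym (≡.trans (ℤP.*-identityˡ (F [])) (e [] refl))) (∑-nonneg Φs (λ Φ → sq-nonneg (Φ [])))
vand-Res-nonneg (suc n) good (d ∷ ds) = go d good
  where
  go : ∀ d {F} → Good F → 0ℤ ℤ.≤ (vand (fins (suc n)) ⊛ Matrices.Res (suc n) F) (lst (stair (d ∷ ds)))
  go zero {F} good = subst (0ℤ ℤ.≤_) (sym e)
    (Xs-nonneg n (stair ds) (vand (fins n) ⊛ Matrices.Res n (suc² ^* F)) (vand-Res-nonneg n (Good-suc good) ds))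
    where
    V R : Ser (Fin (suc n))
    V = vand (map suc (fins n))
    R = Matrices.Res (suc n) F
    K : List (Fin n)
    K = lst (V.map suc (stair ds))
    e : (vand (fins (suc n)) ⊛ R) (lst (stair (0 ∷ ds))) ≡ (Xs (fins n) ⊛ (vand (fins n) ⊛ Matrices.Res n (suc² ^* F))) K
    e = begin
      (vand (fins (suc n)) ⊛ R) (map suc (lst (V.map id (V.map suc (stair ds)))))
        ≡⟨ cong (λ v → (vand (fins (suc n)) ⊛ R) (map suc (lst v))) (VP.map-id (V.map suc (stair ds))) ⟩
      (vand (fins (suc n)) ⊛ R) (map suc K)
        ≡⟨ ⊛-assoc (π zero (map suc (fins n))) V R (map suc K) ⟩
      (π zero (map suc (fins n)) ⊛ (V ⊛ R)) (map suc K)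
        ≡⟨ ^*-⊛ suc (π zero (map suc (fins n))) (V ⊛ R) K ⟩
      ((suc ^* π zero (map suc (fins n))) ⊛ (suc ^* (V ⊛ R))) K
        ≡⟨ ⊛-cong (suc^*-π₀ (fins n)) (≋-trans (^*-⊛ suc V R) (⊛-cong (suc^*-vand (fins n)) (Res-suc F))) K ⟩
      (Xs (fins n) ⊛ (vand (fins n) ⊛ Matrices.Res n (suc² ^* F))) K ∎
      where open ≡-Reasoning
  go (suc d) {F} good = subst (0ℤ ℤ.≤_) (sym (perm c r)) (cancel-pos (*-pos (detScale-pos (suc n)) (δ!-pos (suc n)))
    (subst (0ℤ ℤ.≤_) (vand-Res-column (suc n) good (lst (stair (d ∷ ds)))) (go d (Good-contract (suc n) good))))
    where
    c : Comm (vand (fins (suc n)) ⊛ Matrices.Res (suc n) F)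
    c = Comm-⊛ (Comm-vand (fins (suc n))) (Comm-^* (Matrices.diag (suc n)) (Good.isComm good))
    r : lst (stair (suc d ∷ ds)) ↭ fins (suc n) ++ lst (stair (d ∷ ds))
    r = ↭-trans (↭-reflexive (cong lst (VP.map-∘ suc (d ℕ.+_) (0 ∷ V.map suc (stair ds))))) (lst-suc (stair (d ∷ ds)))

-- Ordinary generating functions

Ogf : ℕ → Set
Ogf n = Vec ℕ n → ℤ

xmul : Fin n → Ogf n → Ogf n
xmul zero    c (zero ∷ α)  = 0ℤ
xmul zero    c (suc m ∷ α) = c (m ∷ α)
xmul (suc i) c (m ∷ α)     = xmul i (λ β → c (m ∷ β)) α

dq : Fin n → Ogf n → Ogf n
dq zero    c (m ∷ α) = ℤ.+ suc m * c (suc m ∷ α)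
dq (suc i) c (m ∷ α) = dq i (λ β → c (m ∷ β)) α

egf : Ogf n → Ser (Fin n)
egf {n} c []      = c (V.replicate n 0)
egf     c (q ∷ L) = egf (dq q c) L

infix 4 _≗ᵒ_
_≗ᵒ_ : Ogf n → Ogf n → Set
c ≗ᵒ d = ∀ α → c α ≡ d α

dq-cong : ∀ (q : Fin n) {c d} → c ≗ᵒ d → dq q c ≗ᵒ dq q d
dq-cong zero    e (m ∷ α) = cong (ℤ.+ suc m *_) (e (suc m ∷ α))
dq-cong (suc i) e (m ∷ α) = dq-cong i (λ β → e (m ∷ β)) α

dq-lin : ∀ (q : Fin n) y z c d → dq q (λ α → y * c α + z * d α) ≗ᵒ (λ α → y * dq q c α + z * dq q d α)
dq-lin zero    y z c d (m ∷ α) = lemma y z (ℤ.+ suc m) (c (suc m ∷ α)) (d (suc m ∷ α))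
  where
  lemma : ∀ y z s a b → s * (y * a + z * b) ≡ y * (s * a) + z * (s * b)
  lemma = solve-∀
dq-lin (suc i) y z c d (m ∷ α) = dq-lin i y z (λ β → c (m ∷ β)) (λ β → d (m ∷ β)) α

egf-cong : ∀ {c d : Ogf n} → c ≗ᵒ d → egf c ≋ egf d
egf-cong {n} e []      = e (V.replicate n 0)
egf-cong     e (q ∷ L) = egf-cong (dq-cong q e) L

egf-lin : ∀ y z (c d : Ogf n) → egf (λ α → y * c α + z * d α) ≋ (y · egf c) ⊕ (z · egf d)
egf-lin y z c d []      = refl
egf-lin y z c d (q ∷ L) = ≡.trans (egf-cong (dq-lin q y z c d) L) (egf-lin y z (dq q c) (dq q d) L)

xmul-cong : ∀ (i : Fin n) {c d} → c ≗ᵒ d → xmul i c ≗ᵒ xmul i d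
xmul-cong zero    e (zero ∷ α)  = refl
xmul-cong zero    e (suc m ∷ α) = e (m ∷ α)
xmul-cong (suc i) e (m ∷ α)     = xmul-cong i (λ β → e (m ∷ β)) α

dq-0 : ∀ (q : Fin n) → dq q (λ _ → 0ℤ) ≗ᵒ (λ _ → 0ℤ)
dq-0 zero    (m ∷ α) = ℤP.*-zeroʳ (ℤ.+ suc m)
dq-0 (suc i) (m ∷ α) = dq-0 i α

xmul-· : ∀ (i : Fin n) z c → xmul i (λ α → z * c α) ≗ᵒ (λ α → z * xmul i c α)
xmul-· zero    z c (zero ∷ α)  = sym (ℤP.*-zeroʳ z)
xmul-· zero    z c (suc m ∷ α) = refl
xmul-· (suc i) z c (m ∷ α)     = xmul-· i z (λ β → c (m ∷ β)) α

-- The commutation relation of ∂ and x, written as a linear combination to which `egf-lin` applies.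
dq-xmul : ∀ (q i : Fin n) c → dq q (xmul i c) ≗ᵒ (λ α → δ i q * c α + 1ℤ * xmul i (dq q c) α)
dq-xmul zero zero c (zero ∷ α)  = sym (ℤP.+-identityʳ _)
dq-xmul zero zero c (suc m ∷ α) = lemma (ℤ.+ suc m) (c (suc m ∷ α))
  where
  lemma : ∀ a b → (1ℤ + a) * b ≡ 1ℤ * b + 1ℤ * (a * b)
  lemma = solve-∀
dq-xmul (suc q) zero c (zero ∷ α)  = ≡.trans (dq-0 q α) (sym (cong (_+ 0ℤ) (ℤP.*-zeroˡ (c (zero ∷ α)))))
dq-xmul (suc q) zero c (suc m ∷ α) = lemma (c (suc m ∷ α)) (dq q (λ β → c (m ∷ β)) α)
  where
  lemma : ∀ a b → b ≡ 0ℤ * a + 1ℤ * b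
  lemma = solve-∀
dq-xmul zero (suc i) c (m ∷ α) = sym (≡.trans (lemma (c (m ∷ α)) _) (xmul-· i (ℤ.+ suc m) (λ β → c (suc m ∷ β)) α))
  where
  lemma : ∀ a b → 0ℤ * a + 1ℤ * b ≡ b
  lemma = solve-∀
dq-xmul (suc q) (suc i) c (m ∷ α) = dq-xmul q i (λ β → c (m ∷ β)) α

xmul-origin : ∀ (i : Fin n) c → xmul i c (V.replicate n 0) ≡ 0ℤ
xmul-origin zero    c = refl
xmul-origin (suc i) c = xmul-origin i (λ β → c (0 ∷ β))

egf-xmul : ∀ (i : Fin n) c → egf (xmul i c) ≋ x i ⊛ egf c
egf-xmul i c []      = ≡.trans (xmul-origin i c) (sym (ℤP.*-zeroˡ (egf c [])))
egf-xmul i c (q ∷ L) = begin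
  egf (dq q (xmul i c)) L
    ≡⟨ egf-cong (dq-xmul q i c) L ⟩
  egf (λ α → δ i q * c α + 1ℤ * xmul i (dq q c) α) L
    ≡⟨ egf-lin (δ i q) 1ℤ c (xmul i (dq q c)) L ⟩
  δ i q * egf c L + 1ℤ * egf (xmul i (dq q c)) L
    ≡⟨ cong (δ i q * egf c L +_) (≡.trans (ℤP.*-identityˡ _) (egf-xmul i (dq q c) L)) ⟩
  δ i q * egf c L + (x i ⊛ egf (dq q c)) L
    ≡⟨ sym (D-lin (δ i) (egf c) q L) ⟩
  (x i ⊛ egf c) (q ∷ L) ∎
  where open ≡-Reasoning

vfact : Vec ℕ n → ℤ
vfact []      = 1ℤ
vfact (m ∷ l) = δ! m m * vfact l

vfact-pos : ∀ (l : Vec ℕ n) → 0ℤ ℤ.< vfact l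
vfact-pos []      = +<+ (s≤s z≤n)
vfact-pos (m ∷ l) = *-pos (δ!-pos m) (vfact-pos l)

egf-map-suc : ∀ (c : Ogf (suc n)) K → egf c (map suc K) ≡ egf (λ β → c (0 ∷ β)) K
egf-map-suc c []      = refl
egf-map-suc c (q ∷ K) = egf-map-suc (dq (suc q) c) K

egf-replicate : ∀ m (c : Ogf (suc n)) K → egf c (replicate m zero ++ map suc K) ≡ δ! m m * egf (λ β → c (m ∷ β)) K
egf-replicate zero    c K = ≡.trans (egf-map-suc c K) (sym (ℤP.*-identityˡ _))
egf-replicate (suc m) c K = begin
  egf (dq zero c) (replicate m zero ++ map suc K)
    ≡⟨ egf-replicate m (dq zero c) K ⟩
  δ! m m * egf (λ β → ℤ.+ suc m * c (suc m ∷ β)) K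
    ≡⟨ cong (δ! m m *_) (≡.trans (egf-cong (λ β → sym (ℤP.+-identityʳ (ℤ.+ suc m * c (suc m ∷ β)))) K)
         (≡.trans (egf-lin (ℤ.+ suc m) 0ℤ (λ β → c (suc m ∷ β)) (λ β → c (suc m ∷ β)) K) (ℤP.+-identityʳ _))) ⟩
  δ! m m * (ℤ.+ suc m * egf (λ β → c (suc m ∷ β)) K)
    ≡⟨ lemma (δ! m m) (ℤ.+ suc m) _ ⟩
  ℤ.+ suc m * δ! m m * egf (λ β → c (suc m ∷ β)) K ∎
  where
  open ≡-Reasoning
  lemma : ∀ a b c → a * (b * c) ≡ b * a * c
  lemma = solve-∀

egf-lst : ∀ (c : Ogf n) l → egf c (lst l) ≡ vfact l * c l
egf-lst c []      = sym (ℤP.*-identityˡ (c []))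
egf-lst c (m ∷ l) = ≡.trans (egf-replicate m c (lst l))
  (≡.trans (cong (δ! m m *_) (egf-lst (λ β → c (m ∷ β)) l)) (sym (ℤP.*-assoc (δ! m m) (vfact l) _)))

*-cancelˡ-pos : ∀ {c y z} → 0ℤ ℤ.< c → c * y ≡ c * z → y ≡ z
*-cancelˡ-pos {ℤ.+ suc c} {y} {z} p e = ℤP.*-cancelˡ-≡ (ℤ.+ suc c) y z e
*-cancelˡ-pos {ℤ.+ zero} (+<+ ())
*-cancelˡ-pos { ℤ.-[1+ _ ]} ()

egf-injective : ∀ {c d : Ogf n} → egf c ≋ egf d → c ≗ᵒ d
egf-injective {c = c} {d} e l = *-cancelˡ-pos (vfact-pos l) (≡.trans (sym (egf-lst c l)) (≡.trans (e (lst l)) (egf-lst d l)))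

-- Alternants and their antisymmetry

-- Multiplication by xᵢ - xⱼ, the negative of `ℓ i j`: in an alternant the decreasing exponents λ +
-- δ get the positive sign.
opℓ : Fin n → Fin n → Ogf n → Ogf n
opℓ i j c α = xmul i c α - xmul j c α

opπ : Fin n → List (Fin n) → Ogf n → Ogf n
opπ i []       c = c
opπ i (j ∷ js) c = opℓ i j (opπ i js c)

opA : List (Fin n) → Ogf n → Ogf n
opA []       c = c
opA (i ∷ is) c = opπ i is (opA is c)

πᵈ : Fin n → List (Fin n) → Ser (Fin n)
πᵈ i []       = con 1ℤ
πᵈ i (j ∷ js) = ℓ j i ⊛ πᵈ i js

vandᵈ : List (Fin n) → Ser (Fin n)
vandᵈ []       = con 1ℤ
vandᵈ (i ∷ is) = πᵈ i is ⊛ vandᵈ is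

egf-opℓ : ∀ (i j : Fin n) c → egf (opℓ i j c) ≋ ℓ j i ⊛ egf c
egf-opℓ i j c L = begin
  egf (opℓ i j c) L
    ≡⟨ egf-cong (λ α → lemma (xmul i c α) (xmul j c α)) L ⟩
  egf (λ α → 1ℤ * xmul i c α + - 1ℤ * xmul j c α) L
    ≡⟨ egf-lin 1ℤ (- 1ℤ) (xmul i c) (xmul j c) L ⟩
  1ℤ * egf (xmul i c) L + - 1ℤ * egf (xmul j c) L
    ≡⟨ sym (lemma (egf (xmul i c) L) (egf (xmul j c) L)) ⟩
  egf (xmul i c) L - egf (xmul j c) L
    ≡⟨ cong₂ _-_ (egf-xmul i c L) (egf-xmul j c L) ⟩
  (x i ⊛ egf c) L - (x j ⊛ egf c) L
    ≡⟨ solve 3 (λ a b f → a :* f :- b :* f := (a :- b) :* f) (λ {_} → ≋-refl) (x i) (x j) (egf c) L ⟩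
  (ℓ j i ⊛ egf c) L ∎
  where
  open ≡-Reasoning
  open SerSolver (Fin _) using (solve; _:=_; _:*_; _:-_)
  lemma : ∀ a b → a - b ≡ 1ℤ * a + - 1ℤ * b
  lemma = solve-∀

egf-opπ : ∀ (i : Fin n) js c → egf (opπ i js c) ≋ πᵈ i js ⊛ egf c
egf-opπ i []       c = ≋-sym (con-1-identityˡ (egf c))
egf-opπ i (j ∷ js) c = ≋-trans (egf-opℓ i j (opπ i js c))
  (≋-trans (⊛-congˡ {F = ℓ j i} (egf-opπ i js c)) (≋-sym (⊛-assoc (ℓ j i) (πᵈ i js) (egf c))))

egf-opA : ∀ (is : List (Fin n)) c → egf (opA is c) ≋ vandᵈ is ⊛ egf c
egf-opA []       c = ≋-sym (con-1-identityˡ (egf c))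
egf-opA (i ∷ is) c = ≋-trans (egf-opπ i is (opA is c))
  (≋-trans (⊛-congˡ {F = πᵈ i is} (egf-opA is c)) (≋-sym (⊛-assoc (πᵈ i is) (vandᵈ is) (egf c))))

alternant : Ogf n → Ogf n
alternant {n} = opA (fins n)

-- The interchange of the letters k and k + 1, and the identity when k + 1 is out of range.
τ : ℕ → Fin n → Fin n
τ {suc zero}    zero    i             = i
τ {suc (suc n)} zero    zero          = suc zero
τ {suc (suc n)} zero    (suc zero)    = zero
τ {suc (suc n)} zero    (suc (suc i)) = suc (suc i)
τ               (suc k) zero          = zero
τ               (suc k) (suc i)       = suc (τ k i)

τ-involutive : ∀ k (i : Fin n) → τ k (τ k i) ≡ i
τ-involutive {suc zero}    zero    i             = refl
τ-involutive {suc (suc n)} zero    zero          = refl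
τ-involutive {suc (suc n)} zero    (suc zero)    = refl
τ-involutive {suc (suc n)} zero    (suc (suc i)) = refl
τ-involutive               (suc k) zero          = refl
τ-involutive               (suc k) (suc i)       = cong suc (τ-involutive k i)

swapAt : ℕ → Vec A n → Vec A n
swapAt k       []          = []
swapAt zero    (a ∷ [])    = a ∷ []
swapAt zero    (a ∷ b ∷ v) = b ∷ a ∷ v
swapAt (suc k) (a ∷ v)     = a ∷ swapAt k v

swapL : ℕ → List A → List A
swapL k       []          = []
swapL zero    (a ∷ [])    = a ∷ []
swapL zero    (a ∷ b ∷ v) = b ∷ a ∷ v
swapL (suc k) (a ∷ v)     = a ∷ swapL k v

swapL-↭ : ∀ k (v : List A) → swapL k v ↭ v
swapL-↭ k       []          = refl
swapL-↭ zero    (a ∷ [])    = refl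
swapL-↭ zero    (a ∷ b ∷ v) = swap b a refl
swapL-↭ (suc k) (a ∷ v)     = prep a (swapL-↭ k v)

swapL-map : ∀ {B : Set} (f : A → B) k v → swapL k (map f v) ≡ map f (swapL k v)
swapL-map f k       []          = refl
swapL-map f zero    (a ∷ [])    = refl
swapL-map f zero    (a ∷ b ∷ v) = refl
swapL-map f (suc k) (a ∷ v)     = cong (f a ∷_) (swapL-map f k v)

map-τ-fins : ∀ n k → map (τ k) (fins n) ≡ swapL k (fins n)
map-τ-fins zero          k       = refl
map-τ-fins (suc zero)    zero    = refl
map-τ-fins (suc (suc n)) zero    = cong (λ js → suc zero ∷ zero ∷ js)
  (≡.trans (sym (ListP.map-∘ (map suc (fins n)))) (≡.trans (sym (ListP.map-∘ (fins n))) (ListP.map-∘ (fins n))))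
map-τ-fins (suc n) (suc k) = cong (zero ∷_) (begin
  map (τ (suc k)) (map suc (fins n)) ≡⟨ sym (ListP.map-∘ (fins n)) ⟩
  map (suc ∘ τ k) (fins n)           ≡⟨ ListP.map-∘ (fins n) ⟩
  map suc (map (τ k) (fins n))       ≡⟨ cong (map suc) (map-τ-fins n k) ⟩
  map suc (swapL k (fins n))         ≡⟨ sym (swapL-map suc k (fins n)) ⟩
  swapL k (map suc (fins n))         ∎)
  where open ≡-Reasoning

dq-swapAt : ∀ k (q : Fin n) c α → dq (τ k q) c (swapAt k α) ≡ dq q (c ∘ swapAt k) α
dq-swapAt {suc zero}    zero    zero          c (a ∷ [])    = refl
dq-swapAt {suc (suc n)} zero    zero          c (a ∷ b ∷ α) = refl
dq-swapAt {suc (suc n)} zero    (suc zero)    c (a ∷ b ∷ α) = refl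
dq-swapAt {suc (suc n)} zero    (suc (suc q)) c (a ∷ b ∷ α) = refl
dq-swapAt               (suc k) zero          c (a ∷ α)     = refl
dq-swapAt               (suc k) (suc q)       c (a ∷ α)     = dq-swapAt k q (λ β → c (a ∷ β)) α

swapAt-replicate : ∀ k n (a : A) → swapAt k (V.replicate n a) ≡ V.replicate n a
swapAt-replicate k       zero          a = refl
swapAt-replicate zero    (suc zero)    a = refl
swapAt-replicate zero    (suc (suc n)) a = refl
swapAt-replicate (suc k) (suc n)       a = cong (a ∷_) (swapAt-replicate k n a)

egf-swapAt : ∀ k (c : Ogf n) → egf (c ∘ swapAt k) ≋ τ k ^* egf c
egf-swapAt {n} k c []      = cong c (swapAt-replicate k n 0)
egf-swapAt     k c (q ∷ L) = ≡.trans (egf-cong (λ α → sym (dq-swapAt k q c α)) L) (egf-swapAt k (dq (τ k q) c) L)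

δ-involution : ∀ {φ : Fin n → Fin n} → (∀ i → φ (φ i) ≡ i) → ∀ i j → δ i (φ j) ≡ δ (φ i) j
δ-involution {φ = φ} inv i j with φ i FinP.≟ j
... | yes refl = ≡.trans (cong (δ i) (inv i)) (≡.trans (δ-refl i) (sym (δ-refl (φ i))))
... | no ne    = ≡.trans (δ-≢ (λ e → ne (≡.trans (cong φ e) (inv j)))) (sym (δ-≢ ne))

module Involution {φ : Fin n → Fin n} (inv : ∀ i → φ (φ i) ≡ i) where

  ^*-x : ∀ i → φ ^* x i ≋ x (φ i)
  ^*-x i = ≋-trans (^*-lin φ (δ i)) (lin-cong (δ-involution inv i))

  ^*-ℓ : ∀ i j → φ ^* ℓ i j ≋ ℓ (φ i) (φ j)
  ^*-ℓ i j L = cong₂ _-_ (^*-x j L) (^*-x i L)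

  ^*-π : ∀ i js → φ ^* π i js ≋ π (φ i) (map φ js)
  ^*-π i []       = ^*-con φ 1ℤ
  ^*-π i (j ∷ js) = ≋-trans (^*-⊛ φ (ℓ i j) (π i js)) (⊛-cong (^*-ℓ i j) (^*-π i js))

  ^*-vand : ∀ is → φ ^* vand is ≋ vand (map φ is)
  ^*-vand []       = ^*-con φ 1ℤ
  ^*-vand (i ∷ is) = ≋-trans (^*-⊛ φ (π i is) (vand is)) (⊛-cong (^*-π i is) (^*-vand is))

  ^*-πᵈ : ∀ i js → φ ^* πᵈ i js ≋ πᵈ (φ i) (map φ js)
  ^*-πᵈ i []       = ^*-con φ 1ℤ
  ^*-πᵈ i (j ∷ js) = ≋-trans (^*-⊛ φ (ℓ j i) (πᵈ i js)) (⊛-cong (^*-ℓ j i) (^*-πᵈ i js))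

  ^*-vandᵈ : ∀ is → φ ^* vandᵈ is ≋ vandᵈ (map φ is)
  ^*-vandᵈ []       = ^*-con φ 1ℤ
  ^*-vandᵈ (i ∷ is) = ≋-trans (^*-⊛ φ (πᵈ i is) (vandᵈ is)) (⊛-cong (^*-πᵈ i is) (^*-vandᵈ is))

module _ {n : ℕ} where
  open SerSolver (Fin n) using (solve; _:=_; _:*_; _:-_; :-_)

  πᵈ-↭ : ∀ (i : Fin n) {js ks} → js ↭ ks → πᵈ i js ≋ πᵈ i ks
  πᵈ-↭ i refl       = ≋-refl
  πᵈ-↭ i (prep j r) = ⊛-congˡ {F = ℓ j i} (πᵈ-↭ i r)
  πᵈ-↭ i (swap {ys = ys} j k r) = ≋-trans (⊛-congˡ {F = ℓ j i} (⊛-congˡ {F = ℓ k i} (πᵈ-↭ i r)))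
    (solve 3 (λ a b p → a :* (b :* p) := b :* (a :* p)) (λ {_} → ≋-refl) (ℓ j i) (ℓ k i) (πᵈ i ys))
  πᵈ-↭ i (trans r s) = ≋-trans (πᵈ-↭ i r) (πᵈ-↭ i s)

  vandᵈ-swapL : ∀ k (is : List (Fin n)) → suc k ℕ.< length is → vandᵈ (swapL k is) ≋ ⊝ vandᵈ is
  vandᵈ-swapL zero (i ∷ []) (s≤s ())
  vandᵈ-swapL zero (i ∷ j ∷ is) _ =
    solve 5 (λ xi xj p q v → (xj :- xi) :* q :* (p :* v) := :- ((xi :- xj) :* p :* (q :* v))) (λ {_} → ≋-refl)
      (x i) (x j) (πᵈ i is) (πᵈ j is) (vandᵈ is)
  vandᵈ-swapL (suc k) (i ∷ is) (s≤s k<) = ≋-trans (⊛-cong (πᵈ-↭ i (swapL-↭ k is)) (vandᵈ-swapL k is k<))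
    (solve 2 (λ p v → p :* (:- v) := :- (p :* v)) (λ {_} → ≋-refl) (πᵈ i is) (vandᵈ is))

  vand-∷ʳ : ∀ (is : List (Fin n)) i → vand (is ++ i ∷ []) ≋ πᵈ i is ⊛ vand is
  vand-∷ʳ []       i = ≋-refl
  vand-∷ʳ (j ∷ is) i = ≋-trans (⊛-cong (π-∷ʳ is) (vand-∷ʳ is i))
    (solve 4 (λ p l q v → p :* l :* (q :* v) := l :* q :* (p :* v)) (λ {_} → ≋-refl) (π j is) (ℓ j i) (πᵈ i is) (vand is))
    where
    π-∷ʳ : ∀ ks → π j (ks ++ i ∷ []) ≋ π j ks ⊛ ℓ j i
    π-∷ʳ []       = ⊛-comm (ℓ j i) (con 1ℤ)
    π-∷ʳ (k ∷ ks) = ≋-trans (⊛-congˡ {F = ℓ j k} (π-∷ʳ ks)) (≋-sym (⊛-assoc (ℓ j k) (π j ks) (ℓ j i)))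

  vand-reverse : ∀ (is : List (Fin n)) → vand (Data.List.reverse is) ≋ vandᵈ is
  vand-reverse []       = ≋-refl
  vand-reverse (i ∷ is) L = ≡.trans (cong (λ js → vand js L) (ListP.unfold-reverse i is))
    (≋-trans (vand-∷ʳ (Data.List.reverse is) i) (⊛-cong (πᵈ-↭ i (↭P.↭-reverse is)) (vand-reverse is)) L)

Sym : Ogf n → Set
Sym c = ∀ k v → c (swapAt k v) ≡ c v

-- Antisymmetry under adjacent interchanges, arranged by depth with the earlier exponents frozen:
-- this is how `interlace` consumes it.
AntiSym : Ogf n → Set
AntiSym {zero}        c = ⊤
AntiSym {suc zero}    c = ⊤
AntiSym {suc (suc n)} c = (∀ a b v → c (b ∷ a ∷ v) ≡ - c (a ∷ b ∷ v)) × (∀ a → AntiSym (λ v → c (a ∷ v)))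

swapAt⇒AntiSym : ∀ (c : Ogf n) → (∀ k v → suc k ℕ.< n → c (swapAt k v) ≡ - c v) → AntiSym c
swapAt⇒AntiSym {zero}        c h = tt
swapAt⇒AntiSym {suc zero}    c h = tt
swapAt⇒AntiSym {suc (suc n)} c h =
  (λ a b v → h 0 (a ∷ b ∷ v) (s≤s (s≤s z≤n))) , (λ a → swapAt⇒AntiSym (λ v → c (a ∷ v)) (λ k v k< → h (suc k) (a ∷ v) (s≤s k<)))

-- Proved on the exponential side, where an interchange of exponents is a substitution of variables:
-- the Vandermonde product changes sign and the symmetric factor does not.
alternant-anti : ∀ {c : Ogf n} → Sym c → AntiSym (alternant c)
alternant-anti {n} {c} s = swapAt⇒AntiSym (alternant c) (λ k v k< → *-cancelˡ-pos (vfact-pos v) (begin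
  vfact v * alternant c (swapAt k v)
    ≡⟨ sym (egf-lst (alternant c ∘ swapAt k) v) ⟩
  egf (alternant c ∘ swapAt k) (lst v)
    ≡⟨ egf-swapAt k (alternant c) (lst v) ⟩
  (τ k ^* egf (alternant c)) (lst v)
    ≡⟨ egf-opA (fins n) c (map (τ k) (lst v)) ⟩
  (τ k ^* (vandᵈ (fins n) ⊛ egf c)) (lst v)
    ≡⟨ ^*-⊛ (τ k) (vandᵈ (fins n)) (egf c) (lst v) ⟩
  ((τ k ^* vandᵈ (fins n)) ⊛ (τ k ^* egf c)) (lst v)
    ≡⟨ ⊛-cong (≋-trans (Involution.^*-vandᵈ (τ-involutive k) (fins n))
         (≋-trans (λ L → cong (λ is → vandᵈ is L) (map-τ-fins n k)) (vandᵈ-swapL k (fins n) (subst (suc k ℕ.<_) (sym (length-fins n)) k<))))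
         (≋-trans (≋-sym (egf-swapAt k c)) (egf-cong (s k))) (lst v) ⟩
  ((⊝ vandᵈ (fins n)) ⊛ egf c) (lst v)
    ≡⟨ solve 2 (λ v f → (:- v) :* f := :- (v :* f)) (λ {_} → ≋-refl) (vandᵈ (fins n)) (egf c) (lst v) ⟩
  - (vandᵈ (fins n) ⊛ egf c) (lst v)
    ≡⟨ cong -_ (≡.trans (sym (egf-opA (fins n) c (lst v))) (egf-lst (alternant c) v)) ⟩
  - (vfact v * alternant c v)
    ≡⟨ ℤP.neg-distribʳ-* (vfact v) (alternant c v) ⟩
  vfact v * - alternant c v ∎))
  where
  open ≡-Reasoning
  open SerSolver (Fin n) using (solve; _:=_; _:*_; :-_)

-- Integer-valued indicators and bounded sums

le eq : ℕ → ℕ → ℤ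
le zero    n       = 1ℤ
le (suc m) zero    = 0ℤ
le (suc m) (suc n) = le m n
eq zero    zero    = 1ℤ
eq zero    (suc n) = 0ℤ
eq (suc m) zero    = 0ℤ
eq (suc m) (suc n) = eq m n

le-cases : ∀ m n → (le m n ≡ 0ℤ × n ℕ.< m) ⊎ (le m n ≡ 1ℤ × m ℕ.≤ n)
le-cases zero    n       = inj₂ (refl , z≤n)
le-cases (suc m) zero    = inj₁ (refl , s≤s z≤n)
le-cases (suc m) (suc n) with le-cases m n
... | inj₁ (e , p) = inj₁ (e , s≤s p)
... | inj₂ (e , p) = inj₂ (e , s≤s p)

le-yes : ∀ {m n} → m ℕ.≤ n → le m n ≡ 1ℤ
le-yes z≤n     = refl
le-yes (s≤s p) = le-yes p

le-+-lt : ∀ m n → le m n + le (suc n) m ≡ 1ℤ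
le-+-lt zero    n       = refl
le-+-lt (suc m) zero    = refl
le-+-lt (suc m) (suc n) = le-+-lt m n

le-suc : ∀ v k → le v (suc k) ≡ eq v (suc k) + le v k
le-suc zero          k       = refl
le-suc (suc zero)    zero    = refl
le-suc (suc (suc v)) zero    = refl
le-suc (suc v)       (suc k) = le-suc v k

le-zero : ∀ v → le v 0 ≡ eq v 0
le-zero zero    = refl
le-zero (suc v) = refl

eq-refl : ∀ m → eq m m ≡ 1ℤ
eq-refl zero    = refl
eq-refl (suc m) = eq-refl m

eq-≢ : ∀ {m n} → m ≢ n → eq m n ≡ 0ℤ
eq-≢ {zero}  {zero}  ne = ⊥-elim (ne refl)
eq-≢ {zero}  {suc n} ne = refl
eq-≢ {suc m} {zero}  ne = refl
eq-≢ {suc m} {suc n} ne = eq-≢ (ne ∘ cong suc)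

eq-+ : ∀ v a b → eq (v ℕ.+ a) (v ℕ.+ b) ≡ eq a b
eq-+ zero    a b = refl
eq-+ (suc v) a b = eq-+ v a b

below : ℕ → List ℕ
below zero    = []
below (suc N) = zero ∷ map suc (below N)

down : ℕ → List ℕ
down zero    = zero ∷ []
down (suc k) = suc k ∷ down k

∑-below-eq : ∀ {m N} → m ℕ.< N → ∀ (h : ℕ → ℤ) → ∑ (below N) (λ v → eq v m * h v) ≡ h m
∑-below-eq {zero} {suc N} _ h = ≡.trans (cong₂ _+_ (ℤP.*-identityˡ (h 0))
  (≡.trans (∑-map suc (below N) _) (∑-zero (below N) (λ v → ℤP.*-zeroˡ (h (suc v)))))) (ℤP.+-identityʳ (h 0))
∑-below-eq {suc m} {suc N} (s≤s p) h = ≡.trans (cong₂ _+_ (ℤP.*-zeroˡ (h 0))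
  (≡.trans (∑-map suc (below N) _) (∑-below-eq p (h ∘ suc)))) (ℤP.+-identityˡ _)

∑-down : ∀ k {N} → k ℕ.< N → ∀ (h : ℕ → ℤ) → ∑ (down k) h ≡ ∑ (below N) (λ v → le v k * h v)
∑-down zero    {N} p h = ≡.trans (ℤP.+-identityʳ (h 0)) (sym (≡.trans (∑-cong (below N) (λ v → cong (_* h v) (le-zero v))) (∑-below-eq p h)))
∑-down (suc k) {N} p h = sym (≡.trans
  (∑-cong (below N) (λ v → ≡.trans (cong (_* h v) (le-suc v k)) (ℤP.*-distribʳ-+ (h v) (eq v (suc k)) (le v k))))
  (≡.trans (∑-+ (below N) _ _) (cong₂ _+_ (∑-below-eq p h) (sym (∑-down k (ℕP.<-trans (ℕP.n<1+n k) p) h)))))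

box : ℕ → ∀ n → List (Vec ℕ n)
box N zero    = [] ∷ []
box N (suc n) = concatMap (λ m → map (m ∷_) (box N n)) (below N)

∑-box : ∀ N n (h : Vec ℕ (suc n) → ℤ) → ∑ (box N (suc n)) h ≡ ∑ (below N) (λ m → ∑ (box N n) (λ v → h (m ∷ v)))
∑-box N n h = ≡.trans (∑-concatMap (λ m → map (m ∷_) (box N n)) (below N) h) (∑-cong (below N) (λ m → ∑-map (m ∷_) (box N n) h))

-- Removing one variable from an alternating series

-- Division by ∏ (x₀ − xⱼ) as an expansion in powers of xⱼ / x₀

telescope : (ℕ → ℕ → ℤ) → ℕ → ℕ → ℤ
telescope b m zero    = b (suc m) 0
telescope b m (suc k) = b (suc m) (suc k) + telescope b (suc m) k

divide : (ℕ → Vec ℕ n → ℤ) → ℕ → Vec ℕ n → ℤ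
divide b m []       = b m []
divide b m (k ∷ ks) = telescope (λ m′ v → divide (λ m″ α → b m″ (v ∷ α)) m′ ks) m k

telescope-cong : ∀ {b b′ : ℕ → ℕ → ℤ} → (∀ m v → b m v ≡ b′ m v) → ∀ m k → telescope b m k ≡ telescope b′ m k
telescope-cong e m zero    = e (suc m) 0
telescope-cong e m (suc k) = cong₂ _+_ (e (suc m) (suc k)) (telescope-cong e (suc m) k)

divide-cong : ∀ {b b′ : ℕ → Vec ℕ n → ℤ} → (∀ m α → b m α ≡ b′ m α) → ∀ m ks → divide b m ks ≡ divide b′ m ks
divide-cong e m []       = e m []
divide-cong e m (k ∷ ks) = telescope-cong (λ m′ v → divide-cong (λ m″ α → e m″ (v ∷ α)) m′ ks) m k

telescope-- : ∀ (b b′ : ℕ → ℕ → ℤ) m k → telescope (λ m v → b m v - b′ m v) m k ≡ telescope b m k - telescope b′ m k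
telescope-- b b′ m zero    = refl
telescope-- b b′ m (suc k) = ≡.trans (cong ((b (suc m) (suc k) - b′ (suc m) (suc k)) +_) (telescope-- b b′ (suc m) k)) (lemma (b (suc m) (suc k)) _ _ _)
  where
  lemma : ∀ a b c d → (a - b) + (c - d) ≡ (a + c) - (b + d)
  lemma = solve-∀

divide-- : ∀ (b b′ : ℕ → Vec ℕ n → ℤ) m ks → divide (λ m α → b m α - b′ m α) m ks ≡ divide b m ks - divide b′ m ks
divide-- b b′ m []       = refl
divide-- b b′ m (k ∷ ks) = ≡.trans
  (telescope-cong (λ m′ v → divide-- (λ m″ α → b m″ (v ∷ α)) (λ m″ α → b′ m″ (v ∷ α)) m′ ks) m k)
  (telescope-- _ _ m k)

telescope-suc : ∀ (b : ℕ → ℕ → ℤ) m k → telescope b (suc m) k ≡ telescope (λ m → b (suc m)) m k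
telescope-suc b m zero    = refl
telescope-suc b m (suc k) = cong (b (suc (suc m)) (suc k) +_) (telescope-suc b (suc m) k)

divide-suc : ∀ (b : ℕ → Vec ℕ n → ℤ) m ks → divide b (suc m) ks ≡ divide (λ m → b (suc m)) m ks
divide-suc b m []       = refl
divide-suc b m (k ∷ ks) = ≡.trans (telescope-suc _ m k)
  (telescope-cong (λ m′ v → divide-suc (λ m″ α → b m″ (v ∷ α)) m′ ks) m k)

-- The hypotheses say b = (x₀ - x₁) c in coefficients; along a fixed total degree consecutive terms
-- then cancel and only the first one survives.
telescope-collapse : ∀ (b c : ℕ → ℕ → ℤ) → (∀ m → b (suc m) 0 ≡ c m 0) → (∀ m v → b (suc m) (suc v) ≡ c m (suc v) - c (suc m) v) →
                     ∀ m k → telescope b m k ≡ c m k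
telescope-collapse b c e₀ e₁ m zero    = e₀ m
telescope-collapse b c e₀ e₁ m (suc k) = ≡.trans (cong₂ _+_ (e₁ m k) (telescope-collapse b c e₀ e₁ (suc m) k)) (lemma (c m (suc k)) _)
  where
  lemma : ∀ a b → (a - b) + b ≡ a
  lemma = solve-∀

freeze : ℕ → Ogf (suc (suc n)) → Ogf (suc n)
freeze v c (m ∷ α) = c (m ∷ v ∷ α)

opℓ-cong : ∀ (i j : Fin n) {c d} → c ≗ᵒ d → opℓ i j c ≗ᵒ opℓ i j d
opℓ-cong i j e α = cong₂ _-_ (xmul-cong i e α) (xmul-cong j e α)

-- The remaining factors x₀ - xⱼ do not involve x₁, whose exponent is therefore a mere parameter in
-- the induction of `divide-opπ`.
opπ-freeze : ∀ v (js : List (Fin n)) c → opπ zero (map suc js) (freeze v c) ≗ᵒ freeze v (opπ zero (map suc (map suc js)) c)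
opπ-freeze v []       c α = refl
opπ-freeze v (j ∷ js) c α = ≡.trans (opℓ-cong zero (suc j) (opπ-freeze v js c) α) (lemma α)
  where
  lemma : opℓ zero (suc j) (freeze v (opπ zero (map suc (map suc js)) c)) ≗ᵒ freeze v (opπ zero (map suc (map suc (j ∷ js))) c)
  lemma (zero ∷ α)  = refl
  lemma (suc m ∷ α) = refl

divide-opπ : ∀ (c : Ogf (suc n)) m k → divide (λ m α → opπ zero (map suc (fins n)) c (m ∷ α)) m k ≡ c (m ∷ k)
divide-opπ c m []       = refl
divide-opπ {suc n} c m (k ∷ ks) = begin
  telescope (λ m′ v → divide (λ m″ α → opℓ zero (suc zero) c₁ (m″ ∷ v ∷ α)) m′ ks) m k
    ≡⟨ telescope-collapse _ (λ m v → divide (c₁′ v) m ks) step₀ step₁ m k ⟩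
  divide (c₁′ k) m ks
    ≡⟨ divide-cong (λ m α → sym (opπ-freeze k (fins n) c (m ∷ α))) m ks ⟩
  divide (λ m α → opπ zero (map suc (fins n)) (freeze k c) (m ∷ α)) m ks
    ≡⟨ divide-opπ (freeze k c) m ks ⟩
  c (m ∷ k ∷ ks) ∎
  where
  open ≡-Reasoning
  c₁ : Ogf (suc (suc n))
  c₁ = opπ zero (map suc (map suc (fins n))) c
  c₁′ : ℕ → ℕ → Vec ℕ n → ℤ
  c₁′ v m α = c₁ (m ∷ v ∷ α)
  step₀ : ∀ m → divide (λ m″ α → opℓ zero (suc zero) c₁ (m″ ∷ 0 ∷ α)) (suc m) ks ≡ divide (c₁′ 0) m ks
  step₀ m = ≡.trans (divide-suc _ m ks) (divide-cong (λ m α → ℤP.+-identityʳ (c₁ (m ∷ 0 ∷ α))) m ks)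
  step₁ : ∀ m v → divide (λ m″ α → opℓ zero (suc zero) c₁ (m″ ∷ suc v ∷ α)) (suc m) ks ≡ divide (c₁′ (suc v)) m ks - divide (c₁′ v) (suc m) ks
  step₁ m v = ≡.trans (divide-suc _ m ks) (≡.trans (divide-- (c₁′ (suc v)) (λ m → c₁′ v (suc m)) m ks)
    (cong (λ z → divide (c₁′ (suc v)) m ks - z) (sym (divide-suc (c₁′ v) m ks))))

low : Vec ℕ n → Vec ℕ n → ℤ
low []       []       = 1ℤ
low (v ∷ vs) (k ∷ ks) = le v k * low vs ks

telescope-down : ∀ (b : ℕ → ℕ → ℤ) (h : ℕ → ℤ) t → (∀ m v → m ℕ.+ v ≡ t → b m v ≡ h v) → ∀ m k → suc m ℕ.+ k ≡ t → telescope b m k ≡ ∑ (down k) h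
telescope-down b h t e m zero    p = ≡.trans (e (suc m) 0 p) (sym (ℤP.+-identityʳ _))
telescope-down b h t e m (suc k) p = cong₂ _+_ (e (suc m) (suc k) p) (telescope-down b h t e (suc m) k (≡.trans (cong suc (sym (ℕP.+-suc m k))) p))

-- The quotient at (m , k) adds up the coefficients of `b` whose exponents in the later variables
-- are at most k and whose total degree is larger by one for each of the n factors; x₀ takes up the
-- difference. `N` is any bound above that total.
divide-box : ∀ {N} (b : ℕ → Vec ℕ n → ℤ) m k → m ℕ.+ n ℕ.+ V.sum k ℕ.< N →
  divide b m k ≡ ∑ (below N) (λ v → ∑ (box N n) (λ vs → low vs k * (eq (v ℕ.+ V.sum vs) (m ℕ.+ n ℕ.+ V.sum k) * b v vs)))
divide-box {zero} {N} b m [] p = sym (≡.trans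
  (∑-cong (below N) (λ v → ≡.trans (ℤP.+-identityʳ _) (≡.trans (ℤP.*-identityˡ _)
    (cong₂ (λ s t → eq s t * b v []) (ℕP.+-identityʳ v) (≡.trans (ℕP.+-identityʳ _) (ℕP.+-identityʳ m))))))
  (∑-below-eq (subst (ℕ._< N) (≡.trans (ℕP.+-identityʳ _) (ℕP.+-identityʳ m)) p) (λ v → b v [])))
divide-box {suc n} {N} b m (k ∷ ks) p = begin
  telescope (λ m′ v → divide (λ m″ α → b m″ (v ∷ α)) m′ ks) m k
    ≡⟨ telescope-down _ h (suc m ℕ.+ k) term m k refl ⟩
  ∑ (down k) h
    ≡⟨ ∑-down k k<N h ⟩
  ∑ (below N) (λ v → le v k * h v)
    ≡⟨ ∑-cong (below N) (λ v → ≡.trans (sym (∑-*ˡ (below N) (le v k) _)) (∑-cong (below N) (λ v₀ →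
         ≡.trans (sym (∑-*ˡ (box N n) (le v k) _)) (∑-cong (box N n) (λ vs → sym (ℤP.*-assoc (le v k) (low vs ks) _)))))) ⟩
  ∑ (below N) (λ v → ∑ (below N) (λ v₀ → ∑ (box N n) (λ vs → low (v ∷ vs) (k ∷ ks) * (eq (v₀ ℕ.+ (v ℕ.+ V.sum vs)) t * b v₀ (v ∷ vs)))))
    ≡⟨ ∑-comm (below N) (below N) _ ⟩
  ∑ (below N) (λ v₀ → ∑ (below N) (λ v → ∑ (box N n) (λ vs → low (v ∷ vs) (k ∷ ks) * (eq (v₀ ℕ.+ (v ℕ.+ V.sum vs)) t * b v₀ (v ∷ vs)))))
    ≡⟨ ∑-cong (below N) (λ v₀ → sym (∑-box N n _)) ⟩
  ∑ (below N) (λ v₀ → ∑ (box N (suc n)) (λ vs → low vs (k ∷ ks) * (eq (v₀ ℕ.+ V.sum vs) t * b v₀ vs))) ∎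
  where
  open ≡-Reasoning
  t : ℕ
  t = m ℕ.+ suc n ℕ.+ V.sum (k ∷ ks)
  h : ℕ → ℤ
  h v = ∑ (below N) (λ v₀ → ∑ (box N n) (λ vs → low vs ks * (eq (v₀ ℕ.+ (v ℕ.+ V.sum vs)) t * b v₀ (v ∷ vs))))
  arith : ∀ m n k s → suc m ℕ.+ k ℕ.+ n ℕ.+ s ≡ m ℕ.+ suc n ℕ.+ (k ℕ.+ s)
  arith = ℕSolver.solve-∀
  arith′ : ∀ m v n s → v ℕ.+ (m ℕ.+ n ℕ.+ s) ≡ m ℕ.+ v ℕ.+ n ℕ.+ s
  arith′ = ℕSolver.solve-∀
  arith″ : ∀ v v₀ s → v ℕ.+ (v₀ ℕ.+ s) ≡ v₀ ℕ.+ (v ℕ.+ s)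
  arith″ = ℕSolver.solve-∀
  k<N : k ℕ.< N
  k<N = ℕP.≤-<-trans (ℕP.≤-trans (ℕP.m≤m+n k (V.sum ks)) (ℕP.m≤n+m (k ℕ.+ V.sum ks) (m ℕ.+ suc n))) p
  total : ∀ m′ v → m′ ℕ.+ v ≡ suc m ℕ.+ k → v ℕ.+ (m′ ℕ.+ n ℕ.+ V.sum ks) ≡ t
  total m′ v e = ≡.trans (arith′ m′ v n (V.sum ks)) (≡.trans (cong (λ s → s ℕ.+ n ℕ.+ V.sum ks) e) (arith m n k (V.sum ks)))
  term : ∀ m′ v → m′ ℕ.+ v ≡ suc m ℕ.+ k → divide (λ m″ α → b m″ (v ∷ α)) m′ ks ≡ h v
  term m′ v e = ≡.trans
    (divide-box (λ m″ α → b m″ (v ∷ α)) m′ ks (ℕP.≤-<-trans (ℕP.≤-trans (ℕP.m≤n+m _ v) (ℕP.≤-reflexive (total m′ v e))) p))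
    (∑-cong (below N) (λ v₀ → ∑-cong (box N n) (λ vs → cong (λ z → low vs ks * (z * b v₀ (v ∷ vs)))
      (≡.trans (sym (eq-+ v (v₀ ℕ.+ V.sum vs) (m′ ℕ.+ n ℕ.+ V.sum ks))) (cong₂ eq (arith″ v v₀ (V.sum vs)) (total m′ v e))))))

-- int l k = 1 when l₀ > k₁ ≥ l₁ > k₂ ≥ l₂ > …, and 0 otherwise.
int : Vec ℕ (suc n) → Vec ℕ n → ℤ
int (l₀ ∷ [])     []       = 1ℤ
int (l₀ ∷ l₁ ∷ l) (k ∷ ks) = le (suc k) l₀ * (le l₁ k * int (l₁ ∷ l) ks)

∑-antisym : ∀ (xs : List A) (q : A → A → ℤ) → (∀ a b → q b a ≡ - q a b) → ∑ xs (λ a → ∑ xs (q a)) ≡ 0ℤ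
∑-antisym xs q e = x≡-x⇒x≡0 _ (≡.trans (∑-comm xs xs q)
  (≡.trans (∑-cong xs (λ b → ≡.trans (∑-cong xs (λ a → e b a)) (∑-neg xs (q b)))) (∑-neg xs _)))

-- `u` is 1 wherever the next bound holds, so that the terms paired in `interlace` carry a symmetric
-- weight.
Dominated : (ℕ → ℤ) → Vec ℕ n → Set
Dominated u []       = ⊤
Dominated u (k ∷ ks) = (∀ v → u v * le v k ≡ le v k) × Dominated (λ v → le v k) ks

-- The terms with l₀ and l₁ both at most k₁ cancel in pairs, hence l₀ > k₁; iterate.
interlace : ∀ N (u : ℕ → ℤ) (k : Vec ℕ n) (g : Ogf (suc n)) → AntiSym g → Dominated u k →
  ∑ (below N) (λ v → ∑ (box N n) (λ vs → u v * (low vs k * g (v ∷ vs)))) ≡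
  ∑ (below N) (λ v → ∑ (box N n) (λ vs → u v * (int (v ∷ vs) k * g (v ∷ vs))))
interlace N u [] g a d = refl
interlace {suc n} N u (k ∷ ks) g (a₀ , a₁) (d , ds) = begin
  ∑ (below N) (λ v → ∑ (box N (suc n)) (λ vs → u v * (low vs (k ∷ ks) * g (v ∷ vs))))
    ≡⟨ ∑-cong (below N) (λ v → ∑-box N n _) ⟩
  ∑ (below N) (λ v → ∑ (below N) (λ w → ∑ (box N n) (λ vs → u v * (le w k * low vs ks * g (v ∷ w ∷ vs)))))
    ≡⟨ ∑-cong (below N) (λ v → ≡.trans (∑-cong (below N) (λ w → ≡.trans (∑-cong (box N n) (λ vs → split v w vs)) (∑-+ (box N n) _ _))) (∑-+ (below N) _ _)) ⟩
  ∑ (below N) (λ v → ∑ (below N) (q v) + ∑ (below N) (λ w → ∑ (box N n) (λ vs → u v * le (suc k) v * (le w k * (low vs ks * g (v ∷ w ∷ vs))))))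
    ≡⟨ ≡.trans (∑-+ (below N) _ _) (≡.trans (cong (_+ rest) (∑-antisym (below N) q q-anti)) (ℤP.+-identityˡ rest)) ⟩
  ∑ (below N) (λ v → ∑ (below N) (λ w → ∑ (box N n) (λ vs → u v * le (suc k) v * (le w k * (low vs ks * g (v ∷ w ∷ vs))))))
    ≡⟨ ∑-cong (below N) (λ v → ≡.trans (factor v _) (≡.trans (cong (u v * le (suc k) v *_)
         (interlace N (λ w → le w k) ks (λ vs → g (v ∷ vs)) (a₁ v) ds)) (sym (factor v _)))) ⟩
  ∑ (below N) (λ v → ∑ (below N) (λ w → ∑ (box N n) (λ vs → u v * le (suc k) v * (le w k * (int (w ∷ vs) ks * g (v ∷ w ∷ vs))))))
    ≡⟨ ∑-cong (below N) (λ v → ∑-cong (below N) (λ w → ∑-cong (box N n) (λ vs →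
         lemma (u v) (le (suc k) v) (le w k) (int (w ∷ vs) ks) (g (v ∷ w ∷ vs))))) ⟩
  ∑ (below N) (λ v → ∑ (below N) (λ w → ∑ (box N n) (λ vs → u v * (int (v ∷ w ∷ vs) (k ∷ ks) * g (v ∷ w ∷ vs)))))
    ≡⟨ ∑-cong (below N) (λ v → sym (∑-box N n _)) ⟩
  ∑ (below N) (λ v → ∑ (box N (suc n)) (λ vs → u v * (int (v ∷ vs) (k ∷ ks) * g (v ∷ vs)))) ∎
  where
  open ≡-Reasoning
  lemma : ∀ a b c d e → a * b * (c * (d * e)) ≡ a * (b * (c * d) * e)
  lemma = solve-∀
  q : ℕ → ℕ → ℤ
  q v w = ∑ (box N n) (λ vs → le v k * le w k * (low vs ks * g (v ∷ w ∷ vs)))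
  rest : ℤ
  rest = ∑ (below N) (λ v → ∑ (below N) (λ w → ∑ (box N n) (λ vs → u v * le (suc k) v * (le w k * (low vs ks * g (v ∷ w ∷ vs))))))
  q-anti : ∀ v w → q w v ≡ - q v w
  q-anti v w = ≡.trans (∑-cong (box N n) (λ vs → ≡.trans (cong (λ z → le w k * le v k * (low vs ks * z)) (a₀ v w vs))
    (neg (le w k) (le v k) (low vs ks) _))) (∑-neg (box N n) _)
    where
    neg : ∀ a b c d → a * b * (c * - d) ≡ - (b * a * (c * d))
    neg = solve-∀
  split : ∀ v w vs → u v * (le w k * low vs ks * g (v ∷ w ∷ vs)) ≡
    le v k * le w k * (low vs ks * g (v ∷ w ∷ vs)) + u v * le (suc k) v * (le w k * (low vs ks * g (v ∷ w ∷ vs)))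
  split v w vs = begin
    u v * r                                           ≡⟨ cong (_* r) (sym (ℤP.*-identityʳ (u v))) ⟩
    -- The sum is split into v ≤ k, which will cancel in pairs, and v > k, which stays.
    u v * 1ℤ * r                                      ≡⟨ cong (λ z → u v * z * r) (sym (le-+-lt v k)) ⟩
    u v * (le v k + le (suc k) v) * r                 ≡⟨ expand (u v) (le v k) (le (suc k) v) (le w k) (low vs ks) (g (v ∷ w ∷ vs)) ⟩
    u v * le v k * r + u v * le (suc k) v * r′        ≡⟨ cong (λ z → z * r + u v * le (suc k) v * r′) (d v) ⟩
    le v k * r + u v * le (suc k) v * r′              ≡⟨ cong (_+ u v * le (suc k) v * r′) (expand′ (le v k) (le w k) (low vs ks) (g (v ∷ w ∷ vs))) ⟩
    le v k * le w k * (low vs ks * g (v ∷ w ∷ vs)) + u v * le (suc k) v * r′ ∎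
    where
    r r′ : ℤ
    r = le w k * low vs ks * g (v ∷ w ∷ vs)
    r′ = le w k * (low vs ks * g (v ∷ w ∷ vs))
    expand : ∀ u a b w l g → u * (a + b) * (w * l * g) ≡ u * a * (w * l * g) + u * b * (w * (l * g))
    expand = solve-∀
    expand′ : ∀ a w l g → a * (w * l * g) ≡ a * w * (l * g)
    expand′ = solve-∀
  factor : ∀ v (f : ℕ → Vec ℕ n → ℤ) → ∑ (below N) (λ w → ∑ (box N n) (λ vs → u v * le (suc k) v * f w vs)) ≡
           u v * le (suc k) v * ∑ (below N) (λ w → ∑ (box N n) (f w))
  factor v f = ≡.trans (∑-cong (below N) (λ w → ∑-*ˡ (box N n) (u v * le (suc k) v) (f w))) (∑-*ˡ (below N) (u v * le (suc k) v) _)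

Strict : Vec ℕ n → Set
Strict []          = ⊤
Strict (a ∷ [])    = ⊤
Strict (a ∷ b ∷ v) = b ℕ.< a × Strict (b ∷ v)

strict : Vec ℕ n → ℤ
strict []          = 1ℤ
strict (a ∷ [])    = 1ℤ
strict (a ∷ b ∷ v) = le (suc b) a * strict (b ∷ v)

strict-yes : ∀ (v : Vec ℕ n) → Strict v → strict v ≡ 1ℤ
strict-yes []          _       = refl
strict-yes (a ∷ [])    _       = refl
strict-yes (a ∷ b ∷ v) (p , s) = cong₂ _*_ (le-yes p) (strict-yes (b ∷ v) s)

strict-cases : ∀ (v : Vec ℕ n) → strict v ≡ 0ℤ ⊎ Strict v
strict-cases []          = inj₂ tt
strict-cases (a ∷ [])    = inj₂ tt
strict-cases (a ∷ b ∷ v) with le-cases (suc b) a | strict-cases (b ∷ v)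
... | inj₁ (e , _) | _      = inj₁ (≡.trans (cong (_* strict (b ∷ v)) e) (ℤP.*-zeroˡ (strict (b ∷ v))))
... | inj₂ _       | inj₁ e = inj₁ (≡.trans (cong (le (suc b) a *_) e) (ℤP.*-zeroʳ (le (suc b) a)))
... | inj₂ (_ , p) | inj₂ s = inj₂ (p , s)

-- The chain l₀ > k₁ ≥ l₁ > k₂ ≥ ... makes both of its halves strictly decreasing.
int-cases : ∀ (l : Vec ℕ (suc n)) k → int l k ≡ 0ℤ ⊎ (Strict l × Strict k)
int-cases (l₀ ∷ [])     []       = inj₂ (tt , tt)
int-cases (l₀ ∷ l₁ ∷ l) (k ∷ ks) with le-cases (suc k) l₀ | le-cases l₁ k | int-cases (l₁ ∷ l) ks
... | inj₁ (e , _) | _ | _ = inj₁ (≡.trans (cong (_* (le l₁ k * int (l₁ ∷ l) ks)) e) (ℤP.*-zeroˡ (le l₁ k * int (l₁ ∷ l) ks)))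
... | inj₂ _ | inj₁ (e , _) | _ = inj₁ (≡.trans (cong (λ z → le (suc k) l₀ * (z * int (l₁ ∷ l) ks)) e) (ℤP.*-zeroʳ (le (suc k) l₀)))
... | inj₂ _ | inj₂ _ | inj₁ e = inj₁ (≡.trans (cong (λ z → le (suc k) l₀ * (le l₁ k * z)) e)
  (≡.trans (cong (le (suc k) l₀ *_) (ℤP.*-zeroʳ (le l₁ k))) (ℤP.*-zeroʳ (le (suc k) l₀))))
int-cases (l₀ ∷ l₁ ∷ []) (k ∷ []) | inj₂ (_ , p) | inj₂ (_ , q) | inj₂ _ = inj₂ ((ℕP.≤-<-trans q p , tt) , tt)
int-cases (l₀ ∷ l₁ ∷ l₂ ∷ l) (k ∷ k₁ ∷ ks) | inj₂ (_ , p) | inj₂ (_ , q) | inj₂ (s , t) with le-cases (suc k₁) l₁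
... | inj₁ (e , _) = inj₁ (≡.trans (cong (λ z → le (suc k) l₀ * (le l₁ k * (z * (le l₂ k₁ * int (l₂ ∷ l) ks)))) e)
  (lemma (le (suc k) l₀) (le l₁ k) (le l₂ k₁ * int (l₂ ∷ l) ks)))
  where
  lemma : ∀ a b c → a * (b * (0ℤ * c)) ≡ 0ℤ
  lemma = solve-∀
... | inj₂ (_ , r) = inj₂ ((ℕP.≤-<-trans q p , s) , (ℕP.<-≤-trans r q , t))

-- Moves the strictness condition from k to l when the order of summation is changed in
-- `schur-expansion`.
strict-int : ∀ (l : Vec ℕ (suc n)) k → strict k * int l k ≡ strict l * int l k
strict-int l k with int-cases l k
... | inj₁ e       = ≡.trans (cong (strict k *_) e) (≡.trans (ℤP.*-zeroʳ (strict k)) (sym (≡.trans (cong (strict l *_) e) (ℤP.*-zeroʳ (strict l)))))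
... | inj₂ (s , t) = cong (_* int l k) (≡.trans (strict-yes k t) (sym (strict-yes l s)))

le-le : ∀ {k j} → j ℕ.≤ k → ∀ v → le v k * le v j ≡ le v j
le-le {k} {j} p v with le-cases v j
... | inj₁ (e , _) = ≡.trans (cong (le v k *_) e) (≡.trans (ℤP.*-zeroʳ (le v k)) (sym e))
... | inj₂ (e , q) = ≡.trans (cong (_* le v j) (le-yes (ℕP.≤-trans q p))) (ℤP.*-identityˡ (le v j))

Strict⇒Dominated : ∀ (k : Vec ℕ n) → Strict k → Dominated (λ _ → 1ℤ) k
Strict⇒Dominated []       s = tt
Strict⇒Dominated (k ∷ ks) s = (λ v → ℤP.*-identityˡ (le v k)) , go k ks s
  where
  go : ∀ {n} k (ks : Vec ℕ n) → Strict (k ∷ ks) → Dominated (λ v → le v k) ks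
  go k []       _       = tt
  go k (j ∷ ks) (p , s) = le-le (ℕP.<⇒≤ p) , go j ks s

AntiSym-total : ∀ s t (c : Ogf n) → AntiSym c → AntiSym (λ v → eq (s ℕ.+ V.sum v) t * c v)
AntiSym-total {zero}        s t c a = tt
AntiSym-total {suc zero}    s t c a = tt
AntiSym-total {suc (suc n)} s t c (a₀ , a₁) =
  (λ a b v → ≡.trans (cong₂ (λ z y → eq z t * y) (arith s a b (V.sum v)) (a₀ a b v)) (sym (ℤP.neg-distribʳ-* (eq (s ℕ.+ (a ℕ.+ (b ℕ.+ V.sum v))) t) _)))
  , (λ a → AntiSym-≗ (λ v → cong (λ z → eq z t * c (a ∷ v)) (ℕP.+-assoc s a (V.sum v))) (AntiSym-total (s ℕ.+ a) t (λ v → c (a ∷ v)) (a₁ a)))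
  where
  arith : ∀ s a b v → s ℕ.+ (b ℕ.+ (a ℕ.+ v)) ≡ s ℕ.+ (a ℕ.+ (b ℕ.+ v))
  arith = ℕSolver.solve-∀
  AntiSym-≗ : ∀ {n} {c d : Ogf n} → c ≗ᵒ d → AntiSym c → AntiSym d
  AntiSym-≗ {zero}        e a = tt
  AntiSym-≗ {suc zero}    e a = tt
  AntiSym-≗ {suc (suc n)} e (a₀ , a₁) = (λ a b v → ≡.trans (sym (e _)) (≡.trans (a₀ a b v) (cong -_ (e _)))) , (λ a → AntiSym-≗ (λ v → e (a ∷ v)) (a₁ a))

opA-suc : ∀ (is : List (Fin n)) c m → (λ α → opA (map suc is) c (m ∷ α)) ≗ᵒ opA is (λ α → c (m ∷ α))
opA-suc []       c m α = refl
opA-suc {n} (i ∷ is) c m α = opπ-suc is (opA (map suc is) c) (opA is (λ α → c (m ∷ α))) (opA-suc is c m) α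
  where
  opπ-suc : ∀ js (c : Ogf (suc n)) d → (λ α → c (m ∷ α)) ≗ᵒ d → (λ α → opπ (suc i) (map suc js) c (m ∷ α)) ≗ᵒ opπ i js d
  opπ-suc []       c d e α = e α
  opπ-suc (j ∷ js) c d e α = opℓ-cong i j (opπ-suc js c d e) α

-- The full alternant is ∏ (x₀ - xⱼ) times the alternant in the later variables. Dividing and
-- reading off the exponent m of x₀ leaves, after the cancellation in `interlace`, the interlacing
-- l.
alternant-slice : ∀ {N} (c : Ogf (suc n)) → Sym c → ∀ m k → Strict k → m ℕ.+ n ℕ.+ V.sum k ℕ.< N →
  alternant (λ α → c (m ∷ α)) k ≡ ∑ (box N (suc n)) (λ l → int l k * (eq (V.sum l) (m ℕ.+ n ℕ.+ V.sum k) * alternant c l))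
alternant-slice {n} {N} c s m k st p = begin
  alternant (λ α → c (m ∷ α)) k
    ≡⟨ sym (opA-suc (fins n) c m k) ⟩
  opA (map suc (fins n)) c (m ∷ k)
    ≡⟨ sym (divide-opπ (opA (map suc (fins n)) c) m k) ⟩
  divide (λ m α → alternant c (m ∷ α)) m k
    ≡⟨ divide-box _ m k p ⟩
  ∑ (below N) (λ v → ∑ (box N n) (λ vs → low vs k * g (v ∷ vs)))
    ≡⟨ ∑-cong (below N) (λ v → ∑-cong (box N n) (λ vs → sym (ℤP.*-identityˡ _))) ⟩
  ∑ (below N) (λ v → ∑ (box N n) (λ vs → 1ℤ * (low vs k * g (v ∷ vs))))
    ≡⟨ interlace N (λ _ → 1ℤ) k g (AntiSym-total 0 t (alternant c) (alternant-anti s)) (Strict⇒Dominated k st) ⟩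
  ∑ (below N) (λ v → ∑ (box N n) (λ vs → 1ℤ * (int (v ∷ vs) k * g (v ∷ vs))))
    ≡⟨ ∑-cong (below N) (λ v → ∑-cong (box N n) (λ vs → ℤP.*-identityˡ _)) ⟩
  ∑ (below N) (λ v → ∑ (box N n) (λ vs → int (v ∷ vs) k * g (v ∷ vs)))
    ≡⟨ sym (∑-box N n _) ⟩
  ∑ (box N (suc n)) (λ l → int l k * g l) ∎
  where
  open ≡-Reasoning
  t : ℕ
  t = m ℕ.+ n ℕ.+ V.sum k
  g : Ogf (suc n)
  g v = eq (V.sum v) t * alternant c v

-- Expansion of a symmetric series with Kostka numbers

-- Kostka numbers by the branching rule; l = λ + (n − 1, …, 1, 0).
kostka : ℕ → Vec ℕ n → Vec ℕ n → ℤ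
kostka         N l []      = 1ℤ
kostka {suc n} N l (m ∷ α) = ∑ (box N n) (λ k → int l k * (eq (V.sum l) (m ℕ.+ n ℕ.+ V.sum k) * kostka N k α))

-- The size of (n - 1, ..., 1, 0), the amount by which l exceeds λ.
tri : ℕ → ℕ
tri zero    = zero
tri (suc n) = n ℕ.+ tri n

tri-sum : ∀ m n a t → m ℕ.+ n ℕ.+ (a ℕ.+ t) ≡ (m ℕ.+ a) ℕ.+ (n ℕ.+ t)
tri-sum = ℕSolver.solve-∀

kostka-size : ∀ N (l α : Vec ℕ n) → kostka N l α ≡ 0ℤ ⊎ V.sum l ≡ V.sum α ℕ.+ tri n
kostka-size N [] [] = inj₂ refl
kostka-size {suc n} N l (m ∷ α) with V.sum l ℕP.≟ (m ℕ.+ V.sum α) ℕ.+ (n ℕ.+ tri n)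
... | yes e = inj₂ e
... | no ne = inj₁ (∑-zero (box N n) term)
  where
  term : ∀ k → int l k * (eq (V.sum l) (m ℕ.+ n ℕ.+ V.sum k) * kostka N k α) ≡ 0ℤ
  term k with kostka-size N k α
  ... | inj₁ e = ≡.trans (cong (λ z → int l k * (eq (V.sum l) (m ℕ.+ n ℕ.+ V.sum k) * z)) e)
    (≡.trans (cong (int l k *_) (ℤP.*-zeroʳ (eq (V.sum l) (m ℕ.+ n ℕ.+ V.sum k)))) (ℤP.*-zeroʳ (int l k)))
  ... | inj₂ e = ≡.trans (cong (λ z → int l k * (z * kostka N k α))
      (eq-≢ (λ e′ → ne (≡.trans e′ (≡.trans (cong (m ℕ.+ n ℕ.+_) e) (tri-sum m n (V.sum α) (tri n)))))))
    (ℤP.*-zeroʳ (int l k))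

-- The slice of `c` at the exponent m of x₀ is symmetric in the other variables. Expanding it by
-- induction and rewriting its alternant by `alternant-slice` leaves the recursion of `kostka` once
-- the sum over l is taken outside.
schur-expansion : ∀ {N} (c : Ogf n) → Sym c → ∀ α → V.sum α ℕ.+ tri n ℕ.< N →
  c α ≡ ∑ (box N n) (λ l → strict l * (alternant c l * kostka N l α))
schur-expansion {zero} c s [] p = sym (≡.trans (ℤP.+-identityʳ _) (≡.trans (ℤP.*-identityˡ _) (ℤP.*-identityʳ _)))
schur-expansion {suc n} {N} c s (m ∷ α) p = begin
  c (m ∷ α)
    ≡⟨ schur-expansion (λ β → c (m ∷ β)) (λ k v → s (suc k) (m ∷ v)) α
         (ℕP.≤-<-trans (ℕP.≤-trans (ℕP.m≤n+m _ (m ℕ.+ n)) (ℕP.≤-reflexive (tri-sum m n (V.sum α) (tri n)))) p) ⟩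
  ∑ (box N n) (λ k → strict k * (alternant (λ β → c (m ∷ β)) k * kostka N k α))
    ≡⟨ ∑-cong (box N n) expand ⟩
  ∑ (box N n) (λ k → ∑ (box N (suc n)) (λ l → strict k * int l k * (eq (V.sum l) (m ℕ.+ n ℕ.+ V.sum k) * (alternant c l * kostka N k α))))
    ≡⟨ ∑-comm (box N n) (box N (suc n)) _ ⟩
  ∑ (box N (suc n)) (λ l → ∑ (box N n) (λ k → strict k * int l k * (eq (V.sum l) (m ℕ.+ n ℕ.+ V.sum k) * (alternant c l * kostka N k α))))
    ≡⟨ ∑-cong (box N (suc n)) (λ l → ≡.trans
         (∑-cong (box N n) (λ k → ≡.trans (cong (_* (eq (V.sum l) (m ℕ.+ n ℕ.+ V.sum k) * (alternant c l * kostka N k α))) (strict-int l k))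
           (lemma (strict l) (int l k) (eq (V.sum l) (m ℕ.+ n ℕ.+ V.sum k)) (alternant c l) (kostka N k α))))
         (≡.trans (∑-*ˡ (box N n) (strict l * alternant c l) _) (ℤP.*-assoc (strict l) (alternant c l) _))) ⟩
  ∑ (box N (suc n)) (λ l → strict l * (alternant c l * kostka N l (m ∷ α))) ∎
  where
  open ≡-Reasoning
  lemma : ∀ s i e a k → s * i * (e * (a * k)) ≡ s * a * (i * (e * k))
  lemma = solve-∀
  lemma′ : ∀ s i e a k → s * (i * (e * a) * k) ≡ s * i * (e * (a * k))
  lemma′ = solve-∀
  zeroˡ : ∀ {z} y → z ≡ 0ℤ → z * y ≡ 0ℤ
  zeroˡ y e = ≡.trans (cong (_* y) e) (ℤP.*-zeroˡ y)
  expand : ∀ k → strict k * (alternant (λ β → c (m ∷ β)) k * kostka N k α) ≡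
    ∑ (box N (suc n)) (λ l → strict k * int l k * (eq (V.sum l) (m ℕ.+ n ℕ.+ V.sum k) * (alternant c l * kostka N k α)))
  expand k with strict-cases k | kostka-size N k α
  ... | inj₁ e | _ = ≡.trans (zeroˡ _ e) (sym (∑-zero (box N (suc n)) (λ l → zeroˡ _ (zeroˡ (int l k) e))))
  ... | inj₂ _ | inj₁ e = ≡.trans
    (≡.trans (cong (λ z → strict k * (alternant (λ β → c (m ∷ β)) k * z)) e) (vanish₁ (strict k) (alternant (λ β → c (m ∷ β)) k)))
    (sym (∑-zero (box N (suc n)) (λ l → ≡.trans (cong (λ z → strict k * int l k * (eq (V.sum l) (m ℕ.+ n ℕ.+ V.sum k) * (alternant c l * z))) e)
      (vanish₂ (strict k) (int l k) (eq (V.sum l) (m ℕ.+ n ℕ.+ V.sum k)) (alternant c l)))))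
    where
    vanish₁ : ∀ a b → a * (b * 0ℤ) ≡ 0ℤ
    vanish₁ = solve-∀
    vanish₂ : ∀ a b c d → a * b * (c * (d * 0ℤ)) ≡ 0ℤ
    vanish₂ = solve-∀
  ... | inj₂ st | inj₂ e = ≡.trans
    (cong (λ z → strict k * (z * kostka N k α)) (alternant-slice c s m k st
      (subst (ℕ._< N) (sym (≡.trans (cong (m ℕ.+ n ℕ.+_) e) (tri-sum m n (V.sum α) (tri n)))) p)))
    (≡.trans (cong (strict k *_) (sym (∑-*ʳ (box N (suc n)) (kostka N k α) _)))
      (≡.trans (sym (∑-*ˡ (box N (suc n)) (strict k) _))
        (∑-cong (box N (suc n)) (λ l → lemma′ (strict k) (int l k) (eq (V.sum l) (m ℕ.+ n ℕ.+ V.sum k)) (alternant c l) (kostka N k α)))))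

-- Tableaux and the branching rule

ι : Bool → ℤ
ι true  = 1ℤ
ι false = 0ℤ

ι-∧ : ∀ a b → ι (a ∧ b) ≡ ι a * ι b
ι-∧ true  b = sym (ℤP.*-identityˡ (ι b))
ι-∧ false b = sym (ℤP.*-zeroˡ (ι b))

∑-tabulate : ∀ {m} (h : Fin m → A) (g : A → C) f → ∑ (tabulate (g ∘ h)) f ≡ ∑ (tabulate h) (f ∘ g)
∑-tabulate {m = zero}  h g f = refl
∑-tabulate {m = suc m} h g f = cong (f (g (h zero)) +_) (∑-tabulate (h ∘ suc) g f)

∑-tabulate-last : ∀ m (g : Fin (suc m) → A) f → ∑ (tabulate g) f ≡ ∑ (tabulate (g ∘ inject₁)) f + f (g (fromℕ m))
∑-tabulate-last zero    g f = ≡.trans (ℤP.+-identityʳ (f (g zero))) (sym (ℤP.+-identityˡ (f (g zero))))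
∑-tabulate-last (suc m) g f = ≡.trans (cong (f (g zero) +_) (∑-tabulate-last m (g ∘ suc) f)) (sym (ℤP.+-assoc (f (g zero)) _ _))

∑-allFin-last : ∀ n f → ∑ (allFin (suc n)) f ≡ ∑ (allFin n) (f ∘ inject₁) + f (fromℕ n)
∑-allFin-last n f = ≡.trans (∑-tabulate-last n id f) (cong (_+ f (fromℕ n)) (∑-tabulate id inject₁ f))

Row : ℕ → Set
Row n = List (Fin n)

∑-words : ∀ q (f : Row n → ℤ) → ∑ (words (suc q)) f ≡ ∑ (allFin n) (λ i → ∑ (words q) (f ∘ (i ∷_)))
∑-words {n} q f = ≡.trans (∑-concatMap (λ i → map (i ∷_) (words q)) (allFin n) f) (∑-cong (allFin n) (λ i → ∑-map (i ∷_) (words q) f))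

∑-words-cong : ∀ q {f g : Row n → ℤ} → (∀ r → length r ≡ q → f r ≡ g r) → ∑ (words q) f ≡ ∑ (words q) g
∑-words-cong zero    e = cong (_+ 0ℤ) (e [] refl)
∑-words-cong {n} (suc q) {f} {g} e = ≡.trans (∑-words q f)
  (≡.trans (∑-cong (allFin n) (λ i → ∑-words-cong q (λ r p → e (i ∷ r) (cong suc p)))) (sym (∑-words q g)))

∑-fillings : ∀ ℓ ρ (f : List (Row n) → ℤ) → ∑ (fillings (ℓ ∷ ρ)) f ≡ ∑ (words ℓ) (λ r → ∑ (fillings ρ) (f ∘ (r ∷_)))
∑-fillings ℓ ρ f = ≡.trans (∑-concatMap (λ r → map (r ∷_) (fillings ρ)) (words ℓ) f) (∑-cong (words ℓ) (λ r → ∑-map (r ∷_) (fillings ρ) f))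

splitSum : ℕ → (ℕ → ℕ → ℤ) → ℤ
splitSum zero    h = h 0 0
splitSum (suc ℓ) h = h 0 (suc ℓ) + splitSum ℓ (λ q p → h (suc q) p)

splitSum-cong : ∀ ℓ {h h′ : ℕ → ℕ → ℤ} → (∀ q p → q ℕ.+ p ≡ ℓ → h q p ≡ h′ q p) → splitSum ℓ h ≡ splitSum ℓ h′
splitSum-cong zero    e = e 0 0 refl
splitSum-cong (suc ℓ) e = cong₂ _+_ (e 0 (suc ℓ) refl) (splitSum-cong ℓ (λ q p s → e (suc q) p (cong suc s)))

splitSum-∑ : ∀ ℓ (xs : List A) (h : A → ℕ → ℕ → ℤ) → splitSum ℓ (λ q p → ∑ xs (λ y → h y q p)) ≡ ∑ xs (λ y → splitSum ℓ (h y))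
splitSum-∑ zero    xs h = refl
splitSum-∑ (suc ℓ) xs h = ≡.trans (cong (∑ xs (λ y → h y 0 (suc ℓ)) +_) (splitSum-∑ ℓ xs (λ y q p → h y (suc q) p))) (sym (∑-+ xs _ _))

splitSum-first : ∀ ℓ {h : ℕ → ℕ → ℤ} → (∀ q p → h (suc q) p ≡ 0ℤ) → splitSum ℓ h ≡ h 0 ℓ
splitSum-first zero    e = refl
splitSum-first (suc ℓ) {h} e = ≡.trans (cong (h 0 (suc ℓ) +_) (zeros ℓ {h} e)) (ℤP.+-identityʳ _)
  where
  zeros : ∀ ℓ {h : ℕ → ℕ → ℤ} → (∀ q p → h (suc q) p ≡ 0ℤ) → splitSum ℓ (λ q p → h (suc q) p) ≡ 0ℤ
  zeros zero    e = e 0 0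
  zeros (suc ℓ) {h} e = cong₂ _+_ (e 0 (suc ℓ)) (zeros ℓ {λ q p → h (suc q) p} (λ q p → e (suc q) p))

splitSum-* : ∀ ℓ c (h : ℕ → ℕ → ℤ) → splitSum ℓ (λ q p → c * h q p) ≡ c * splitSum ℓ h
splitSum-* zero    c h = refl
splitSum-* (suc ℓ) c h = ≡.trans (cong (c * h 0 (suc ℓ) +_) (splitSum-* ℓ c (λ q p → h (suc q) p))) (sym (ℤP.*-distribˡ-+ c (h 0 (suc ℓ)) _))

splitSum-below : ∀ ℓ {M} → ℓ ℕ.< M → ∀ (h : ℕ → ℕ → ℤ) → splitSum ℓ h ≡ ∑ (below M) (λ q → le q ℓ * h q (ℓ ℕ.∸ q))
splitSum-below zero {suc M} _ h = sym (≡.trans (cong₂ _+_ (ℤP.*-identityˡ (h 0 0))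
  (≡.trans (∑-map suc (below M) _) (∑-zero (below M) (λ q → ℤP.*-zeroˡ (h (suc q) (zero ℕ.∸ suc q)))))) (ℤP.+-identityʳ _))
splitSum-below (suc ℓ) {suc M} (s≤s p) h = sym (cong₂ _+_ (ℤP.*-identityˡ (h 0 (suc ℓ)))
  (≡.trans (∑-map suc (below M) _) (sym (splitSum-below ℓ p (λ q p → h (suc q) p)))))

-- A weakly increasing row is a row in the smaller letters followed by copies of the largest letter.

extend : Row n → ℕ → Row (suc n)
extend r p = map inject₁ r ++ replicate p (fromℕ _)

hd : Fin n → Row n → ℤ
hd i []      = 1ℤ
hd i (b ∷ r) = ι (toℕ i ≤ᵇ toℕ b)

rowWeak-∷ : ∀ (i : Fin n) r → ι (rowWeak (i ∷ r)) ≡ ι (rowWeak r) * hd i r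
rowWeak-∷ i []      = refl
rowWeak-∷ i (b ∷ r) = ≡.trans (ι-∧ (toℕ i ≤ᵇ toℕ b) (rowWeak (b ∷ r))) (ℤP.*-comm (ι (toℕ i ≤ᵇ toℕ b)) _)

ι-≤ᵇ-yes : ∀ {m n} → m ℕ.≤ n → ι (m ≤ᵇ n) ≡ 1ℤ
ι-≤ᵇ-yes {m} {n} p with m ≤ᵇ n | ℕP.≤⇒≤ᵇ p
... | true | _ = refl

ι-≤ᵇ-no : ∀ {m n} → n ℕ.< m → ι (m ≤ᵇ n) ≡ 0ℤ
ι-≤ᵇ-no {m} {n} p with m ≤ᵇ n | ℕP.≤ᵇ⇒≤ m n
... | true  | h = ⊥-elim (ℕP.<⇒≱ p (h tt))
... | false | _ = refl

ι-<ᵇ-yes : ∀ {m n} → m ℕ.< n → ι (m <ᵇ n) ≡ 1ℤ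
ι-<ᵇ-yes {m} {n} p with m <ᵇ n | ℕP.<⇒<ᵇ p
... | true | _ = refl

ι-<ᵇ-no : ∀ {m n} → n ℕ.≤ m → ι (m <ᵇ n) ≡ 0ℤ
ι-<ᵇ-no {m} {n} p with m <ᵇ n | ℕP.<ᵇ⇒< m n
... | true  | h = ⊥-elim (ℕP.<⇒≱ (h tt) p)
... | false | _ = refl

inject₁<max : ∀ (j : Fin n) → toℕ (inject₁ j) ℕ.< toℕ (fromℕ n)
inject₁<max {n} j = ≡.subst₂ ℕ._<_ (sym (FinP.toℕ-inject₁ j)) (sym (FinP.toℕ-fromℕ n)) (FinP.toℕ<n j)

hd-inject₁ : ∀ (j : Fin n) r p → hd (inject₁ j) (extend r p) ≡ hd j r
hd-inject₁ j []      zero    = refl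
hd-inject₁ j []      (suc p) = ι-≤ᵇ-yes (ℕP.<⇒≤ (inject₁<max j))
hd-inject₁ j (b ∷ r) p       = cong₂ (λ s t → ι (s ≤ᵇ t)) (FinP.toℕ-inject₁ j) (FinP.toℕ-inject₁ b)

hd-max-[] : ∀ n p → hd (fromℕ n) (extend [] p) ≡ 1ℤ
hd-max-[] n zero    = refl
hd-max-[] n (suc p) = ι-≤ᵇ-yes {toℕ (fromℕ n)} ℕP.≤-refl

hd-max-∷ : ∀ (b : Fin n) r p → hd (fromℕ n) (extend (b ∷ r) p) ≡ 0ℤ
hd-max-∷ b r p = ι-≤ᵇ-no (inject₁<max b)

-- By the first letter: if it is the largest one, the whole row consists of it and q = 0; any other
-- letter lengthens the part in smaller letters.
∑-rows : ∀ ℓ (Ψ : Row (suc n) → ℤ) →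
  ∑ (words ℓ) (λ r → ι (rowWeak r) * Ψ r) ≡ splitSum ℓ (λ q p → ∑ (words q) (λ r → ι (rowWeak r) * Ψ (extend r p)))
∑-rows zero    Ψ = refl
∑-rows {n} (suc ℓ) Ψ = begin
  ∑ (words (suc ℓ)) (λ r → ι (rowWeak r) * Ψ r)
    ≡⟨ ∑-words ℓ (λ r → ι (rowWeak r) * Ψ r) ⟩
  ∑ (allFin (suc n)) (λ i → ∑ (words ℓ) (λ r → ι (rowWeak (i ∷ r)) * Ψ (i ∷ r)))
    ≡⟨ ∑-cong (allFin (suc n)) (λ i → ≡.trans
         (∑-cong (words ℓ) (λ r → ≡.trans (cong (_* Ψ (i ∷ r)) (rowWeak-∷ i r)) (ℤP.*-assoc (ι (rowWeak r)) (hd i r) _)))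
         (∑-rows ℓ (λ r → hd i r * Ψ (i ∷ r)))) ⟩
  ∑ (allFin (suc n)) (λ i → splitSum ℓ (h i))
    ≡⟨ ∑-allFin-last n (λ i → splitSum ℓ (h i)) ⟩
  ∑ (allFin n) (λ j → splitSum ℓ (h (inject₁ j))) + splitSum ℓ (h (fromℕ n))
    ≡⟨ cong₂ _+_ (≡.trans (sym (splitSum-∑ ℓ (allFin n) (λ j → h (inject₁ j)))) (splitSum-cong ℓ (λ q p _ → small q p))) largest ⟩
  splitSum ℓ (λ q p → ∑ (words (suc q)) (λ r → ι (rowWeak r) * Ψ (extend r p))) + ∑ (words 0) (λ r → ι (rowWeak r) * Ψ (extend r (suc ℓ)))
    ≡⟨ ℤP.+-comm (splitSum ℓ _) _ ⟩
  splitSum (suc ℓ) (λ q p → ∑ (words q) (λ r → ι (rowWeak r) * Ψ (extend r p))) ∎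
  where
  open ≡-Reasoning
  h : Fin (suc n) → ℕ → ℕ → ℤ
  h i q p = ∑ (words q) (λ r → ι (rowWeak r) * (hd i (extend r p) * Ψ (i ∷ extend r p)))
  small : ∀ q p → ∑ (allFin n) (λ j → h (inject₁ j) q p) ≡ ∑ (words (suc q)) (λ r → ι (rowWeak r) * Ψ (extend r p))
  small q p = sym (≡.trans (∑-words q (λ r → ι (rowWeak r) * Ψ (extend r p))) (∑-cong (allFin n) (λ j → ∑-cong (words q) (λ r →
    ≡.trans (cong (_* Ψ (extend (j ∷ r) p)) (≡.trans (rowWeak-∷ j r) (cong (ι (rowWeak r) *_) (sym (hd-inject₁ j r p)))))
            (ℤP.*-assoc (ι (rowWeak r)) (hd (inject₁ j) (extend r p)) _)))))
  largest : splitSum ℓ (h (fromℕ n)) ≡ ∑ (words 0) (λ r → ι (rowWeak r) * Ψ (extend r (suc ℓ)))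
  largest = ≡.trans (splitSum-first ℓ (λ q p → ≡.trans (∑-words q (λ r → ι (rowWeak r) * (hd (fromℕ n) (extend r p) * Ψ (fromℕ n ∷ extend r p)))) (∑-zero (allFin n) (λ b → ∑-zero (words q) (λ r →
      ≡.trans (cong (λ z → ι (rowWeak (b ∷ r)) * (z * Ψ (fromℕ n ∷ extend (b ∷ r) p))) (hd-max-∷ b r p))
        (≡.trans (cong (ι (rowWeak (b ∷ r)) *_) (ℤP.*-zeroˡ (Ψ (fromℕ n ∷ extend (b ∷ r) p)))) (ℤP.*-zeroʳ (ι (rowWeak (b ∷ r))))))))))
    (cong (λ z → 1ℤ * z + 0ℤ) (≡.trans (cong (_* Ψ (fromℕ n ∷ extend [] ℓ)) (hd-max-[] n ℓ)) (ℤP.*-identityˡ _)))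

colStrict-[] : ∀ (r : Row n) → colStrict r [] ≡ true
colStrict-[] []      = refl
colStrict-[] (a ∷ r) = refl

-- Nothing can stand below a largest letter, and a largest letter can stand below every smaller one:
-- the lower row has to fit under the small part of the upper row.
colStrict-extend : ∀ (r s : Row n) p p′ → length s ℕ.+ p′ ℕ.≤ length r ℕ.+ p →
  ι (colStrict (extend r p) (extend s p′)) ≡ le (length s ℕ.+ p′) (length r) * ι (colStrict r s)
colStrict-extend (a ∷ r) (b ∷ s) p p′ (s≤s h) = begin
  ι ((toℕ (inject₁ a) <ᵇ toℕ (inject₁ b)) ∧ colStrict (extend r p) (extend s p′))
    ≡⟨ ι-∧ (toℕ (inject₁ a) <ᵇ toℕ (inject₁ b)) _ ⟩
  ι (toℕ (inject₁ a) <ᵇ toℕ (inject₁ b)) * ι (colStrict (extend r p) (extend s p′))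
    ≡⟨ cong₂ (λ y z → ι y * z) (cong₂ _<ᵇ_ (FinP.toℕ-inject₁ a) (FinP.toℕ-inject₁ b)) (colStrict-extend r s p p′ h) ⟩
  ι (toℕ a <ᵇ toℕ b) * (le (length s ℕ.+ p′) (length r) * ι (colStrict r s))
    ≡⟨ lemma (ι (toℕ a <ᵇ toℕ b)) (le (length s ℕ.+ p′) (length r)) (ι (colStrict r s)) ⟩
  le (length s ℕ.+ p′) (length r) * (ι (toℕ a <ᵇ toℕ b) * ι (colStrict r s))
    ≡⟨ cong (le (length s ℕ.+ p′) (length r) *_) (sym (ι-∧ (toℕ a <ᵇ toℕ b) (colStrict r s))) ⟩
  le (length s ℕ.+ p′) (length r) * ι ((toℕ a <ᵇ toℕ b) ∧ colStrict r s) ∎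
  where
  open ≡-Reasoning
  lemma : ∀ a b c → a * (b * c) ≡ b * (a * c)
  lemma = solve-∀
colStrict-extend (a ∷ r) [] p zero     h = refl
colStrict-extend {n} (a ∷ r) [] p (suc p′) (s≤s h) = ≡.trans (ι-∧ (toℕ (inject₁ a) <ᵇ toℕ (fromℕ n)) (colStrict (extend r p) (extend [] p′)))
  (≡.trans (cong₂ _*_ (ι-<ᵇ-yes (inject₁<max a)) (colStrict-extend r [] p p′ h))
    (≡.trans (ℤP.*-identityˡ _) (cong (λ z → le p′ (length r) * ι z) (colStrict-[] r))))
colStrict-extend []      [] p       zero    h = cong ι (colStrict-[] (replicate p (fromℕ _)))
colStrict-extend {n} []  [] (suc p) (suc p′) h = ≡.trans (ι-∧ (toℕ (fromℕ n) <ᵇ toℕ (fromℕ n)) (colStrict (extend {n} [] p) (extend {n} [] p′)))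
  (≡.trans (cong (_* ι (colStrict (extend {n} [] p) (extend {n} [] p′))) (ι-<ᵇ-no {toℕ (fromℕ n)} ℕP.≤-refl)) (ℤP.*-zeroˡ (ι (colStrict (extend {n} [] p) (extend {n} [] p′)))))
colStrict-extend {n} [] (b ∷ s) (suc p) p′ h = ≡.trans (ι-∧ (toℕ (fromℕ n) <ᵇ toℕ (inject₁ b)) (colStrict (extend {n} [] p) (extend s p′)))
  (≡.trans (cong (_* ι (colStrict (extend {n} [] p) (extend s p′))) (ι-<ᵇ-no (ℕP.<⇒≤ (inject₁<max b)))) (ℤP.*-zeroˡ (ι (colStrict (extend {n} [] p) (extend s p′)))))

rowWeight : Row n → Mono n
rowWeight r = foldr (λ a m → var a *M m) oneM r

*M-identityˡ : ∀ (m : Mono n) → oneM *M m ≡ m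
*M-identityˡ = VP.zipWith-identityˡ (λ _ → refl)

*M-assoc : ∀ (a b c : Mono n) → (a *M b) *M c ≡ a *M (b *M c)
*M-assoc = VP.zipWith-assoc ℕP.+-assoc

weight-∷ : ∀ (r : Row n) T → weight (r ∷ T) ≡ rowWeight r *M weight T
weight-∷ []      T = sym (*M-identityˡ (weight T))
weight-∷ (a ∷ r) T = ≡.trans (cong (var a *M_) (weight-∷ r T)) (sym (*M-assoc (var a) (rowWeight r) (weight T)))

*M-∷ʳ : ∀ (u v : Mono n) a b → (u ∷ʳ a) *M (v ∷ʳ b) ≡ (u *M v) ∷ʳ (a ℕ.+ b)
*M-∷ʳ []      []      a b = refl
*M-∷ʳ (c ∷ u) (d ∷ v) a b = cong (c ℕ.+ d ∷_) (*M-∷ʳ u v a b)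

oneM-∷ʳ : ∀ n → oneM {suc n} ≡ oneM {n} ∷ʳ 0
oneM-∷ʳ zero    = refl
oneM-∷ʳ (suc n) = cong (0 ∷_) (oneM-∷ʳ n)

var-zero : ∀ n → var {suc n} zero ≡ 1 ∷ oneM
var-zero n = cong (1 ∷_) (zeros n)
  where
  zeros : ∀ n → V.tabulate {n = n} (λ _ → 0) ≡ V.replicate n 0
  zeros zero    = refl
  zeros (suc n) = cong (0 ∷_) (zeros n)

var-inject₁ : ∀ (i : Fin n) → var (inject₁ i) ≡ var i ∷ʳ 0
var-inject₁ {suc n} zero    = ≡.trans (var-zero (suc n)) (≡.trans (cong (1 ∷_) (oneM-∷ʳ n)) (cong (_∷ʳ 0) (sym (var-zero n))))
var-inject₁ {suc n} (suc i) = cong (0 ∷_) (var-inject₁ i)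

var-max : ∀ n → var (fromℕ n) ≡ oneM {n} ∷ʳ 1
var-max zero    = refl
var-max (suc n) = cong (0 ∷_) (var-max n)

rowWeight-extend : ∀ (r : Row n) p → rowWeight (extend r p) ≡ rowWeight r ∷ʳ p
rowWeight-extend {n} [] zero    = oneM-∷ʳ n
rowWeight-extend {n} [] (suc p) = ≡.trans (cong₂ _*M_ (var-max n) (rowWeight-extend [] p))
  (≡.trans (*M-∷ʳ oneM oneM 1 p) (cong (_∷ʳ suc p) (*M-identityˡ oneM)))
rowWeight-extend (a ∷ r) p = ≡.trans (cong₂ _*M_ (var-inject₁ a) (rowWeight-extend r p)) (*M-∷ʳ (var a) (rowWeight r) 0 p)

schurSum : ∀ n → List ℕ → (Mono n → ℤ) → ℤ
schurSum n ρ f = ∑ (fillings ρ) (λ T → ι (isSSYT T) * f (weight T))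

colHead : Row n → List (Row n) → Bool
colHead r []      = true
colHead r (s ∷ _) = colStrict r s

-- The sum over the tableaux that can be placed under the row `r`. Unlike `schurSum` it can be
-- peeled row by row.
belowSum : ∀ n → List ℕ → Row n → (Mono n → ℤ) → ℤ
belowSum n ρ r f = ∑ (fillings ρ) (λ T → ι (isSSYT T) * (ι (colHead r T) * f (weight T)))

isSSYT-∷ : ∀ (r : Row n) T → ι (isSSYT (r ∷ T)) ≡ ι (rowWeak r) * (ι (isSSYT T) * ι (colHead r T))
isSSYT-∷ r []      = sym (ℤP.*-identityʳ _)
isSSYT-∷ r (s ∷ T) = ≡.trans (ι-∧ (rowWeak r) _) (cong (ι (rowWeak r) *_)
  (≡.trans (ι-∧ (colStrict r s) (isSSYT (s ∷ T))) (ℤP.*-comm (ι (colStrict r s)) _)))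

schurSum-∷ : ∀ ℓ ρ (f : Mono n → ℤ) →
  schurSum n (ℓ ∷ ρ) f ≡ ∑ (words ℓ) (λ r → ι (rowWeak r) * belowSum n ρ r (λ α → f (rowWeight r *M α)))
schurSum-∷ ℓ ρ f = ≡.trans (∑-fillings ℓ ρ _) (∑-cong (words ℓ) (λ r → ≡.trans
  (∑-cong (fillings ρ) (λ T → ≡.trans (cong₂ (λ y z → y * f z) (isSSYT-∷ r T) (weight-∷ r T))
    (lemma (ι (rowWeak r)) (ι (isSSYT T)) (ι (colHead r T)) _)))
  (∑-*ˡ (fillings ρ) (ι (rowWeak r)) _)))
  where
  lemma : ∀ a b c d → a * (b * c) * d ≡ a * (b * (c * d))
  lemma = solve-∀

belowSum-∷ : ∀ ℓ ρ (r : Row n) (f : Mono n → ℤ) →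
  belowSum n (ℓ ∷ ρ) r f ≡ ∑ (words ℓ) (λ s → ι (rowWeak s) * (ι (colStrict r s) * belowSum n ρ s (λ α → f (rowWeight s *M α))))
belowSum-∷ ℓ ρ r f = ≡.trans (∑-fillings ℓ ρ _) (∑-cong (words ℓ) (λ s → ≡.trans
  (∑-cong (fillings ρ) (λ T → ≡.trans (cong₂ (λ y z → y * (ι (colStrict r s) * f z)) (isSSYT-∷ s T) (weight-∷ s T))
    (lemma (ι (rowWeak s)) (ι (isSSYT T)) (ι (colHead s T)) (ι (colStrict r s)) _)))
  (≡.trans (∑-*ˡ (fillings ρ) (ι (rowWeak s)) _) (cong (ι (rowWeak s) *_) (∑-*ˡ (fillings ρ) (ι (colStrict r s)) _)))))
  where
  lemma : ∀ a b c d e → a * (b * c) * (d * e) ≡ a * (d * (b * (c * e)))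
  lemma = solve-∀

-- Sum over the shapes σ interlacing ρ below a row with q small letters, and the number of boxes removed
branch : List ℕ → ℕ → (List ℕ → ℕ → ℤ) → ℤ
branch []      q g = g [] 0
branch (ℓ ∷ ρ) q g = le ℓ q * splitSum ℓ (λ q′ p′ → branch ρ q′ (λ σ s → g (q′ ∷ σ) (p′ ℕ.+ s)))

Interlaced : List ℕ → ℕ → List ℕ → Set
Interlaced []      q []       = ⊤
Interlaced []      q (_ ∷ _)  = ⊥
Interlaced (ℓ ∷ ρ) q []       = ⊥
Interlaced (ℓ ∷ ρ) q (q′ ∷ σ) = ℓ ℕ.≤ q × q′ ℕ.≤ ℓ × Interlaced ρ q′ σ

branch-cong : ∀ ρ q {g g′ : List ℕ → ℕ → ℤ} → (∀ σ s → Interlaced ρ q σ → g σ s ≡ g′ σ s) → branch ρ q g ≡ branch ρ q g′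
branch-cong []      q e = e [] 0 tt
branch-cong (ℓ ∷ ρ) q e with le-cases ℓ q
... | inj₁ (z , _) = ≡.trans (vanish z _) (sym (vanish z _))
  where
  vanish : ∀ {y} → y ≡ 0ℤ → ∀ w → y * w ≡ 0ℤ
  vanish refl w = ℤP.*-zeroˡ w
... | inj₂ (_ , p) = cong (le ℓ q *_) (splitSum-cong ℓ (λ q′ p′ s → branch-cong ρ q′ (λ σ t i →
  e (q′ ∷ σ) (p′ ℕ.+ t) (p , ℕP.m+n≤o⇒m≤o q′ (ℕP.≤-reflexive s) , i))))

branch-∑ : ∀ ρ q (xs : List A) (g : A → List ℕ → ℕ → ℤ) → branch ρ q (λ σ s → ∑ xs (λ y → g y σ s)) ≡ ∑ xs (λ y → branch ρ q (g y))
branch-∑ []      q xs g = refl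
branch-∑ (ℓ ∷ ρ) q xs g = ≡.trans
  (cong (le ℓ q *_) (≡.trans (splitSum-cong ℓ (λ q′ p′ _ → branch-∑ ρ q′ xs (λ y σ s → g y (q′ ∷ σ) (p′ ℕ.+ s)))) (splitSum-∑ ℓ xs _)))
  (sym (∑-*ˡ xs (le ℓ q) _))

branch-* : ∀ ρ q c (g : List ℕ → ℕ → ℤ) → branch ρ q (λ σ s → c * g σ s) ≡ c * branch ρ q g
branch-* []      q c g = refl
branch-* (ℓ ∷ ρ) q c g = ≡.trans
  (cong (le ℓ q *_) (≡.trans (splitSum-cong ℓ (λ q′ p′ _ → branch-* ρ q′ c (λ σ s → g (q′ ∷ σ) (p′ ℕ.+ s)))) (splitSum-* ℓ c _)))
  (lemma (le ℓ q) c _)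
  where
  lemma : ∀ a b c → a * (b * c) ≡ b * (a * c)
  lemma = solve-∀

Decr : List ℕ → Set
Decr []          = ⊤
Decr (a ∷ [])    = ⊤
Decr (a ∷ b ∷ v) = b ℕ.≤ a × Decr (b ∷ v)

belowSum-branch : ∀ ρ (r : Row n) p (f : Mono (suc n) → ℤ) → Decr (length r ℕ.+ p ∷ ρ) →
  belowSum (suc n) ρ (extend r p) f ≡ branch ρ (length r) (λ σ s → belowSum n σ r (λ α → f (α ∷ʳ s)))

-- Proved mutually with `belowSum-branch`. The weight κ is the condition imposed from above: column
-- strictness for an inner row, 1 for the top row. Extending the row by largest letters multiplies
-- it by κ₀.
rowSum-branch : ∀ ℓ ρ (κ : Row (suc n) → ℤ) (κ₀ : ℤ) (κ′ : Row n → ℤ) →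
  (∀ r p → length r ℕ.+ p ≡ ℓ → κ (extend r p) ≡ κ₀ * κ′ r) → Decr (ℓ ∷ ρ) → ∀ (f : Mono (suc n) → ℤ) →
  ∑ (words ℓ) (λ r → ι (rowWeak r) * (κ r * belowSum (suc n) ρ r (λ α → f (rowWeight r *M α)))) ≡
  κ₀ * splitSum ℓ (λ q p → branch ρ q (λ σ s →
    ∑ (words q) (λ r → ι (rowWeak r) * (κ′ r * belowSum n σ r (λ α → f ((rowWeight r *M α) ∷ʳ (p ℕ.+ s)))))))
rowSum-branch {n} ℓ ρ κ κ₀ κ′ e d f = begin
  ∑ (words ℓ) (λ r → ι (rowWeak r) * (κ r * belowSum (suc n) ρ r (λ α → f (rowWeight r *M α))))
    ≡⟨ ∑-rows ℓ _ ⟩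
  splitSum ℓ (λ q p → ∑ (words q) (λ r → ι (rowWeak r) * (κ (extend r p) * belowSum (suc n) ρ (extend r p) (λ α → f (rowWeight (extend r p) *M α)))))
    ≡⟨ splitSum-cong ℓ (λ q p s → ≡.trans (∑-words-cong q (λ r t → term q p s r t)) (≡.trans (∑-*ˡ (words q) κ₀ _) (cong (κ₀ *_) (sym (branch-∑ ρ q (words q) _))))) ⟩
  splitSum ℓ (λ q p → κ₀ * branch ρ q (λ σ s → ∑ (words q) (λ r → ι (rowWeak r) * (κ′ r * belowSum n σ r (λ α → f ((rowWeight r *M α) ∷ʳ (p ℕ.+ s)))))))
    ≡⟨ splitSum-* ℓ κ₀ _ ⟩
  κ₀ * splitSum ℓ (λ q p → branch ρ q (λ σ s → ∑ (words q) (λ r → ι (rowWeak r) * (κ′ r * belowSum n σ r (λ α → f ((rowWeight r *M α) ∷ʳ (p ℕ.+ s))))))) ∎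
  where
  open ≡-Reasoning
  lemma : ∀ a b c d → a * (b * c * d) ≡ b * (a * (c * d))
  lemma = solve-∀
  term : ∀ q p → q ℕ.+ p ≡ ℓ → ∀ r → length r ≡ q →
    ι (rowWeak r) * (κ (extend r p) * belowSum (suc n) ρ (extend r p) (λ α → f (rowWeight (extend r p) *M α))) ≡
    κ₀ * branch ρ q (λ σ s → ι (rowWeak r) * (κ′ r * belowSum n σ r (λ α → f ((rowWeight r *M α) ∷ʳ (p ℕ.+ s)))))
  term _ p s r refl = begin
    ι (rowWeak r) * (κ (extend r p) * belowSum (suc n) ρ (extend r p) (λ α → f (rowWeight (extend r p) *M α)))
      ≡⟨ cong₂ (λ y z → ι (rowWeak r) * (y * z)) (e r p s) (belowSum-branch ρ r p (λ α → f (rowWeight (extend r p) *M α)) (subst (λ ℓ → Decr (ℓ ∷ ρ)) (sym s) d)) ⟩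
    ι (rowWeak r) * (κ₀ * κ′ r * branch ρ (length r) (λ σ t → belowSum n σ r (λ α → f (rowWeight (extend r p) *M (α ∷ʳ t)))))
      ≡⟨ lemma (ι (rowWeak r)) κ₀ (κ′ r) _ ⟩
    κ₀ * (ι (rowWeak r) * (κ′ r * branch ρ (length r) (λ σ t → belowSum n σ r (λ α → f (rowWeight (extend r p) *M (α ∷ʳ t))))))
      ≡⟨ cong (κ₀ *_) (sym (≡.trans (branch-* ρ (length r) (ι (rowWeak r)) _) (cong (ι (rowWeak r) *_) (branch-* ρ (length r) (κ′ r) _)))) ⟩
    κ₀ * branch ρ (length r) (λ σ t → ι (rowWeak r) * (κ′ r * belowSum n σ r (λ α → f (rowWeight (extend r p) *M (α ∷ʳ t)))))
      ≡⟨ cong (κ₀ *_) (branch-cong ρ (length r) (λ σ t _ → cong (λ z → ι (rowWeak r) * (κ′ r * z))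
           (∑-cong (fillings σ) (λ T → cong (λ z → ι (isSSYT T) * (ι (colHead r T) * f z))
             (≡.trans (cong (_*M (weight T ∷ʳ t)) (rowWeight-extend r p)) (*M-∷ʳ (rowWeight r) (weight T) p t)))))) ⟩
    κ₀ * branch ρ (length r) (λ σ t → ι (rowWeak r) * (κ′ r * belowSum n σ r (λ α → f ((rowWeight r *M α) ∷ʳ (p ℕ.+ t))))) ∎

belowSum-branch {n} [] r p f d = cong (λ z → 1ℤ * (1ℤ * f z) + 0ℤ) (oneM-∷ʳ n)
belowSum-branch {n} (ℓ ∷ ρ) r p f (h , d) = begin
  belowSum (suc n) (ℓ ∷ ρ) (extend r p) f
    ≡⟨ belowSum-∷ ℓ ρ (extend r p) f ⟩
  ∑ (words ℓ) (λ s → ι (rowWeak s) * (ι (colStrict (extend r p) s) * belowSum (suc n) ρ s (λ α → f (rowWeight s *M α))))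
    ≡⟨ rowSum-branch ℓ ρ (λ s → ι (colStrict (extend r p) s)) (le ℓ (length r)) (λ s → ι (colStrict r s))
         (λ { s p′ refl → colStrict-extend r s p p′ h }) d f ⟩
  le ℓ (length r) * splitSum ℓ (λ q p → branch ρ q (λ σ s →
    ∑ (words q) (λ s′ → ι (rowWeak s′) * (ι (colStrict r s′) * belowSum n σ s′ (λ α → f ((rowWeight s′ *M α) ∷ʳ (p ℕ.+ s)))))))
    ≡⟨ cong (le ℓ (length r) *_) (splitSum-cong ℓ (λ q p _ → branch-cong ρ q (λ σ s _ → sym (belowSum-∷ q σ r (λ α → f (α ∷ʳ (p ℕ.+ s))))))) ⟩
  le ℓ (length r) * splitSum ℓ (λ q p → branch ρ q (λ σ s → belowSum n (q ∷ σ) r (λ α → f (α ∷ʳ (p ℕ.+ s))))) ∎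
  where open ≡-Reasoning

schurSum-branch : ∀ ℓ ρ (f : Mono (suc n) → ℤ) → Decr (ℓ ∷ ρ) →
  schurSum (suc n) (ℓ ∷ ρ) f ≡ splitSum ℓ (λ q p → branch ρ q (λ σ s → schurSum n (q ∷ σ) (λ α → f (α ∷ʳ (p ℕ.+ s)))))
schurSum-branch {n} ℓ ρ f d = begin
  schurSum (suc n) (ℓ ∷ ρ) f
    ≡⟨ schurSum-∷ ℓ ρ f ⟩
  ∑ (words ℓ) (λ r → ι (rowWeak r) * belowSum (suc n) ρ r (λ α → f (rowWeight r *M α)))
    ≡⟨ ∑-cong (words ℓ) (λ r → cong (ι (rowWeak r) *_) (sym (ℤP.*-identityˡ (belowSum (suc n) ρ r (λ α → f (rowWeight r *M α)))))) ⟩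
  ∑ (words ℓ) (λ r → ι (rowWeak r) * (1ℤ * belowSum (suc n) ρ r (λ α → f (rowWeight r *M α))))
    ≡⟨ rowSum-branch ℓ ρ (λ _ → 1ℤ) 1ℤ (λ _ → 1ℤ) (λ _ _ _ → refl) d f ⟩
  1ℤ * splitSum ℓ (λ q p → branch ρ q (λ σ s →
    ∑ (words q) (λ r → ι (rowWeak r) * (1ℤ * belowSum n σ r (λ α → f ((rowWeight r *M α) ∷ʳ (p ℕ.+ s)))))))
    ≡⟨ ℤP.*-identityˡ _ ⟩
  splitSum ℓ (λ q p → branch ρ q (λ σ s →
    ∑ (words q) (λ r → ι (rowWeak r) * (1ℤ * belowSum n σ r (λ α → f ((rowWeight r *M α) ∷ʳ (p ℕ.+ s)))))))
    ≡⟨ splitSum-cong ℓ (λ q p _ → branch-cong ρ q (λ σ s _ → ≡.trans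
         (∑-cong (words q) (λ r → cong (ι (rowWeak r) *_) (ℤP.*-identityˡ (belowSum n σ r (λ α → f ((rowWeight r *M α) ∷ʳ (p ℕ.+ s))))))) (sym (schurSum-∷ q σ (λ α → f (α ∷ʳ (p ℕ.+ s))))))) ⟩
  splitSum ℓ (λ q p → branch ρ q (λ σ s → schurSum n (q ∷ σ) (λ α → f (α ∷ʳ (p ℕ.+ s))))) ∎
  where open ≡-Reasoning

-- Coefficients of Schur polynomials are Kostka numbers

eqV : Vec ℕ n → Vec ℕ n → ℤ
eqV []      []      = 1ℤ
eqV (a ∷ u) (b ∷ v) = eq a b * eqV u v

eqV-refl : ∀ (u : Vec ℕ n) → eqV u u ≡ 1ℤ
eqV-refl []      = refl
eqV-refl (a ∷ u) = cong₂ _*_ (eq-refl a) (eqV-refl u)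

eqV-≢ : ∀ {u v : Vec ℕ n} → u ≢ v → eqV u v ≡ 0ℤ
eqV-≢ {u = []}    {[]}    ne = ⊥-elim (ne refl)
eqV-≢ {u = a ∷ u} {b ∷ v} ne with a ℕP.≟ b
... | yes refl = ≡.trans (cong (eq a a *_) (eqV-≢ (ne ∘ cong (a ∷_)))) (ℤP.*-zeroʳ (eq a a))
... | no a≢b   = ≡.trans (cong (_* eqV u v) (eq-≢ a≢b)) (ℤP.*-zeroˡ (eqV u v))

eqV-∷ʳ : ∀ (u v : Vec ℕ n) a b → eqV (u ∷ʳ a) (v ∷ʳ b) ≡ eqV u v * eq a b
eqV-∷ʳ []      []      a b = ℤP.*-comm (eq a b) 1ℤ
eqV-∷ʳ (c ∷ u) (d ∷ v) a b = ≡.trans (cong (eq c d *_) (eqV-∷ʳ u v a b)) (sym (ℤP.*-assoc (eq c d) (eqV u v) (eq a b)))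

coeff-∑ : ∀ α (p : Poly n) → ℤ.+ coeff α p ≡ ∑ p (λ β → eqV β α)
coeff-∑ α []      = refl
coeff-∑ α (β ∷ p) with VP.≡-dec ℕ._≟_ β α
... | yes refl = cong₂ _+_ (sym (eqV-refl β)) (coeff-∑ α p)
... | no ne    = ≡.trans (coeff-∑ α p) (sym (≡.trans (cong (_+ ∑ p (λ β → eqV β α)) (eqV-≢ ne)) (ℤP.+-identityˡ _)))

∑-filterᵇ : ∀ (b : A → Bool) xs (f : A → ℤ) → ∑ (filterᵇ b xs) f ≡ ∑ xs (λ y → ι (b y) * f y)
∑-filterᵇ b []       f = refl
∑-filterᵇ b (y ∷ xs) f with b y
... | true  = cong₂ _+_ (sym (ℤP.*-identityˡ (f y))) (∑-filterᵇ b xs f)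
... | false = ≡.trans (∑-filterᵇ b xs f) (sym (≡.trans (cong (_+ ∑ xs (λ y → ι (b y) * f y)) (ℤP.*-zeroˡ (f y))) (ℤP.+-identityˡ _)))

∑-schur : ∀ n ρ f → ∑ (schur n ρ) f ≡ schurSum n ρ f
∑-schur n ρ f = ≡.trans (∑-map weight (filterᵇ isSSYT (fillings ρ)) f) (∑-filterᵇ isSSYT (fillings ρ) (f ∘ weight))

∑-fillings-∷ʳ : ∀ ρ (f : List (Row n) → ℤ) → ∑ (fillings (ρ ++ [ 0 ])) f ≡ ∑ (fillings ρ) (λ T → f (T ++ [ [] ]))
∑-fillings-∷ʳ []      f = refl
∑-fillings-∷ʳ (ℓ ∷ ρ) f = ≡.trans (∑-fillings ℓ (ρ ++ [ 0 ]) f)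
  (≡.trans (∑-cong (words ℓ) (λ r → ∑-fillings-∷ʳ ρ (f ∘ (r ∷_)))) (sym (∑-fillings ℓ ρ (λ T → f (T ++ [ [] ])))))

isSSYT-∷ʳ : ∀ (T : List (Row n)) → isSSYT (T ++ [ [] ]) ≡ isSSYT T
isSSYT-∷ʳ []          = refl
isSSYT-∷ʳ (r ∷ [])    = ≡.trans (cong (λ b → rowWeak r ∧ b ∧ true) (colStrict-[] r)) (BoolP.∧-identityʳ (rowWeak r))
isSSYT-∷ʳ (r ∷ s ∷ T) = cong (λ b → rowWeak r ∧ colStrict r s ∧ b) (isSSYT-∷ʳ (s ∷ T))

weight-∷ʳ : ∀ (T : List (Row n)) → weight (T ++ [ [] ]) ≡ weight T
weight-∷ʳ T = cong rowWeight (≡.trans (sym (ListP.concat-++ T [ [] ])) (ListP.++-identityʳ (concat T)))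

schurSum-∷ʳ : ∀ ρ (f : Mono n → ℤ) → schurSum n (ρ ++ [ 0 ]) f ≡ schurSum n ρ f
schurSum-∷ʳ ρ f = ≡.trans (∑-fillings-∷ʳ ρ _) (∑-cong (fillings ρ) (λ T → cong₂ (λ b w → ι b * f w) (isSSYT-∷ʳ T) (weight-∷ʳ T)))

schurSum-zeros : ∀ z ρ (f : Mono n → ℤ) → schurSum n (ρ ++ replicate z 0) f ≡ schurSum n ρ f
schurSum-zeros {n} zero    ρ f = cong (λ σ → schurSum n σ f) (ListP.++-identityʳ ρ)
schurSum-zeros {n} (suc z) ρ f = ≡.trans (cong (λ σ → schurSum n σ f) (sym (ListP.++-assoc ρ [ 0 ] (replicate z 0))))
  (≡.trans (schurSum-zeros z (ρ ++ [ 0 ]) f) (schurSum-∷ʳ ρ f))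

-- The recursions keep one row per variable, empty rows included, whereas a partition has positive
-- parts.
strip : List ℕ → List ℕ
strip []          = []
strip (zero ∷ ρ)  = []
strip (suc m ∷ ρ) = suc m ∷ strip ρ

Decr-tail : ∀ a ρ → Decr (a ∷ ρ) → Decr ρ
Decr-tail a []      d       = tt
Decr-tail a (b ∷ ρ) (_ , d) = d

strip-zeros : ∀ ρ → Decr ρ → ∃[ z ] ρ ≡ strip ρ ++ replicate z 0
strip-zeros []          d = 0 , refl
strip-zeros (zero ∷ ρ)  d = length (0 ∷ ρ) , zeros ρ d
  where
  zeros : ∀ ρ → Decr (0 ∷ ρ) → 0 ∷ ρ ≡ replicate (length (0 ∷ ρ)) 0
  zeros []      d         = refl
  zeros (0 ∷ ρ) (z≤n , d) = cong (0 ∷_) (zeros ρ d)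
strip-zeros (suc m ∷ ρ) d with strip-zeros ρ (Decr-tail (suc m) ρ d)
... | z , e = z , cong (suc m ∷_) e

schurSum-strip : ∀ ρ → Decr ρ → ∀ (f : Mono n → ℤ) → schurSum n (strip ρ) f ≡ schurSum n ρ f
schurSum-strip {n} ρ d f with strip-zeros ρ d
... | z , e = ≡.trans (sym (schurSum-zeros z (strip ρ) f)) (cong (λ σ → schurSum n σ f) (sym e))

strip-partition : ∀ ρ → Decr ρ → IsPartition (strip ρ)
strip-partition ρ d = positive ρ , linked ρ d
  where
  positive : ∀ ρ → All (λ m → 1 ℕ.≤ m) (strip ρ)
  positive []          = []
  positive (zero ∷ ρ)  = []
  positive (suc m ∷ ρ) = s≤s z≤n ∷ positive ρ
  linked : ∀ ρ → Decr ρ → Linked (λ a b → b ℕ.≤ a) (strip ρ)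
  linked []                  d       = []
  linked (zero ∷ ρ)          d       = []
  linked (suc m ∷ [])        d       = [-]
  linked (suc m ∷ zero ∷ ρ)  d       = [-]
  linked (suc m ∷ suc k ∷ ρ) (p , d) = p ∷ linked (suc k ∷ ρ) d

-- The partition λ with l = λ + (n − 1, …, 0)
shape : Vec ℕ n → List ℕ
shape []              = []
shape {suc n} (l ∷ v) = (l ℕ.∸ n) ∷ shape v

Decr-shape : ∀ (l : Vec ℕ n) → Strict l → Decr (shape l)
Decr-shape []                      s       = tt
Decr-shape (a ∷ [])                s       = tt
Decr-shape {suc (suc n)} (a ∷ b ∷ v) (p , s) = ℕP.∸-monoˡ-≤ (suc n) p , Decr-shape (b ∷ v) s

Strict-head : ∀ a (v : Vec ℕ n) → Strict (a ∷ v) → n ℕ.≤ a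
Strict-head a []      s       = z≤n
Strict-head a (b ∷ v) (p , s) = ℕP.≤-trans (s≤s (Strict-head b v s)) p

length-shape : ∀ (l : Vec ℕ n) → length (shape l) ≡ n
length-shape []      = refl
length-shape (a ∷ v) = cong suc (length-shape v)

-- Branching from n + 1 to n letters leaves n + 1 rows, which is too tall for n letters unless the
-- last row is empty; this is the indicator of that.
lastZero : List ℕ → ℤ
lastZero []          = 1ℤ
lastZero (q ∷ [])    = eq q 0
lastZero (q ∷ r ∷ σ) = lastZero (r ∷ σ)

-- Row number j (counted from 0) is nonempty.
Row⁺ : ℕ → List ℕ → Set
Row⁺ j       []      = ⊥
Row⁺ zero    (q ∷ σ) = 1 ℕ.≤ q
Row⁺ (suc j) (q ∷ σ) = Row⁺ j σ

lastZero-cases : ∀ j q σ → length σ ≡ j → lastZero (q ∷ σ) ≡ 1ℤ ⊎ Row⁺ j (q ∷ σ)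
lastZero-cases _ zero    []      refl = inj₁ refl
lastZero-cases _ (suc q) []      refl = inj₂ (s≤s z≤n)
lastZero-cases _ q       (r ∷ σ) refl = lastZero-cases _ r σ refl

Interlaced-length : ∀ ρ q σ → Interlaced ρ q σ → length σ ≡ length ρ
Interlaced-length []      q []      i           = refl
Interlaced-length (ℓ ∷ ρ) q (r ∷ σ) (_ , _ , i) = cong suc (Interlaced-length ρ r σ i)

Interlaced-Decr : ∀ ρ q σ → Interlaced ρ q σ → Decr (q ∷ σ)
Interlaced-Decr []      q []      i           = tt
Interlaced-Decr (ℓ ∷ ρ) q (r ∷ σ) (a , b , i) = ℕP.≤-trans b a , Interlaced-Decr ρ r σ i

Interlaced-Row⁺ : ∀ j ρ q σ → Interlaced ρ q σ → Row⁺ j ρ → Row⁺ j (q ∷ σ)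
Interlaced-Row⁺ zero    (ℓ ∷ ρ) q (r ∷ σ) (a , _ , _) p = ℕP.≤-trans p a
Interlaced-Row⁺ (suc j) (ℓ ∷ ρ) q (r ∷ σ) (_ , _ , i) p = Interlaced-Row⁺ j ρ r σ i p

splitSum-zero : ∀ ℓ {h : ℕ → ℕ → ℤ} → (∀ q p → h q p ≡ 0ℤ) → splitSum ℓ h ≡ 0ℤ
splitSum-zero ℓ e = ≡.trans (splitSum-cong ℓ (λ q p _ → e q p)) (splitSum-* ℓ 0ℤ (λ _ _ → 0ℤ))

branch-zero : ∀ ρ q {g : List ℕ → ℕ → ℤ} → (∀ σ s → Interlaced ρ q σ → g σ s ≡ 0ℤ) → branch ρ q g ≡ 0ℤ
branch-zero ρ q e = ≡.trans (branch-cong ρ q e) (branch-* ρ q 0ℤ (λ _ _ → 0ℤ))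

-- A column of strictly increasing letters has at most n entries.
schurSum-tall : ∀ n ρ → Decr ρ → Row⁺ n ρ → ∀ f → schurSum n ρ f ≡ 0ℤ
schurSum-tall zero    (suc ℓ ∷ ρ) d p f = refl
schurSum-tall (suc n) (ℓ ∷ ρ)     d p f = ≡.trans (schurSum-branch ℓ ρ f d)
  (splitSum-zero ℓ (λ q p′ → branch-zero ρ q (λ σ s i → schurSum-tall n (q ∷ σ) (Interlaced-Decr ρ q σ i) (Interlaced-Row⁺ n ρ q σ i p) (λ α → f (α ∷ʳ (p′ ℕ.+ s))))))

∑-below-+ : ∀ j M (f : ℕ → ℤ) → (∀ k → k ℕ.< j → f k ≡ 0ℤ) → ∑ (below (j ℕ.+ M)) f ≡ ∑ (below M) (λ q → f (j ℕ.+ q))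
∑-below-+ zero    M f e = refl
∑-below-+ (suc j) M f e = ≡.trans (cong (_+ ∑ (map suc (below (j ℕ.+ M))) f) (e 0 (s≤s z≤n))) (≡.trans (ℤP.+-identityˡ _)
  (≡.trans (∑-map suc (below (j ℕ.+ M)) f) (∑-below-+ j M (f ∘ suc) (λ k p → e (suc k) (s≤s p)))))

le-+ : ∀ j a b → le (j ℕ.+ a) (j ℕ.+ b) ≡ le a b
le-+ zero    a b = refl
le-+ (suc j) a b = le-+ j a b

removed : Vec ℕ (suc n) → Vec ℕ n → ℕ
removed (l₀ ∷ [])     []       = l₀
removed (l₀ ∷ l₁ ∷ l) (k ∷ ks) = (l₀ ℕ.∸ suc k) ℕ.+ removed (l₁ ∷ l) ks

branchShape : Vec ℕ (suc n) → (List ℕ → ℕ → ℤ) → ℤ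
branchShape {n} (l₀ ∷ v) h = splitSum (l₀ ℕ.∸ n) (λ q p → branch (shape v) q (λ σ s → h (q ∷ σ) (p ℕ.+ s)))

-- The substitution k = q + j, with j rows following, turns the weak conditions λ₁ ≤ q ≤ λ₀ on row
-- lengths into l₁ ≤ k < l₀.
branchShape-int : ∀ N (l : Vec ℕ (suc n)) → Strict l → V.head l ℕ.≤ N → ∀ (h : List ℕ → ℕ → ℤ) →
  branchShape l (λ μ s → lastZero μ * h μ s) ≡ ∑ (box N n) (λ k → int l k * h (shape k ++ [ 0 ]) (removed l k))
branchShape-int N (l₀ ∷ []) s b h = ≡.trans
  (splitSum-first l₀ (λ q p → ℤP.*-zeroˡ (h (suc q ∷ []) (p ℕ.+ 0))))
  (≡.trans (cong (λ r → 1ℤ * h (0 ∷ []) r) (ℕP.+-identityʳ l₀)) (sym (ℤP.+-identityʳ _)))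
branchShape-int {suc j} N (l₀ ∷ l₁ ∷ v) (l₁<l₀ , s) l₀≤N h
  -- a and b are the first two row lengths λ₀ and λ₁, and c is the distance from l₀ to the bound.
  with a , refl ← ℕP.m≤n⇒∃[o]m+o≡n (ℕP.≤-trans (s≤s (Strict-head l₁ v s)) l₁<l₀)
     | b , refl ← ℕP.m≤n⇒∃[o]m+o≡n (Strict-head l₁ v s)
     | c , refl ← ℕP.m≤n⇒∃[o]m+o≡n l₀≤N = begin
  splitSum (suc j ℕ.+ a ℕ.∸ suc j) (λ q p → le (j ℕ.+ b ℕ.∸ j) q * branchShape (l₁ ∷ v) (λ μ s → lastZero μ * h (q ∷ μ) (p ℕ.+ s)))
    ≡⟨ cong₂ (λ y z → splitSum y (λ q p → le z q * branchShape (l₁ ∷ v) (λ μ s → lastZero μ * h (q ∷ μ) (p ℕ.+ s))))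
         (ℕP.m+n∸m≡n (suc j) a) (ℕP.m+n∸m≡n j b) ⟩
  splitSum a (λ q p → le b q * branchShape (l₁ ∷ v) (λ μ s → lastZero μ * h (q ∷ μ) (p ℕ.+ s)))
    ≡⟨ splitSum-cong a (λ q p _ → cong (le b q *_) (branchShape-int N₀ (l₁ ∷ v) s (ℕP.≤-trans (ℕP.<⇒≤ l₁<l₀) l₀≤N) (λ μ s → h (q ∷ μ) (p ℕ.+ s)))) ⟩
  splitSum a (λ q p → le b q * X q p)
    ≡⟨ splitSum-below a (s≤s (ℕP.m≤m+n a c)) _ ⟩
  ∑ (below M) (λ q → le q a * (le b q * X q (a ℕ.∸ q)))
    ≡⟨ ∑-cong (below M) (λ q → sym (shifted q)) ⟩
  ∑ (below M) (λ q → y (j ℕ.+ q))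
    ≡⟨ sym (∑-below-+ j M y small) ⟩
  ∑ (below (j ℕ.+ M)) y
    ≡⟨ cong (λ N → ∑ (below N) y) (ℕP.+-suc j (a ℕ.+ c)) ⟩
  ∑ (below (suc (j ℕ.+ (a ℕ.+ c)))) y
    ≡⟨ cong (λ N → ∑ (below (suc N)) y) (sym (ℕP.+-assoc j a c)) ⟩
  ∑ (below N₀) y
    ≡⟨ ∑-cong (below N₀) (λ k → sym (≡.trans (∑-cong (box N₀ j) (λ ks →
         lemma (le (suc k) (suc j ℕ.+ a)) (le l₁ k) (int (l₁ ∷ v) ks) _))
         (≡.trans (∑-*ˡ (box N₀ j) (le (suc k) (suc j ℕ.+ a)) _) (cong (le (suc k) (suc j ℕ.+ a) *_) (∑-*ˡ (box N₀ j) (le l₁ k) _))))) ⟩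
  ∑ (below N₀) (λ k → ∑ (box N₀ j) (λ ks → int (l₀ ∷ l₁ ∷ v) (k ∷ ks) * h (shape (k ∷ ks) ++ [ 0 ]) (removed (l₀ ∷ l₁ ∷ v) (k ∷ ks))))
    ≡⟨ sym (∑-box N₀ j _) ⟩
  ∑ (box N₀ (suc j)) (λ k → int (l₀ ∷ l₁ ∷ v) k * h (shape k ++ [ 0 ]) (removed (l₀ ∷ l₁ ∷ v) k)) ∎
  where
  open ≡-Reasoning
  M N₀ : ℕ
  M = suc (a ℕ.+ c)
  N₀ = suc j ℕ.+ a ℕ.+ c
  X : ℕ → ℕ → ℤ
  X q p = ∑ (box N₀ j) (λ ks → int (l₁ ∷ v) ks * h (q ∷ shape ks ++ [ 0 ]) (p ℕ.+ removed (l₁ ∷ v) ks))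
  y : ℕ → ℤ
  y k = le (suc k) (suc j ℕ.+ a) * (le (j ℕ.+ b) k * X (k ℕ.∸ j) (suc j ℕ.+ a ℕ.∸ suc k))
  lemma : ∀ a b c d → a * (b * c) * d ≡ a * (b * (c * d))
  lemma = solve-∀
  shifted : ∀ q → y (j ℕ.+ q) ≡ le q a * (le b q * X q (a ℕ.∸ q))
  shifted q = cong₂ _*_ (le-+ j q a) (cong₂ _*_ (le-+ j b q)
    (cong₂ X (ℕP.m+n∸m≡n j q) (ℕP.[m+n]∸[m+o]≡n∸o j a q)))
  small : ∀ k → k ℕ.< j → y k ≡ 0ℤ
  small k p with le-cases (j ℕ.+ b) k
  ... | inj₁ (e , _) = ≡.trans (cong (λ z → le (suc k) (suc j ℕ.+ a) * (z * X (k ℕ.∸ j) (suc j ℕ.+ a ℕ.∸ suc k))) e) (ℤP.*-zeroʳ (le (suc k) (suc j ℕ.+ a)))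
  ... | inj₂ (_ , r) = ⊥-elim (ℕP.<⇒≱ p (ℕP.≤-trans (ℕP.m≤m+n j b) r))

Top : ℕ → Vec ℕ n → Set
Top N []      = ⊤
Top N (a ∷ v) = a ℕ.≤ N

-- Explains why the degree condition in `kostka` fixes the number of removed boxes to be the
-- exponent m.
int-removed : ∀ N (l : Vec ℕ (suc n)) k → V.head l ℕ.≤ N →
  int l k ≡ 0ℤ ⊎ (V.sum l ≡ removed l k ℕ.+ (n ℕ.+ V.sum k) × Top N k)
int-removed N (l₀ ∷ []) [] b = inj₂ (refl , tt)
int-removed {suc n} N (l₀ ∷ l₁ ∷ l) (k ∷ ks) b with le-cases (suc k) l₀ | int-removed l₁ (l₁ ∷ l) ks ℕP.≤-refl
... | inj₁ (e , _) | _ = inj₁ (≡.trans (cong (_* (le l₁ k * int (l₁ ∷ l) ks)) e) (ℤP.*-zeroˡ (le l₁ k * int (l₁ ∷ l) ks)))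
... | inj₂ _ | inj₁ e = inj₁ (≡.trans (cong (λ z → le (suc k) l₀ * (le l₁ k * z)) e)
  (≡.trans (cong (le (suc k) l₀ *_) (ℤP.*-zeroʳ (le l₁ k))) (ℤP.*-zeroʳ (le (suc k) l₀))))
... | inj₂ (_ , p) | inj₂ (e , _) = inj₂ (≡.trans (cong₂ ℕ._+_ (sym (ℕP.m∸n+n≡m p)) e)
    (arith (l₀ ℕ.∸ suc k) k (removed (l₁ ∷ l) ks) n (V.sum ks)) , ℕP.≤-trans (ℕP.<⇒≤ p) b)
  where
  arith : ∀ d k r n s → (d ℕ.+ suc k) ℕ.+ (r ℕ.+ (n ℕ.+ s)) ≡ (d ℕ.+ r) ℕ.+ (suc n ℕ.+ (k ℕ.+ s))
  arith = ℕSolver.solve-∀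

-- `kostka` removes the variable x₀ first, a tableau loses its largest letter first; hence the
-- reversal of α.
kostka-schur : ∀ N (l : Vec ℕ n) → Strict l → Top N l → ∀ α → kostka N l α ≡ schurSum n (shape l) (λ γ → eqV γ (V.reverse α))
kostka-schur N [] s b [] = refl
kostka-schur {suc n} N l@(l₀ ∷ v) s b (m ∷ α) = sym (begin
  schurSum (suc n) (shape l) (λ γ → eqV γ (V.reverse (m ∷ α)))
    ≡⟨ cong (λ β → schurSum (suc n) (shape l) (λ γ → eqV γ β)) (VP.reverse-∷ m α) ⟩
  schurSum (suc n) (shape l) (λ γ → eqV γ (V.reverse α ∷ʳ m))
    ≡⟨ schurSum-branch (l₀ ℕ.∸ n) (shape v) (λ γ → eqV γ (V.reverse α ∷ʳ m)) (Decr-shape l s) ⟩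
  splitSum (l₀ ℕ.∸ n) (λ q p → branch (shape v) q (λ σ t → schurSum n (q ∷ σ) (λ γ → eqV (γ ∷ʳ (p ℕ.+ t)) (V.reverse α ∷ʳ m))))
    ≡⟨ splitSum-cong (l₀ ℕ.∸ n) (λ q p _ → branch-cong (shape v) q (λ σ t i → short q (p ℕ.+ t) σ i)) ⟩
  branchShape l (λ μ t → lastZero μ * h μ t)
    ≡⟨ branchShape-int N l s b h ⟩
  ∑ (box N n) (λ k → int l k * h (shape k ++ [ 0 ]) (removed l k))
    ≡⟨ ∑-cong (box N n) term ⟩
  kostka N l (m ∷ α) ∎)
  where
  open ≡-Reasoning
  f : Mono n → ℤ
  f γ = eqV γ (V.reverse α)
  h : List ℕ → ℕ → ℤ
  h μ t = schurSum n μ f * eq t m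
  short : ∀ q t σ → Interlaced (shape v) q σ → schurSum n (q ∷ σ) (λ γ → eqV (γ ∷ʳ t) (V.reverse α ∷ʳ m)) ≡ lastZero (q ∷ σ) * h (q ∷ σ) t
  short q t σ i = ≡.trans
    (≡.trans (∑-cong (fillings (q ∷ σ)) (λ T → ≡.trans (cong (ι (isSSYT T) *_) (eqV-∷ʳ (weight T) (V.reverse α) t m)) (sym (ℤP.*-assoc (ι (isSSYT T)) (f (weight T)) (eq t m)))))
      (∑-*ʳ (fillings (q ∷ σ)) (eq t m) _))
    (cases (lastZero-cases n q σ (≡.trans (Interlaced-length (shape v) q σ i) (length-shape v))))
    where
    cases : lastZero (q ∷ σ) ≡ 1ℤ ⊎ Row⁺ n (q ∷ σ) → h (q ∷ σ) t ≡ lastZero (q ∷ σ) * h (q ∷ σ) t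
    cases (inj₁ e) = sym (≡.trans (cong (_* h (q ∷ σ) t) e) (ℤP.*-identityˡ _))
    cases (inj₂ r) = ≡.trans z (sym (≡.trans (cong (lastZero (q ∷ σ) *_) z) (ℤP.*-zeroʳ (lastZero (q ∷ σ)))))
      where
      z : h (q ∷ σ) t ≡ 0ℤ
      z = ≡.trans (cong (_* eq t m) (schurSum-tall n (q ∷ σ) (Interlaced-Decr (shape v) q σ i) r f)) (ℤP.*-zeroˡ (eq t m))
  term : ∀ k → int l k * h (shape k ++ [ 0 ]) (removed l k) ≡ int l k * (eq (V.sum l) (m ℕ.+ n ℕ.+ V.sum k) * kostka N k α)
  term k with int-cases l k | int-removed N l k b
  ... | inj₁ e | _ = ≡.trans (≡.trans (cong (_* h (shape k ++ [ 0 ]) (removed l k)) e) (ℤP.*-zeroˡ (h (shape k ++ [ 0 ]) (removed l k))))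
    (sym (≡.trans (cong (_* (eq (V.sum l) (m ℕ.+ n ℕ.+ V.sum k) * kostka N k α)) e) (ℤP.*-zeroˡ (eq (V.sum l) (m ℕ.+ n ℕ.+ V.sum k) * kostka N k α))))
  ... | inj₂ _ | inj₁ e = ≡.trans (≡.trans (cong (_* h (shape k ++ [ 0 ]) (removed l k)) e) (ℤP.*-zeroˡ (h (shape k ++ [ 0 ]) (removed l k))))
    (sym (≡.trans (cong (_* (eq (V.sum l) (m ℕ.+ n ℕ.+ V.sum k) * kostka N k α)) e) (ℤP.*-zeroˡ (eq (V.sum l) (m ℕ.+ n ℕ.+ V.sum k) * kostka N k α))))
  ... | inj₂ (_ , sk) | inj₂ (e , bk) = cong (int l k *_) (≡.trans
    (cong₂ _*_ (≡.trans (schurSum-∷ʳ (shape k) f) (sym (kostka-schur N k sk bk α)))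
      (sym (≡.trans (cong₂ eq (≡.trans e (ℕP.+-comm (removed l k) _)) (≡.trans (ℕP.+-assoc m n _) (ℕP.+-comm m _)))
        (eq-+ (n ℕ.+ V.sum k) (removed l k) m))))
    (ℤP.*-comm (kostka N k α) _))

-- Subsets and permutations of the letters

set⇒↭ : ∀ {xs ys : List A} → Unique xs → Unique ys → (∀ {y} → y ∈ xs → y ∈ ys) → (∀ {y} → y ∈ ys → y ∈ xs) → xs ↭ ys
set⇒↭ u u′ to from = ∼bag⇒↭ (unique∧set⇒bag u u′ (mk⇔ to from))

elems : Vec Bool n → List (Fin n)
elems []          = []
elems (true ∷ S)  = zero ∷ map suc (elems S)
elems (false ∷ S) = map suc (elems S)

elems-unique : ∀ (S : Vec Bool n) → Unique (elems S)
elems-unique []          = []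
elems-unique (true ∷ S)  = AllP.map⁺ (All.universal (λ _ ()) (elems S)) ∷ UniqueP.map⁺ FinP.suc-injective (elems-unique S)
elems-unique (false ∷ S) = UniqueP.map⁺ FinP.suc-injective (elems-unique S)

∈-elems⁺ : ∀ (S : Vec Bool n) i → lookup S i ≡ true → i ∈ elems S
∈-elems⁺ (true ∷ S)  zero    e = here refl
∈-elems⁺ (true ∷ S)  (suc i) e = there (∈-map⁺ suc (∈-elems⁺ S i e))
∈-elems⁺ (false ∷ S) (suc i) e = ∈-map⁺ suc (∈-elems⁺ S i e)

∈-elems⁻ : ∀ (S : Vec Bool n) i → i ∈ elems S → lookup S i ≡ true
∈-elems⁻ (true ∷ S)  zero    m = refl
∈-elems⁻ (true ∷ S)  (suc i) (there m) with ∈-map⁻ suc m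
... | _ , m′ , refl = ∈-elems⁻ S i m′
∈-elems⁻ (false ∷ S) zero    m with ∈-map⁻ suc m
... | _ , _ , ()
∈-elems⁻ (false ∷ S) (suc i) m with ∈-map⁻ suc m
... | _ , m′ , refl = ∈-elems⁻ S i m′

length-elems≤ : ∀ (S : Vec Bool n) → length (elems S) ℕ.≤ n
length-elems≤ []          = z≤n
length-elems≤ (true ∷ S)  = s≤s (subst (ℕ._≤ _) (sym (ListP.length-map suc (elems S))) (length-elems≤ S))
length-elems≤ (false ∷ S) = ℕP.m≤n⇒m≤1+n (subst (ℕ._≤ _) (sym (ListP.length-map suc (elems S))) (length-elems≤ S))

∣∣≡length : ∀ (S : Subset n) → ∣ S ∣ ≡ length (elems S)
∣∣≡length []          = refl
∣∣≡length (true ∷ S)  = cong suc (≡.trans (∣∣≡length S) (sym (ListP.length-map suc (elems S))))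
∣∣≡length (false ∷ S) = ≡.trans (∣∣≡length S) (sym (ListP.length-map suc (elems S)))

vec-ext : ∀ {u v : Vec A n} → (∀ i → lookup u i ≡ lookup v i) → u ≡ v
vec-ext {u = u} {v} e = ≡.trans (sym (VP.tabulate∘lookup u)) (≡.trans (VP.tabulate-cong e) (VP.tabulate∘lookup v))

true-ext : ∀ (b c : Bool) → (b ≡ true → c ≡ true) → (c ≡ true → b ≡ true) → b ≡ c
true-ext true  c     f g = sym (f refl)
true-ext false true  f g = g refl
true-ext false false f g = refl

elems-injective : ∀ {S S′ : Vec Bool n} → elems S ↭ elems S′ → S ≡ S′
elems-injective {S = S} {S′} r = vec-ext (λ i → true-ext (lookup S i) (lookup S′ i)
  (λ e → ∈-elems⁻ S′ i (↭P.∈-resp-↭ r (∈-elems⁺ S i e)))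
  (λ e → ∈-elems⁻ S i (↭P.∈-resp-↭ (↭-sym r) (∈-elems⁺ S′ i e))))

Involutive : (A → A) → Set
Involutive φ = ∀ i → φ (φ i) ≡ i

permute : (Fin n → Fin n) → Vec Bool n → Vec Bool n
permute φ S = V.tabulate (lookup S ∘ φ)

lookup-permute : ∀ (φ : Fin n → Fin n) S i → lookup (permute φ S) i ≡ lookup S (φ i)
lookup-permute φ S i = VP.lookup∘tabulate (lookup S ∘ φ) i

permute-involutive : ∀ {φ : Fin n → Fin n} → Involutive φ → Involutive (permute φ)
permute-involutive {φ = φ} inv S = vec-ext (λ i →
  ≡.trans (lookup-permute φ (permute φ S) i) (≡.trans (lookup-permute φ S (φ i)) (cong (lookup S) (inv i))))

elems-permute : ∀ {φ : Fin n → Fin n} → Involutive φ → ∀ S → elems (permute φ S) ↭ map φ (elems S)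
elems-permute {φ = φ} inv S = set⇒↭ (elems-unique (permute φ S))
  (UniqueP.map⁺ (λ {i} {j} e → ≡.trans (sym (inv i)) (≡.trans (cong φ e) (inv j))) (elems-unique S)) to from
  where
  to : ∀ {i} → i ∈ elems (permute φ S) → i ∈ map φ (elems S)
  to {i} m = subst (_∈ map φ (elems S)) (inv i)
    (∈-map⁺ φ (∈-elems⁺ S (φ i) (≡.trans (sym (lookup-permute φ S i)) (∈-elems⁻ (permute φ S) i m))))
  from : ∀ {i} → i ∈ map φ (elems S) → i ∈ elems (permute φ S)
  from m with ∈-map⁻ φ m
  ... | j , m′ , refl = ∈-elems⁺ (permute φ S) (φ j)
    (≡.trans (lookup-permute φ S (φ j)) (≡.trans (cong (lookup S) (inv j)) (∈-elems⁻ S j m′)))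

∣permute∣ : ∀ {φ : Fin n → Fin n} → Involutive φ → ∀ S → ∣ permute φ S ∣ ≡ ∣ S ∣
∣permute∣ {φ = φ} inv S = ≡.trans (∣∣≡length (permute φ S)) (≡.trans (↭P.↭-length (elems-permute inv S))
  (≡.trans (ListP.length-map φ (elems S)) (sym (∣∣≡length S))))

transpose : Fin n → Fin n → Fin n → Fin n
transpose a b i with i FinP.≟ a | i FinP.≟ b
... | yes _ | _     = b
... | no _  | yes _ = a
... | no _  | no _  = i

transpose-a : ∀ (a b : Fin n) → transpose a b a ≡ b
transpose-a a b with a FinP.≟ a
... | yes _ = refl
... | no ne = ⊥-elim (ne refl)

transpose-b : ∀ (a b : Fin n) → transpose a b b ≡ a
transpose-b a b with b FinP.≟ a | b FinP.≟ b
... | yes e | _     = e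
... | no _  | yes _ = refl
... | no _  | no ne = ⊥-elim (ne refl)

transpose-other : ∀ {a b i : Fin n} → i ≢ a → i ≢ b → transpose a b i ≡ i
transpose-other {a = a} {b} {i} p q with i FinP.≟ a | i FinP.≟ b
... | yes e | _     = ⊥-elim (p e)
... | no _  | yes e = ⊥-elim (q e)
... | no _  | no _  = refl

transpose-involutive : ∀ (a b : Fin n) → Involutive (transpose a b)
transpose-involutive a b i with i FinP.≟ a | i FinP.≟ b
... | yes e | _     = ≡.trans (transpose-b a b) (sym e)
... | no _  | yes e = ≡.trans (transpose-a a b) (sym e)
... | no p  | no q  = transpose-other p q

-- Stability is asked for involutions because these are the permutations applied later:
-- transpositions, adjacent interchanges and the reversal `opposite`.
record Stable (𝒮 : List (Subset n)) : Set where
  field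
    unique : Unique 𝒮
    stable : ∀ {φ : Fin n → Fin n} → Involutive φ → ∀ {S} → S ∈ 𝒮 → permute φ S ∈ 𝒮

-- Replacing a by b amounts to interchanging them, because the other letters of the subset contain
-- neither.
Stable⇒Family : ∀ {𝒮 : List (Subset n)} → Stable 𝒮 → Family (map elems 𝒮)
Stable⇒Family {n} {𝒮} st = record
  { nodup    = AllP.map⁺ (All.universal elems-unique 𝒮)
  ; distinct = AllPairsP.map⁺ (AllPairs.map (λ ne r → ne (elems-injective r)) unique)
  ; closed   = closed }
  where
  open Stable st
  closed : ∀ {S a b R} → S ∈ map elems 𝒮 → S ↭ a ∷ R → a ≢ b → b ∉ R → ∃[ S′ ] (S′ ∈ map elems 𝒮 × (b ∷ R ↭ S′))
  closed {S} {a} {b} {R} m r a≢b b∉ with ∈-map⁻ elems m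
  ... | P , P∈ , refl = elems (permute φ P) , ∈-map⁺ elems (stable inv P∈) ,
    ↭-trans (↭-reflexive (sym (cong₂ _∷_ (transpose-a a b) (fixed R a∉ b∉)))) (↭-trans (↭P.map⁺ φ (↭-sym r)) (↭-sym (elems-permute inv P)))
    where
    φ : Fin n → Fin n
    φ = transpose a b
    inv : Involutive φ
    inv = transpose-involutive a b
    a∉ : a ∉ R
    a∉ = AllP.All¬⇒¬Any (AllPairs.head (Unique-resp-↭ r (elems-unique P)))
    fixed : ∀ R → a ∉ R → b ∉ R → map φ R ≡ R
    fixed []      _ _ = refl
    fixed (i ∷ R) p q = cong₂ _∷_ (transpose-other (λ e → p (here (sym e))) (λ e → q (here (sym e)))) (fixed R (p ∘ there) (q ∘ there))

-- The product of the X_S as a series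

mem : Subset n → Fin n → ℤ
mem S i = ι (lookup S i)

χ-elems : ∀ (S : Subset n) i → χ (elems S) i ≡ mem S i
χ-elems (true ∷ S)  zero    = cong (1ℤ +_) (≡.trans (∑-map suc (elems S) _) (∑-0 (elems S)))
χ-elems (false ∷ S) zero    = ≡.trans (∑-map suc (elems S) _) (∑-0 (elems S))
χ-elems (true ∷ S)  (suc i) = ≡.trans (ℤP.+-identityˡ _) (≡.trans (∑-map suc (elems S) _) (χ-elems S i))
χ-elems (false ∷ S) (suc i) = ≡.trans (∑-map suc (elems S) _) (χ-elems S i)

subsetSer : List (Subset n) → Ser (Fin n)
subsetSer 𝒮 = ∏lin (map mem 𝒮)

∏lin-↭ : ∀ {us vs : List (I → ℤ)} → us ↭ vs → ∏lin us ≋ ∏lin vs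
∏lin-↭ refl       = ≋-refl
∏lin-↭ (prep u r) = ⊛-congˡ {F = lin u} (∏lin-↭ r)
∏lin-↭ {I = I} (swap {ys = ys} u v r) = ≋-trans (⊛-congˡ {F = lin u} (⊛-congˡ {F = lin v} (∏lin-↭ r)))
  (solve 3 (λ a b p → a :* (b :* p) := b :* (a :* p)) (λ {_} → ≋-refl) (lin u) (lin v) (∏lin ys))
  where open SerSolver I using (solve; _:=_; _:*_)
∏lin-↭ (trans r s) = ≋-trans (∏lin-↭ r) (∏lin-↭ s)

Comm-∏lin : ∀ (us : List (I → ℤ)) → Comm (∏lin us)
Comm-∏lin []       = Comm-con 1ℤ
Comm-∏lin (u ∷ us) = Comm-⊛ (Comm-lin u) (Comm-∏lin us)

^*-∏lin : ∀ {φ : Fin n → Fin n} 𝒮 → φ ^* subsetSer 𝒮 ≋ subsetSer (map (permute φ) 𝒮)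
^*-∏lin {φ = φ} []      = ^*-con φ 1ℤ
^*-∏lin {φ = φ} (S ∷ 𝒮) = ≋-trans (^*-⊛ φ (lin (mem S)) (subsetSer 𝒮))
  (⊛-cong (≋-trans (^*-lin φ (mem S)) (lin-cong (λ i → cong ι (sym (lookup-permute φ S i))))) (^*-∏lin 𝒮))

subsetSer-symmetric : ∀ {𝒮 : List (Subset n)} → Stable 𝒮 → ∀ {φ} → Involutive φ → φ ^* subsetSer 𝒮 ≋ subsetSer 𝒮
subsetSer-symmetric {𝒮 = 𝒮} st {φ} inv = ≋-trans (^*-∏lin 𝒮) (∏lin-↭ (↭P.map⁺ mem (set⇒↭
  (UniqueP.map⁺ (λ {S} {S′} e → ≡.trans (sym (permute-involutive inv S)) (≡.trans (cong (permute φ) e) (permute-involutive inv S′))) unique)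
  unique to from)))
  where
  open Stable st
  to : ∀ {S} → S ∈ map (permute φ) 𝒮 → S ∈ 𝒮
  to m with ∈-map⁻ (permute φ) m
  ... | S , m′ , refl = stable inv m′
  from : ∀ {S} → S ∈ 𝒮 → S ∈ map (permute φ) 𝒮
  from {S} m = subst (_∈ map (permute φ) 𝒮) (permute-involutive inv S) (∈-map⁺ (permute φ) (stable inv m))

subsetSer-degree : ∀ (𝒮 : List (Subset n)) L → length L ≢ length 𝒮 → subsetSer 𝒮 L ≡ 0ℤ
subsetSer-degree 𝒮 L ne = go (map mem 𝒮) L (λ e → ne (≡.trans e (ListP.length-map mem 𝒮)))
  where
  lin-⊛ : ∀ (u : I → ℤ) F m → (∀ L → length L ≢ m → F L ≡ 0ℤ) → ∀ L → length L ≢ suc m → (lin u ⊛ F) L ≡ 0ℤ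
  lin-⊛ u F m h []      ne = ℤP.*-zeroˡ (F [])
  lin-⊛ u F zero h (y ∷ L) ne = ≡.trans (D-lin u F y L) (cong₂ _+_
    (≡.trans (cong (u y *_) (h L (λ e → ne (cong suc e)))) (ℤP.*-zeroʳ (u y)))
    (≡.trans (⊛-congˡ {F = lin u} (λ K → h (y ∷ K) (λ ())) L) (≡.trans (⊛-comm (lin u) (λ _ → 0ℤ) L) (⊛-zeroˡ (lin u) L))))
  lin-⊛ u F (suc m) h (y ∷ L) ne = ≡.trans (D-lin u F y L) (cong₂ _+_
    (≡.trans (cong (u y *_) (h L (λ e → ne (cong suc e)))) (ℤP.*-zeroʳ (u y)))
    (lin-⊛ u (D y F) m (λ K k → h (y ∷ K) (λ e → k (ℕP.suc-injective e))) L (λ e → ne (cong suc e))))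
  go : ∀ (us : List (I → ℤ)) L → length L ≢ length us → ∏lin us L ≡ 0ℤ
  go []       []      ne = ⊥-elim (ne refl)
  go []       (_ ∷ _) ne = refl
  go (u ∷ us) L       ne = lin-⊛ u (∏lin us) (length us) (go us) L ne

coeffs : Poly n → Ogf n
coeffs p α = ∑ p (λ β → eqV β α)

∑-*P : ∀ (p q : Poly n) f → ∑ (p *P q) f ≡ ∑ p (λ a → ∑ q (λ b → f (a *M b)))
∑-*P p q f = ≡.trans (∑-concatMap (λ a → map (a *M_) q) p f) (∑-cong p (λ a → ∑-map (a *M_) q f))

fins≡allFin : ∀ n → fins n ≡ allFin n
fins≡allFin zero    = refl
fins≡allFin (suc n) = cong (zero ∷_) (≡.trans (cong (map suc) (fins≡allFin n)) (ListP.map-tabulate id suc))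

∑-XS : ∀ (S : Subset n) f → ∑ (XS S) f ≡ ∑ (fins n) (λ i → mem S i * f (var i))
∑-XS {n} S f = ≡.trans (∑-concatMap _ (allFin n) f) (≡.trans (∑-cong (allFin n) (λ i → pick (lookup S i) i))
  (cong (λ is → ∑ is (λ i → mem S i * f (var i))) (sym (fins≡allFin n))))
  where
  pick : ∀ b i → ∑ (if b then [ var i ] else []) f ≡ ι b * f (var i)
  pick true  i = ≡.trans (ℤP.+-identityʳ _) (sym (ℤP.*-identityˡ _))
  pick false i = sym (ℤP.*-zeroˡ (f (var i)))

coeffs-var : ∀ (i : Fin n) (q : Poly n) → (λ α → ∑ q (λ b → eqV (var i *M b) α)) ≗ᵒ xmul i (coeffs q)
coeffs-var i q α = ≡.trans (∑-cong q (λ b → eqV-var i b α)) (∑-xmul q eqV i α)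
  where
  eqV-var : ∀ {n} (i : Fin n) b α → eqV (var i *M b) α ≡ xmul i (eqV b) α
  eqV-var {suc n} zero    (b ∷ bs) α = ≡.trans (cong (λ u → eqV (u *M (b ∷ bs)) α) (var-zero n))
    (≡.trans (cong (λ u → eqV ((1 ℕ.+ b) ∷ u) α) (*M-identityˡ bs)) (step α))
    where
    step : ∀ α → eqV (suc b ∷ bs) α ≡ xmul zero (eqV (b ∷ bs)) α
    step (zero ∷ α)  = ℤP.*-zeroˡ (eqV bs α)
    step (suc m ∷ α) = refl
  eqV-var (suc i) (b ∷ bs) (m ∷ α) = ≡.trans (cong (eq b m *_) (eqV-var i bs α)) (sym (xmul-· i (eq b m) (eqV bs) α))
  ∑-xmul : ∀ {n} {A : Set} (q : List A) (f : A → Ogf n) (i : Fin n) α → ∑ q (λ b → xmul i (f b) α) ≡ xmul i (λ α → ∑ q (λ b → f b α)) α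
  ∑-xmul q f zero    (zero ∷ α)  = ∑-0 q
  ∑-xmul q f zero    (suc m ∷ α) = refl
  ∑-xmul q f (suc i) (m ∷ α)     = ∑-xmul q (λ b β → f b (m ∷ β)) i α

egf-∑ : ∀ (xs : List A) (u : A → ℤ) (c : A → Ogf n) → egf (λ α → ∑ xs (λ y → u y * c y α)) ≋ ∑S xs (λ y → u y · egf (c y))
egf-∑ {n = n} [] u c L = zeros L
  where
  zeros : egf {n} (λ _ → 0ℤ) ≋ (λ _ → 0ℤ)
  zeros []      = refl
  zeros (q ∷ L) = ≡.trans (egf-cong (dq-0 q) L) (zeros L)
egf-∑ (y ∷ xs) u c L = ≡.trans (egf-cong (λ α → cong (u y * c y α +_) (sym (ℤP.*-identityˡ _))) L)
  (≡.trans (egf-lin (u y) 1ℤ (c y) (λ α → ∑ xs (λ y → u y * c y α)) L)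
    (cong (u y * egf (c y) L +_) (≡.trans (ℤP.*-identityˡ _) (egf-∑ xs u c L))))

lin-x : ∀ (u : Fin n → ℤ) → lin u ≋ ∑S (fins n) (λ i → u i · x i)
lin-x {n} u []          = sym (∑-zero (fins n) (λ i → ℤP.*-zeroʳ (u i)))
lin-x {n} u (p ∷ [])    = sym (≡.trans (∑-cong (fins n) (λ i → ≡.trans (ℤP.*-comm (u i) (δ i p)) (cong (_* u i) (δ-sym i p)))) (∑-δ p u))
  where
  δ-sym : ∀ {n} (i j : Fin n) → δ i j ≡ δ j i
  δ-sym zero    zero    = refl
  δ-sym zero    (suc j) = refl
  δ-sym (suc i) zero    = refl
  δ-sym (suc i) (suc j) = δ-sym i j
lin-x {n} u (p ∷ _ ∷ _) = sym (∑-zero (fins n) (λ i → ℤP.*-zeroʳ (u i)))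

egf-coeffs : ∀ (𝒮 : List (Subset n)) → egf (coeffs (prodP (map XS 𝒮))) ≋ subsetSer 𝒮
egf-coeffs {n} [] = ≋-trans (egf-cong (λ α → ℤP.+-identityʳ (eqV oneM α))) unit
  where
  dq-unit : ∀ {n} (q : Fin n) → dq q (eqV oneM) ≗ᵒ (λ _ → 0ℤ)
  dq-unit zero    (m ∷ α) = ≡.trans (cong (ℤ.+ suc m *_) (ℤP.*-zeroˡ (eqV oneM α))) (ℤP.*-zeroʳ (ℤ.+ suc m))
  dq-unit (suc q) (m ∷ α) = ≡.trans (dq-cong q (λ β → ≡.trans (sym (ℤP.+-identityʳ _)) refl) α)
    (≡.trans (dq-lin q (eq 0 m) 0ℤ (eqV oneM) (eqV oneM) α)
      (≡.trans (ℤP.+-identityʳ _) (≡.trans (cong (eq 0 m *_) (dq-unit q α)) (ℤP.*-zeroʳ (eq 0 m)))))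
  unit : egf (eqV (oneM {n})) ≋ con 1ℤ
  unit []      = eqV-refl (oneM {n})
  unit (q ∷ L) = ≡.trans (egf-cong (dq-unit q) L) (egf-∑ {A = ⊤} [] (λ _ → 0ℤ) (λ _ _ → 0ℤ) L)
egf-coeffs {n} (S ∷ 𝒮) = ≋-trans (egf-cong coeffs-XS)
  (≋-trans (egf-∑ (fins n) (mem S) (λ i → xmul i (coeffs Q)))
  (≋-trans (∑S-cong (fins n) (λ i → ·-cong (mem S i) (≋-trans (egf-xmul i (coeffs Q)) (⊛-congˡ {F = x i} (egf-coeffs 𝒮)))))
  (≋-sym (≋-trans (⊛-congʳ {G = subsetSer 𝒮} (lin-x (mem S)))
    (≋-trans (⊛-∑ˡ (fins n) (λ i → mem S i · x i) (subsetSer 𝒮)) (∑S-cong (fins n) (λ i → ·-⊛ (mem S i) (x i) (subsetSer 𝒮))))))))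
  where
  Q : Poly n
  Q = prodP (map XS 𝒮)
  coeffs-XS : coeffs (XS S *P Q) ≗ᵒ (λ α → ∑ (fins n) (λ i → mem S i * xmul i (coeffs Q) α))
  coeffs-XS α = ≡.trans (∑-*P (XS S) Q _) (≡.trans (∑-XS S _) (∑-cong (fins n) (λ i → cong (mem S i *_) (coeffs-var i Q α))))

-- Reversal of the variables

dq-reverse-last : ∀ n (c : Ogf (suc n)) α m → dq (fromℕ n) c (α ∷ʳ m) ≡ ℤ.+ suc m * c (α ∷ʳ suc m)
dq-reverse-last zero    c []      m = refl
dq-reverse-last (suc n) c (a ∷ α) m = dq-reverse-last n (λ β → c (a ∷ β)) α m

dq-inject₁ : ∀ (q : Fin n) (c : Ogf (suc n)) α m → dq (inject₁ q) c (α ∷ʳ m) ≡ dq q (λ β → c (β ∷ʳ m)) α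
dq-inject₁ zero    c (a ∷ α) m = refl
dq-inject₁ (suc q) c (a ∷ α) m = dq-inject₁ q (λ β → c (a ∷ β)) α m

dq-reverse : ∀ (q : Fin n) c α → dq (opposite q) c (V.reverse α) ≡ dq q (c ∘ V.reverse) α
dq-reverse {suc n} zero    c (m ∷ α) = ≡.trans (cong (dq (fromℕ n) c) (VP.reverse-∷ m α))
  (≡.trans (dq-reverse-last n c (V.reverse α) m) (cong (λ β → ℤ.+ suc m * c β) (sym (VP.reverse-∷ (suc m) α))))
dq-reverse {suc n} (suc q) c (m ∷ α) = ≡.trans (cong (dq (inject₁ (opposite q)) c) (VP.reverse-∷ m α))
  (≡.trans (dq-inject₁ (opposite q) c (V.reverse α) m)
    (≡.trans (dq-reverse q (λ β → c (β ∷ʳ m)) α) (dq-cong q (λ β → cong c (sym (VP.reverse-∷ m β))) α)))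

reverse-replicate : ∀ n → V.reverse (V.replicate n 0) ≡ V.replicate n 0
reverse-replicate zero    = refl
reverse-replicate (suc n) = ≡.trans (VP.reverse-∷ 0 (V.replicate n 0)) (≡.trans (cong (_∷ʳ 0) (reverse-replicate n)) (sym (oneM-∷ʳ n)))

egf-reverse : ∀ (c : Ogf n) → egf (c ∘ V.reverse) ≋ opposite ^* egf c
egf-reverse {n} c []      = cong c (reverse-replicate n)
egf-reverse     c (q ∷ L) = ≡.trans (egf-cong (λ α → sym (dq-reverse q c α)) L) (egf-reverse (dq (opposite q) c) L)

lst-∷ʳ : ∀ (v : Vec ℕ n) m → lst (v ∷ʳ m) ≡ map inject₁ (lst v) ++ replicate m (fromℕ n)
lst-∷ʳ []      m = ListP.++-identityʳ (replicate m zero)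
lst-∷ʳ {suc n} (a ∷ v) m = begin
  replicate a zero ++ map suc (lst (v ∷ʳ m))
    ≡⟨ cong (λ L → replicate a zero ++ map suc L) (lst-∷ʳ v m) ⟩
  replicate a zero ++ map suc (map inject₁ (lst v) ++ replicate m (fromℕ n))
    ≡⟨ cong (replicate a zero ++_) (≡.trans (ListP.map-++ suc (map inject₁ (lst v)) _)
         (cong₂ _++_ (≡.trans (sym (ListP.map-∘ (lst v))) (ListP.map-∘ (lst v))) (ListP.map-replicate suc m (fromℕ n)))) ⟩
  replicate a zero ++ (map inject₁ (map suc (lst v)) ++ replicate m (fromℕ (suc n)))
    ≡⟨ sym (ListP.++-assoc (replicate a zero) _ _) ⟩
  (replicate a zero ++ map inject₁ (map suc (lst v))) ++ replicate m (fromℕ (suc n))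
    ≡⟨ cong (_++ replicate m (fromℕ (suc n))) (sym (≡.trans (ListP.map-++ inject₁ (replicate a zero) _)
         (cong (_++ map inject₁ (map suc (lst v))) (ListP.map-replicate inject₁ a zero)))) ⟩
  map inject₁ (lst (a ∷ v)) ++ replicate m (fromℕ (suc n)) ∎
  where open ≡-Reasoning

lst-reverse : ∀ (l : Vec ℕ n) → map opposite (lst l) ↭ lst (V.reverse l)
lst-reverse []      = refl
lst-reverse {suc n} (m ∷ l) = ↭-trans (↭-reflexive step)
  (↭-trans (↭P.++-comm (replicate m (fromℕ n)) _)
  (↭-trans (↭P.++⁺ʳ (replicate m (fromℕ n)) (↭P.map⁺ inject₁ (lst-reverse l)))
    (↭-reflexive (sym (≡.trans (cong lst (VP.reverse-∷ m l)) (lst-∷ʳ (V.reverse l) m))))))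
  where
  step : map opposite (lst (m ∷ l)) ≡ replicate m (fromℕ n) ++ map inject₁ (map opposite (lst l))
  step = ≡.trans (ListP.map-++ opposite (replicate m zero) _)
    (cong₂ _++_ (ListP.map-replicate opposite m zero) (≡.trans (sym (ListP.map-∘ (lst l))) (ListP.map-∘ (lst l))))

fins-∷ʳ : ∀ n → fins (suc n) ≡ map inject₁ (fins n) ++ [ fromℕ n ]
fins-∷ʳ zero    = refl
fins-∷ʳ (suc n) = cong (zero ∷_) (begin
  map suc (fins (suc n))                                 ≡⟨ cong (map suc) (fins-∷ʳ n) ⟩
  map suc (map inject₁ (fins n) ++ [ fromℕ n ])          ≡⟨ ListP.map-++ suc (map inject₁ (fins n)) _ ⟩
  map suc (map inject₁ (fins n)) ++ [ suc (fromℕ n) ]    ≡⟨ cong (_++ [ suc (fromℕ n) ]) (≡.trans (sym (ListP.map-∘ (fins n))) (ListP.map-∘ (fins n))) ⟩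
  map inject₁ (map suc (fins n)) ++ [ suc (fromℕ n) ]    ∎)
  where open ≡-Reasoning

map-opposite-fins : ∀ n → map opposite (fins n) ≡ Data.List.reverse (fins n)
map-opposite-fins zero    = refl
map-opposite-fins (suc n) = begin
  fromℕ n ∷ map opposite (map suc (fins n))
    ≡⟨ cong (fromℕ n ∷_) (≡.trans (sym (ListP.map-∘ (fins n))) (≡.trans (ListP.map-∘ (fins n)) (cong (map inject₁) (map-opposite-fins n)))) ⟩
  fromℕ n ∷ map inject₁ (Data.List.reverse (fins n))
    ≡⟨ cong (fromℕ n ∷_) (ListP.reverse-map inject₁ (fins n)) ⟩
  fromℕ n ∷ Data.List.reverse (map inject₁ (fins n))
    ≡⟨ sym (ListP.reverse-++ (map inject₁ (fins n)) [ fromℕ n ]) ⟩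
  Data.List.reverse (map inject₁ (fins n) ++ [ fromℕ n ])
    ≡⟨ cong Data.List.reverse (sym (fins-∷ʳ n)) ⟩
  Data.List.reverse (fins (suc n)) ∎
  where open ≡-Reasoning

-- The Vandermonde product of the nonnegativity argument and that of the alternants differ by a
-- reversal of the variables, which introduces no sign here.
vandᵈ-opposite : ∀ n → vandᵈ (fins n) ≋ opposite ^* vand (fins n)
vandᵈ-opposite n = ≋-sym (≋-trans (Involution.^*-vand FinP.opposite-involutive (fins n))
  (≋-trans (λ L → cong (λ is → vand is L) (map-opposite-fins n)) (vand-reverse (fins n))))

Above : ℕ → Vec ℕ n → Set
Above a []      = ⊤
Above a (b ∷ v) = b ℕ.< a × Above a v

Above-stair-tail : ∀ d t (w : Vec ℕ n) → Above (suc (d ℕ.+ 0) ℕ.+ t) (V.map (d ℕ.+_) (V.map suc w)) → Above t w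
Above-stair-tail d t []      _       = tt
Above-stair-tail d t (b ∷ w) (p , q) = ℕP.+-cancelˡ-< (suc d) b t
  (≡.subst₂ ℕ._<_ (ℕP.+-suc d b) (cong (λ z → suc (z ℕ.+ t)) (ℕP.+-identityʳ d)) p) , Above-stair-tail d t w q

stair-∷ʳ : ∀ (ds : Vec ℕ n) a → Above a (stair ds) → ∃[ es ] stair es ≡ stair ds ∷ʳ a
stair-∷ʳ []       a _ = (a ∷ []) , cong (_∷ []) (ℕP.+-identityʳ a)
stair-∷ʳ {suc n} (d ∷ ds) a (p , q) with t , refl ← ℕP.m≤n⇒∃[o]m+o≡n p
  with es , e ← stair-∷ʳ ds t (Above-stair-tail d t (stair ds) q)
  = (d ∷ es) , (begin
  V.map (d ℕ.+_) (0 ∷ V.map suc (stair es))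
    ≡⟨ cong (λ w → V.map (d ℕ.+_) (0 ∷ V.map suc w)) e ⟩
  V.map (d ℕ.+_) (0 ∷ V.map suc (stair ds ∷ʳ t))
    ≡⟨ cong (λ w → V.map (d ℕ.+_) (0 ∷ w)) (VP.map-∷ʳ suc t (stair ds)) ⟩
  (d ℕ.+ 0) ∷ V.map (d ℕ.+_) (V.map suc (stair ds) ∷ʳ suc t)
    ≡⟨ cong ((d ℕ.+ 0) ∷_) (VP.map-∷ʳ (d ℕ.+_) (suc t) (V.map suc (stair ds))) ⟩
  (d ℕ.+ 0) ∷ (V.map (d ℕ.+_) (V.map suc (stair ds)) ∷ʳ (d ℕ.+ suc t))
    ≡⟨ cong (λ z → (d ℕ.+ 0) ∷ (V.map (d ℕ.+_) (V.map suc (stair ds)) ∷ʳ z))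
         (≡.trans (ℕP.+-suc d t) (cong (λ z → suc (z ℕ.+ t)) (sym (ℕP.+-identityʳ d)))) ⟩
  stair (d ∷ ds) ∷ʳ (suc (d ℕ.+ 0) ℕ.+ t) ∎)
  where open ≡-Reasoning

Strict⇒Above : ∀ a (v : Vec ℕ n) → Strict (a ∷ v) → Above a v
Strict⇒Above a []      s       = tt
Strict⇒Above a (b ∷ v) (p , s) = p , weaken (ℕP.<⇒≤ p) v (Strict⇒Above b v s)
  where
  weaken : ∀ {n a b} → b ℕ.≤ a → (v : Vec ℕ n) → Above b v → Above a v
  weaken p []      _       = tt
  weaken p (c ∷ v) (q , r) = ℕP.<-≤-trans q p , weaken p v r

Above-reverse : ∀ a (v : Vec ℕ n) → Above a v → Above a (V.reverse v)
Above-reverse a []      _       = tt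
Above-reverse a (b ∷ v) (p , q) = subst (Above a) (sym (VP.reverse-∷ b v)) (snoc (V.reverse v) (Above-reverse a v q))
  where
  snoc : ∀ {m} (u : Vec ℕ m) → Above a u → Above a (u ∷ʳ b)
  snoc []      _       = p , tt
  snoc (c ∷ u) (r , s) = r , snoc u s

Strict-tail : ∀ a (v : Vec ℕ n) → Strict (a ∷ v) → Strict v
Strict-tail a []      s       = tt
Strict-tail a (b ∷ v) (_ , s) = s

-- Passes from the decreasing exponents of the expansion to the increasing ones of
-- `vand-Res-nonneg`.
reverse-stair : ∀ (l : Vec ℕ n) → Strict l → ∃[ ds ] stair ds ≡ V.reverse l
reverse-stair []      s = [] , refl
reverse-stair (a ∷ v) s with ds , e ← reverse-stair v (Strict-tail a v s)
  with es , e′ ← stair-∷ʳ ds a (subst (Above a) (sym e) (Above-reverse a v (Strict⇒Above a v s)))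
  = es , ≡.trans e′ (≡.trans (cong (_∷ʳ a) e) (sym (VP.reverse-∷ a v)))

length-lst : ∀ (v : Vec ℕ n) → length (lst v) ≡ V.sum v
length-lst []      = refl
length-lst (m ∷ v) = ≡.trans (ListP.length-++ (replicate m zero))
  (cong₂ ℕ._+_ (ListP.length-replicate m) (≡.trans (ListP.length-map suc (lst v)) (length-lst v)))

Top-sum : ∀ {N} (v : Vec ℕ n) → V.sum v ℕ.< N → Top N v
Top-sum []      p = tt
Top-sum (a ∷ v) p = ℕP.≤-trans (ℕP.m≤m+n a (V.sum v)) (ℕP.<⇒≤ p)

-- Schur positivity for stable families

module _ {n : ℕ} (1≤n : 1 ≤ n) {𝒮 : List (Subset n)} (st : Stable 𝒮) where
  private
    fam : Family (map elems 𝒮)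
    fam = Stable⇒Family st

    module F = Forms n n

    -- Reversed in anticipation of `kostka-schur`; the product is symmetric, so `egf-c` finds the
    -- same series.
    c : Ogf n
    c = coeffs (prodP (map XS 𝒮)) ∘ V.reverse

    egf-c : egf c ≋ subsetSer 𝒮
    egf-c = ≋-trans (egf-reverse (coeffs (prodP (map XS 𝒮))))
      (≋-trans (λ L → egf-coeffs 𝒮 (map opposite L)) (subsetSer-symmetric st FinP.opposite-involutive))

    Sym-c : Sym c
    Sym-c k = egf-injective (≋-trans (egf-swapAt k c)
      (≋-trans (λ L → egf-c (map (τ k) L)) (≋-trans (subsetSer-symmetric st (τ-involutive k)) (≋-sym egf-c))))

    scale : ℤ
    scale = F.scale fam (map elems 𝒮)

    scale-pos : 0ℤ ℤ.< scale
    scale-pos = F.scale-pos fam (AllP.map⁺ (All.universal (λ S → pred< (length-elems≤ S)) 𝒮))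
      where
      pred< : ∀ {m} → m ℕ.≤ n → ℕ.pred m ℕ.< n
      -- The truncated predecessor assigns tail length 0 to the empty subset, which fits under the
      -- bound n since n is positive.
      pred< {zero}  _ = 1≤n
      pred< {suc m} p = p

    Res-form : Matrices.Res n (F.form (map elems 𝒮)) ≋ scale · subsetSer 𝒮
    Res-form = ≋-trans (F.Res-form fam) (·-cong scale
      (≋-trans (λ L → cong (λ us → ∏lin us L) (sym (ListP.map-∘ 𝒮))) (∏lin-cong 𝒮 (λ S _ → χ-elems S))))

    vand-nonneg : ∀ ds → 0ℤ ℤ.≤ (vand (fins n) ⊛ subsetSer 𝒮) (lst (stair ds))
    vand-nonneg ds = cancel-pos scale-pos (subst (0ℤ ℤ.≤_) e (vand-Res-nonneg n (F.Good-form fam) ds))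
      where
      V P : Ser (Fin n)
      V = vand (fins n)
      P = subsetSer 𝒮
      e : (V ⊛ Matrices.Res n (F.form (map elems 𝒮))) (lst (stair ds)) ≡ scale * (V ⊛ P) (lst (stair ds))
      e = ≡.trans (⊛-congˡ {F = V} Res-form (lst (stair ds))) (≡.trans (⊛-comm V (scale · P) (lst (stair ds)))
        (≡.trans (·-⊛ scale P V (lst (stair ds))) (cong (scale *_) (⊛-comm P V (lst (stair ds))))))

    alternant-nonneg : ∀ l → Strict l → 0ℤ ℤ.≤ alternant c l
    alternant-nonneg l s with ds , e ← reverse-stair l s =
      cancel-pos (vfact-pos l) (subst (0ℤ ℤ.≤_) (sym path) (vand-nonneg ds))
      where
      open ≡-Reasoning
      V P : Ser (Fin n)
      V = vand (fins n)
      P = subsetSer 𝒮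
      path : vfact l * alternant c l ≡ (V ⊛ P) (lst (stair ds))
      path = begin
        vfact l * alternant c l                           ≡⟨ sym (egf-lst (alternant c) l) ⟩
        egf (alternant c) (lst l)                         ≡⟨ egf-opA (fins n) c (lst l) ⟩
        (vandᵈ (fins n) ⊛ egf c) (lst l)                  ≡⟨ ⊛-cong (vandᵈ-opposite n)
                                                               (≋-trans egf-c (≋-sym (subsetSer-symmetric st FinP.opposite-involutive))) (lst l) ⟩
        ((opposite ^* V) ⊛ (opposite ^* P)) (lst l)       ≡⟨ sym (^*-⊛ opposite V P (lst l)) ⟩
        (V ⊛ P) (map opposite (lst l))                    ≡⟨ perm (Comm-⊛ (Comm-vand (fins n)) (Comm-∏lin (map mem 𝒮))) (lst-reverse l) ⟩
        (V ⊛ P) (lst (V.reverse l))                       ≡⟨ cong (λ v → (V ⊛ P) (lst v)) (sym e) ⟩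
        (V ⊛ P) (lst (stair ds))                          ∎

    total N : ℕ
    total = length 𝒮 ℕ.+ tri n
    N = suc total

    -- Only l = λ + δ with |λ| equal to the number of factors can carry a coefficient. The absolute
    -- value yields a natural number and is the coefficient itself by `alternant-nonneg`.
    entry : ∀ l → strict l ≡ 0ℤ ⊎ Strict l → Dec (V.sum l ≡ total) → List (List ℕ × ℕ)
    entry l (inj₂ _) (yes _) = (strip (shape l) , ℤ.∣ alternant c l ∣) ∷ []
    entry l _        _       = []

    entries : List (List ℕ × ℕ)
    entries = concatMap (λ l → entry l (strict-cases l) (V.sum l ℕP.≟ total)) (box N n)

    partitions : All (λ lk → IsPartition (proj₁ lk)) entries
    partitions = AllP.concat⁺ (AllP.map⁺ (All.universal (λ l → go l (strict-cases l) (V.sum l ℕP.≟ total)) (box N n)))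
      where
      go : ∀ l s d → All (λ lk → IsPartition (proj₁ lk)) (entry l s d)
      go l (inj₁ _) _       = []
      go l (inj₂ s) (no _)  = []
      go l (inj₂ s) (yes _) = strip-partition (shape l) (Decr-shape l s) ∷ []

    value : Mono n → List ℕ × ℕ → ℤ
    value α (λ′ , κ) = ℤ.+ κ * ∑ (schur n λ′) (λ β → eqV β α)

    entry-value : ∀ α l s d → ∑ (entry l s d) (value α) ≡ strict l * (alternant c l * kostka N l (V.reverse α))
                  ⊎ (V.sum l ≢ total × ∑ (entry l s d) (value α) ≡ 0ℤ)
    entry-value α l (inj₁ e) d = inj₁ (sym (≡.trans (cong (_* (alternant c l * kostka N l (V.reverse α))) e) (ℤP.*-zeroˡ (alternant c l * kostka N l (V.reverse α)))))
    entry-value α l (inj₂ s) (no ne) = inj₂ (ne , refl)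
    entry-value α l (inj₂ s) (yes e) = inj₁ (begin
      ℤ.+ ℤ.∣ alternant c l ∣ * ∑ (schur n (strip (shape l))) (λ β → eqV β α) + 0ℤ
        ≡⟨ ℤP.+-identityʳ _ ⟩
      ℤ.+ ℤ.∣ alternant c l ∣ * ∑ (schur n (strip (shape l))) (λ β → eqV β α)
        ≡⟨ cong₂ _*_ (ℤP.0≤i⇒+∣i∣≡i (alternant-nonneg l s)) (begin
             ∑ (schur n (strip (shape l))) (λ β → eqV β α)
               ≡⟨ ∑-schur n (strip (shape l)) (λ β → eqV β α) ⟩
             schurSum n (strip (shape l)) (λ β → eqV β α)
               ≡⟨ schurSum-strip (shape l) (Decr-shape l s) (λ β → eqV β α) ⟩
             schurSum n (shape l) (λ β → eqV β α)
               ≡⟨ cong (λ α → schurSum n (shape l) (λ β → eqV β α)) (sym (VP.reverse-involutive α)) ⟩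
             schurSum n (shape l) (λ β → eqV β (V.reverse (V.reverse α)))
               ≡⟨ sym (kostka-schur N l s (Top-sum l (s≤s (ℕP.≤-reflexive e))) (V.reverse α)) ⟩
             kostka N l (V.reverse α) ∎) ⟩
      alternant c l * kostka N l (V.reverse α)
        ≡⟨ sym (≡.trans (cong (_* (alternant c l * kostka N l (V.reverse α))) (strict-yes l s)) (ℤP.*-identityˡ _)) ⟩
      strict l * (alternant c l * kostka N l (V.reverse α)) ∎)
      where open ≡-Reasoning

    kostka-zero : ∀ α l → V.sum l ≢ V.sum (V.reverse α) ℕ.+ tri n → strict l * (alternant c l * kostka N l (V.reverse α)) ≡ 0ℤ
    kostka-zero α l ne with kostka-size N l (V.reverse α)
    ... | inj₁ e = ≡.trans (cong (λ z → strict l * (alternant c l * z)) e) (lemma (strict l) (alternant c l))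
      where
      lemma : ∀ a b → a * (b * 0ℤ) ≡ 0ℤ
      lemma = solve-∀
    ... | inj₂ e = ⊥-elim (ne e)

    -- If α has the degree of the product, it is within the range of `schur-expansion`. For every
    -- other α both sides vanish, the left one by the size condition on Kostka numbers, the right
    -- one by homogeneity.
    expansion : ∀ α → ∑ entries (value α) ≡ c (V.reverse α)
    expansion α with V.sum (V.reverse α) ℕP.≟ length 𝒮
    ... | yes e = ≡.trans (∑-concatMap _ (box N n) (value α)) (≡.trans (∑-cong (box N n) term)
        (sym (schur-expansion c Sym-c (V.reverse α) (s≤s (ℕP.≤-reflexive (cong (ℕ._+ tri n) e))))))
      where
      term : ∀ l → ∑ (entry l (strict-cases l) (V.sum l ℕP.≟ total)) (value α) ≡ strict l * (alternant c l * kostka N l (V.reverse α))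
      term l with entry-value α l (strict-cases l) (V.sum l ℕP.≟ total)
      ... | inj₁ e′        = e′
      ... | inj₂ (ne , e′) = ≡.trans e′ (sym (kostka-zero α l (λ e″ → ne (≡.trans e″ (cong (ℕ._+ tri n) e)))))
    ... | no ne = ≡.trans (∑-concatMap _ (box N n) (value α)) (≡.trans (∑-zero (box N n) term) (sym vanish))
      where
      term : ∀ l → ∑ (entry l (strict-cases l) (V.sum l ℕP.≟ total)) (value α) ≡ 0ℤ
      term l with strict-cases l | V.sum l ℕP.≟ total
      ... | inj₁ _ | _     = refl
      ... | inj₂ _ | no _  = refl
      ... | inj₂ s | yes e with entry-value α l (inj₂ s) (yes e)
      ... | inj₁ e′       = ≡.trans e′ (kostka-zero α l (λ e″ → ne (ℕP.+-cancelʳ-≡ (tri n) _ _ (≡.trans (sym e″) e))))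
      ... | inj₂ (_ , e′) = e′
      vanish : c (V.reverse α) ≡ 0ℤ
      vanish = *-cancelˡ-pos (vfact-pos (V.reverse α)) (≡.trans (sym (egf-lst c (V.reverse α)))
        (≡.trans (egf-c (lst (V.reverse α))) (≡.trans
          (subsetSer-degree 𝒮 (lst (V.reverse α)) (λ e → ne (≡.trans (sym (length-lst (V.reverse α))) e)))
          (sym (ℤP.*-zeroʳ (vfact (V.reverse α)))))))

    -- The summand in `SchurPositive` is an anonymous function, so it enters as a `g` together with
    -- its defining equation.
    ∑-combination : ∀ (g : List ℕ × ℕ → Poly n → Poly n) → (∀ λ′ κ acc → g (λ′ , κ) acc ≡ scaleP κ (schur n λ′) +P acc) →
      ∀ cs f → ∑ (foldr g [] cs) f ≡ ∑ cs (λ lk → ℤ.+ proj₂ lk * ∑ (schur n (proj₁ lk)) f)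
    ∑-combination g e []              f = refl
    ∑-combination g e ((λ′ , κ) ∷ cs) f = ≡.trans (cong (λ p → ∑ p f) (e λ′ κ (foldr g [] cs)))
      (≡.trans (∑-++ (scaleP κ (schur n λ′)) _ f) (cong₂ _+_ (∑-scaleP κ) (∑-combination g e cs f)))
      where
      ∑-scaleP : ∀ κ → ∑ (scaleP κ (schur n λ′)) f ≡ ℤ.+ κ * ∑ (schur n λ′) f
      ∑-scaleP zero    = sym (ℤP.*-zeroˡ (∑ (schur n λ′) f))
      ∑-scaleP (suc κ) = ≡.trans (∑-++ (schur n λ′) _ f) (≡.trans (cong (∑ (schur n λ′) f +_) (∑-scaleP κ)) (lemma (∑ (schur n λ′) f) (ℤ.+ κ)))
        where
        lemma : ∀ a b → a + b * a ≡ (1ℤ + b) * a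
        lemma = solve-∀

    coeff-combination : ∀ (g : List ℕ × ℕ → Poly n → Poly n) → (∀ λ′ κ acc → g (λ′ , κ) acc ≡ scaleP κ (schur n λ′) +P acc) →
      ∀ cs α → ℤ.+ coeff α (foldr g [] cs) ≡ ∑ cs (value α)
    coeff-combination g e cs α = ≡.trans (coeff-∑ α (foldr g [] cs)) (∑-combination g e cs (λ β → eqV β α))

  -- Only equality of coefficients with one flat product is asked of `p`, so that a nested product
  -- such as `Bn` is covered.
  stable⇒SchurPositive : ∀ p → (∀ α → coeffs p α ≡ coeffs (prodP (map XS 𝒮)) α) → SchurPositive n p
  stable⇒SchurPositive p e = entries , partitions , λ α → ℤP.+-injective (≡.trans (p-coeff α) (sym (coeff-combination _ (λ _ _ _ → refl) entries α)))
    where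
    open ≡-Reasoning
    p-coeff : ∀ α → ℤ.+ coeff α p ≡ ∑ entries (value α)
    p-coeff α = begin
      ℤ.+ coeff α p                           ≡⟨ coeff-∑ α p ⟩
      coeffs p α                              ≡⟨ e α ⟩
      coeffs (prodP (map XS 𝒮)) α             ≡⟨ cong (coeffs (prodP (map XS 𝒮))) (sym (VP.reverse-involutive α)) ⟩
      c (V.reverse α)                         ≡⟨ sym (expansion α) ⟩
      ∑ entries (value α)                     ∎

-- Subsets of a given size, and the theorem

allSubsets-complete : ∀ (S : Subset n) → S ∈ allSubsets n
allSubsets-complete []      = here refl
allSubsets-complete (b ∷ S) = ∈-concat⁺′ (pick b) (∈-map⁺ (λ s → (true ∷ s) ∷ (false ∷ s) ∷ []) (allSubsets-complete S))
  where
  pick : ∀ b → b ∷ S ∈ (true ∷ S) ∷ (false ∷ S) ∷ []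
  pick true  = here refl
  pick false = there (here refl)

allSubsets-unique : ∀ n → Unique (allSubsets n)
allSubsets-unique zero    = [] ∷ []
allSubsets-unique (suc n) = UniqueP.concat⁺
  (AllP.map⁺ (All.universal (λ _ → ((λ ()) ∷ []) ∷ [] ∷ []) (allSubsets n)))
  (AllPairsP.map⁺ (AllPairs.map (λ ne → λ { (p , q) → ne (≡.trans (sym (tail p)) (tail q)) }) (allSubsets-unique n)))
  where
  tail : ∀ {S : Subset n} {T} → T ∈ (true ∷ S) ∷ (false ∷ S) ∷ [] → V.tail T ≡ S
  tail (here refl)         = refl
  tail (there (here refl)) = refl

layer : ∀ n → ℕ → List (Subset n)
layer n k = filter (λ S → ∣ S ∣ ℕ.≟ k) (allSubsets n)

∈-layer : ∀ {k} {S : Subset n} → ∣ S ∣ ≡ k → S ∈ layer n k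
∈-layer {k = k} {S} e = ∈-filter⁺ (λ S → ∣ S ∣ ℕ.≟ k) (allSubsets-complete S) e

layer-size : ∀ {k} {S : Subset n} → S ∈ layer n k → ∣ S ∣ ≡ k
layer-size {n} {k} m = proj₂ (∈-filter⁻ (λ S → ∣ S ∣ ℕ.≟ k) {xs = allSubsets n} m)

layer-stable : ∀ n k → Stable (layer n k)
layer-stable n k = record
  { unique = UniqueP.filter⁺ (λ S → ∣ S ∣ ℕ.≟ k) (allSubsets-unique n)
  ; stable = λ inv {S} m → ∈-layer (≡.trans (∣permute∣ inv S) (layer-size m)) }

layers : ∀ n → List (Subset n)
layers n = concatMap (λ k → layer n (suc k)) (upTo n)

layers-stable : ∀ n → Stable (layers n)
layers-stable n = record
  { unique = UniqueP.concat⁺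
      (AllP.map⁺ (All.universal (λ k → Stable.unique (layer-stable n (suc k))) (upTo n)))
      (AllPairsP.map⁺ (AllPairs.map (λ ne → λ { (p , q) → ne (ℕP.suc-injective (≡.trans (sym (layer-size p)) (layer-size q))) }) (UniqueP.upTo⁺ n)))
  ; stable = stable }
  where
  stable : ∀ {φ : Fin n → Fin n} → Involutive φ → ∀ {S} → S ∈ layers n → permute φ S ∈ layers n
  stable inv {S} m with ∈-concat⁻′ (map (λ k → layer n (suc k)) (upTo n)) m
  ... | _ , m₁ , m₂ with ∈-map⁻ (λ k → layer n (suc k)) m₂
  ... | k , k∈ , refl = ∈-concat⁺′ (Stable.stable (layer-stable n (suc k)) inv m₁) (∈-map⁺ (λ k → layer n (suc k)) k∈)

∑-prodP-++ : ∀ (xs ys : List (Subset n)) f →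
  ∑ (prodP (map XS (xs ++ ys))) f ≡ ∑ (prodP (map XS xs)) (λ a → ∑ (prodP (map XS ys)) (λ b → f (a *M b)))
∑-prodP-++ []       ys f = sym (≡.trans (ℤP.+-identityʳ _) (∑-cong (prodP (map XS ys)) (λ b → cong f (*M-identityˡ b))))
∑-prodP-++ (S ∷ xs) ys f = begin
  ∑ (XS S *P prodP (map XS (xs ++ ys))) f
    ≡⟨ ∑-*P (XS S) (prodP (map XS (xs ++ ys))) f ⟩
  ∑ (XS S) (λ a → ∑ (prodP (map XS (xs ++ ys))) (λ b → f (a *M b)))
    ≡⟨ ∑-cong (XS S) (λ a → ≡.trans (∑-prodP-++ xs ys (λ b → f (a *M b)))
         (∑-cong (prodP (map XS xs)) (λ b → ∑-cong (prodP (map XS ys)) (λ d → cong f (sym (*M-assoc a b d)))))) ⟩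
  ∑ (XS S) (λ a → ∑ (prodP (map XS xs)) (λ b → ∑ (prodP (map XS ys)) (λ d → f ((a *M b) *M d))))
    ≡⟨ sym (∑-*P (XS S) (prodP (map XS xs)) _) ⟩
  ∑ (XS S *P prodP (map XS xs)) (λ a → ∑ (prodP (map XS ys)) (λ b → f (a *M b))) ∎
  where open ≡-Reasoning

∑-prodP-concatMap : ∀ (F : A → List (Subset n)) ks f →
  ∑ (prodP (map (λ k → prodP (map XS (F k))) ks)) f ≡ ∑ (prodP (map XS (concatMap F ks))) f
∑-prodP-concatMap F []       f = refl
∑-prodP-concatMap F (k ∷ ks) f = ≡.trans (∑-*P (prodP (map XS (F k))) _ f)
  (≡.trans (∑-cong (prodP (map XS (F k))) (λ a → ∑-prodP-concatMap F ks (λ b → f (a *M b))))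
    (sym (∑-prodP-++ (F k) (concatMap F ks) f)))

theorem1p1 : (n : ℕ) → 1 ≤ n →
    ((k : ℕ) → 1 ≤ k → k ≤ n → SchurPositive n (B n k)) × SchurPositive n (Bn n)
theorem1p1 n 1≤n =
  (λ k _ _ → stable⇒SchurPositive 1≤n (layer-stable n k) (B n k) (λ _ → refl)) ,
  stable⇒SchurPositive 1≤n (layers-stable n) (Bn n) (λ α → ∑-prodP-concatMap (λ k → layer n (suc k)) (upTo n) (λ β → eqV β α))
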